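{- Let $q$ be a power of an odd prime and put $N=q+1$. Define $I_q(B,C)=(-1)^{N/2}\,\mathcal V_{N/2}(B,C)$ and $P_q(B,C)=\Lambda_N(B,C)$ in $\mathbb F_q[B,C]$. Then for every primitive element $c$ of $\mathbb F_q$: (1) $I_q(B,c)\in\mathbb F_q[B]$ has $N/2$ roots in $\mathbb F_q$, which are exactly the coefficients $b\in\mathbb F_q$ for which $X^2+bX+c$ is irreducible over $\mathbb F_q$; (2) $P_q(B,c)\in\mathbb F_q[B]$ has $\varphi(N)$ roots in $\mathbb F_q$, which are exactly the coefficients $b\in\mathbb F_q$ for which $X^2+bX+c$ is primitive over $\mathbb F_q$. Therefore $P_q(B,C)$ is an optimal determining polynomial for primitive quadratic polynomials over $\mathbb F_q$.
   Context: $\varphi$ is Euler's totient function. A primitive element of $\mathbb F_q$ is a generator of $\mathbb F_q^*$. A monic polynomial of degree $k\ge 1$ over $\mathbb F_q$ is primitive if it is the minimal polynomial over $\mathbb F_q$ of a generator of $\mathbb F_{q^k}^*$. Lucas polynomials: let $B,C$ be algebraically independent indeterminates over $\mathbb F_q$. Define $\mathcal V_0=2$, $\mathcal V_1=-B$, $\mathcal V_n=-B\,\mathcal V_{n-1}-C\,\mathcal V_{n-2}$ for $n\ge 2$ (Lucas polynomials of the second type). Lucas atoms: let $\alpha,\beta$ be the two roots of $T^2+BT+C$ in an algebraic closure of $\mathbb F_q(B,C)$. Let $\Phi_n(X)\in\mathbb F_q[X]$ be the $n$-th cyclotomic polynomial (the image of the integral one) and $\Phi_n^{\mathrm{hom}}(\alpha,\beta)=\beta^{\varphi(n)}\Phi_n(\alpha/\beta)$.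 For $n\ge 2$ the $n$-th Lucas atom $\Lambda_n(B,C)\in\mathbb F_q[B,C]$ is the unique polynomial with $\Lambda_n(B,C)=\Phi_n^{\mathrm{hom}}(\alpha,\beta)$; $\Lambda_1=1$. A polynomial $P(B,C)\in\mathbb F_q[B,C]$ is called an optimal determining polynomial for primitive quadratic polynomials over $\mathbb F_q$ if for every primitive element $c$ of $\mathbb F_q$ the polynomial $P(B,c)\in\mathbb F_q[B]$ is monic and square-free and its roots are exactly the $b\in\mathbb F_q$ for which $X^2+bX+c$ is primitive, i.e. $P(B,c)=\prod_{b}(B-b)$, the product being over all $b\in\mathbb F_q$ with $X^2+bX+c$ primitive over $\mathbb F_q$. -}

module Defs where

open import Level using (Level; _⊔_; suc)
open import Algebra.Bundles using (CommutativeRing)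
open import Algebra.Bundles.Raw using (RawRing)
import Algebra.Definitions.RawSemiring as RawSemiringDefs
open import Algebra.Morphism.Structures using (module RingMorphisms)
open import Data.Fin.Base using (Fin; toℕ)
open import Data.Integer.Base as ℤ using (ℤ; +_; -[1+_])
open import Data.List.Base as List
  using (List; []; _∷_; _++_; length; map; filter; foldr; replicate; take; upTo)
import Data.List.Membership.Setoid as Membership
import Data.List.Relation.Unary.Unique.Setoid as UniqueSetoid
open import Data.Nat.Base as ℕ using (ℕ; _∸_; _<_; _≤_)
open import Data.Nat.Coprimality using (coprime?)
open import Data.Nat.DivMod using (_/_)
open import Data.Nat.Divisibility using (_∣?_)
open import Data.Product.Base using (_×_; _,_; proj₁; proj₂; ∃-syntax; Σ-syntax)
open import Function.Bundles using (Inverse; _⇔_)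
open import Relation.Binary.PropositionalEquality.Core using (_≡_)
import Relation.Binary.PropositionalEquality.Properties as ≡

private
  variable
    a ℓ : Level

------------------------------------------------------------------------
-- Polynomials

coeff : (R : RawRing a ℓ) → List (RawRing.Carrier R) → ℕ → RawRing.Carrier R
coeff R []       i         = RawRing.0# R
coeff R (x ∷ xs) 0         = x
coeff R (x ∷ xs) (ℕ.suc i) = coeff R xs i

-- Coefficients are listed from the constant term upwards.  Trailing
-- zeros are allowed, and invisible to the equality.
_[X] : RawRing a ℓ → RawRing a ℓ
_[X] {a} {ℓ} R = record
  { Carrier = List Carrier
  ; _≈_     = λ f g → ∀ i → coeff R f i ≈ coeff R g i
  ; _+_     = add
  ; _*_     = mul
  ; -_      = map -_
  ; 0#      = []
  ; 1#      = 1# ∷ []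
  }
  where
  open RawRing R

  add : List Carrier → List Carrier → List Carrier
  add []      g       = g
  add (x ∷ f) []      = x ∷ f
  add (x ∷ f) (y ∷ g) = x + y ∷ add f g

  mul : List Carrier → List Carrier → List Carrier
  mul []      g = []
  mul (x ∷ f) g = add (map (x *_) g) (0# ∷ mul f g)

module Polynomial (R : RawRing a ℓ) where

  open RawRing R
  private module R[X] = RawRing (R [X])

  const : Carrier → R[X].Carrier
  const x = x ∷ []

  X : R[X].Carrier
  X = 0# ∷ 1# ∷ []

  -- X² + b X + c
  quadratic : Carrier → Carrier → R[X].Carrier
  quadratic b c = c ∷ b ∷ 1# ∷ []

  eval : R[X].Carrier → Carrier → Carrier
  eval f x = foldr (λ y r → y + x * r) 0# f

  IsRoot : R[X].Carrier → Carrier → Set ℓ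
  IsRoot f x = eval f x ≈ 0#

  IsMonicOfDegree : R[X].Carrier → ℕ → Set ℓ
  IsMonicOfDegree f n = coeff R f n ≈ 1# × (∀ m → n < m → coeff R f m ≈ 0#)

  IsMonic : R[X].Carrier → Set ℓ
  IsMonic f = ∃[ n ] IsMonicOfDegree f n

  IsSquareFree : R[X].Carrier → Set (a ⊔ ℓ)
  IsSquareFree f = ∀ g → (g R[X].* g) ∣ f → g ∣ R[X].1#
    where open RawSemiringDefs R[X].rawSemiring using (_∣_)

  IsIrreducible : R[X].Carrier → Set (a ⊔ ℓ)
  IsIrreducible = RawSemiringDefs.Irreducible R[X].rawSemiring

  -- ∏ (X - x), over the x in the list
  fromRoots : List Carrier → R[X].Carrier
  fromRoots = foldr (λ x f → (X R[X].+ const (- x)) R[X].* f) R[X].1#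

  -- Quotient and remainder of f by a monic g whose last listed
  -- coefficient is its leading 1: if f = Q g + r then
  -- x + X f = (t + X Q) g + (x + X r - t g), with t the coefficient
  -- of x + X r in degree deg g.
  quotRem : R[X].Carrier → R[X].Carrier → R[X].Carrier × R[X].Carrier
  quotRem []      g = [] , []
  quotRem (x ∷ f) g =
    let Q , r = quotRem f g
        t     = coeff R (x ∷ r) (ℕ.pred (length g))
    in  t ∷ Q , (x ∷ r) R[X].+ (R[X].- (const t R[X].* g))

  -- Keeps only deg f - deg g + 1 entries, so that the last entry of
  -- the quotient of two such monic polynomials is again a leading 1.
  quot : R[X].Carrier → R[X].Carrier → R[X].Carrier
  quot f g = take (ℕ.suc (length f) ∸ length g) (proj₁ (quotRem f g))

------------------------------------------------------------------------
-- Totient and cyclotomic polynomials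

φ : ℕ → ℕ
φ n = length (filter (λ k → coprime? k n) (map ℕ.suc (upTo n)))

ℤ-rawRing : RawRing Level.zero Level.zero
ℤ-rawRing = ℤ.+-*-rawRing

ℤ[X] : RawRing Level.zero Level.zero
ℤ[X] = ℤ-rawRing [X]

private module ℤ[X] = RawRing ℤ[X]

Xⁿ⁺¹-1 : ℕ → ℤ[X].Carrier
Xⁿ⁺¹-1 n = ℤ.- (+ 1) ∷ replicate n (+ 0) ++ + 1 ∷ []

-- Φₙ = (Xⁿ - 1) / ∏ Φ_d, over the proper divisors d of n (Φ₀ is junk).
mutual
  cyclotomic : ℕ → ℤ[X].Carrier
  cyclotomic 0         = ℤ[X].1#
  cyclotomic (ℕ.suc n) =
    Polynomial.quot ℤ-rawRing (Xⁿ⁺¹-1 n)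
      (foldr ℤ[X]._*_ ℤ[X].1#
        (map proj₂ (filter (λ dΦ → proj₁ dΦ ∣? ℕ.suc n) (cyclotomicsUpTo n))))

  -- The pairs (d , Φ_d), for d = n , … , 1
  cyclotomicsUpTo : ℕ → List (ℕ × ℤ[X].Carrier)
  cyclotomicsUpTo 0         = []
  cyclotomicsUpTo (ℕ.suc n) =
    (ℕ.suc n , cyclotomic (ℕ.suc n)) ∷ cyclotomicsUpTo n

module _ (R : RawRing a ℓ) where

  open RawRing R
  open RawSemiringDefs rawSemiring using () renaming (_×_ to _·_)

  fromℤ : ℤ → Carrier
  fromℤ (+ n)    = n · 1#
  fromℤ -[1+ n ] = - (ℕ.suc n · 1#)

  cyclotomicOver : ℕ → RawRing.Carrier (R [X])
  cyclotomicOver n = map fromℤ (cyclotomic n)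

------------------------------------------------------------------------
-- R[T] / (T² + b T + c), free over R on 1 and the class of T: the pair
-- (u , v) stands for u + v T.

module AdjoinQuadraticRoot (R : RawRing a ℓ) (b c : RawRing.Carrier R) where

  open RawRing R

  extension : RawRing a ℓ
  extension = record
    { Carrier = Carrier × Carrier
    ; _≈_     = λ (u , v) (u′ , v′) → u ≈ u′ × v ≈ v′
    ; _+_     = λ (u , v) (u′ , v′) → u + u′ , v + v′
    ; _*_     = λ (u , v) (u′ , v′) →
                  u * u′ + - (c * (v * v′)) ,
                  u * v′ + v * u′ + - (b * (v * v′))
    ; -_      = λ (u , v) → - u , - v
    ; 0#      = 0# , 0#
    ; 1#      = 1# , 0#
    }

  ι : Carrier → RawRing.Carrier extension
  ι u = u , 0#

  -- The two roots of T² + b T + c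
  root₁ root₂ : RawRing.Carrier extension
  root₁ = 0# , 1#
  root₂ = - b , - 1#

------------------------------------------------------------------------
-- Polynomials in B and C

module Bivariate (R : RawRing a ℓ) where

  -- R[B,C] is represented as R[B][C].
  R[B] R[B,C] : RawRing a ℓ
  R[B]   = R [X]
  R[B,C] = R[B] [X]

  open RawRing R[B,C]
  open RawSemiringDefs rawSemiring using (_^_)

  B C : Carrier
  B = Polynomial.const R[B] (Polynomial.X R)
  C = Polynomial.X R[B]

  -- P(B , c)
  specialise : Carrier → RawRing.Carrier R → RawRing.Carrier R[B]
  specialise P c = Polynomial.eval R[B] P (Polynomial.const R c)

  lucasV : ℕ → Carrier
  lucasV 0                   = 1# + 1#
  lucasV 1                   = - B
  lucasV (ℕ.suc (ℕ.suc n)) = - B * lucasV (ℕ.suc n) + - (C * lucasV n)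

  -- T² + B T + C is irreducible over the fraction field of R[B,C] when
  -- R is a field, so R[B,C][T]/(T² + B T + C) is the subring R[B,C][α]
  -- of the algebraic closure, which contains β too.
  open AdjoinQuadraticRoot R[B,C] B C public
    using (ι) renaming (extension to R[B,C][α]; root₁ to α; root₂ to β)

  private module E where
    open RawRing R[B,C][α] public
    open RawSemiringDefs (RawRing.rawSemiring R[B,C][α]) public using (sum; _^_)

  -- β ^ φ(n) Φₙ(α / β), written out as ∑ aᵢ αⁱ β ^ (φ(n) - i) where
  -- Φₙ = ∑ aᵢ Xⁱ
  Φʰᵒᵐ : ℕ → E.Carrier
  Φʰᵒᵐ n = E.sum {ℕ.suc (φ n)} λ i →
    embed (coeff R (cyclotomicOver R n) (toℕ i))
      E.* (α E.^ toℕ i) E.* (β E.^ (φ n ∸ toℕ i))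
    where
    embed : RawRing.Carrier R → E.Carrier
    embed x = ι (Polynomial.const R[B] (Polynomial.const R x))

  -- The defining equation of the n-th Lucas atom, for n ≥ 2
  IsLucasAtom : ℕ → Carrier → Set ℓ
  IsLucasAtom n Λ = ι Λ E.≈ Φʰᵒᵐ n

  -- For n ≥ 2 the only candidate for a solution of that equation (see
  -- lucasAtom-unique); it is one when Φʰᵒᵐ n has no α-component.
  lucasAtom : ℕ → Carrier
  lucasAtom (ℕ.suc (ℕ.suc n)) = proj₁ (Φʰᵒᵐ (ℕ.suc (ℕ.suc n)))
  lucasAtom _                 = 1#

  lucasAtom-unique : ∀ n → 2 ≤ n → ∀ Λ → IsLucasAtom n Λ → Λ ≈ lucasAtom n
  lucasAtom-unique (ℕ.suc (ℕ.suc n)) _               Λ eq = proj₁ eq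
  lucasAtom-unique 1                 (ℕ.s≤s ())

  I P : ℕ → Carrier
  I q = (- 1#) ^ (ℕ.suc q / 2) * lucasV (ℕ.suc q / 2)
  P q = lucasAtom (ℕ.suc q)

------------------------------------------------------------------------
-- Finite fields

record FiniteField a ℓ (q : ℕ) : Set (suc (a ⊔ ℓ)) where
  field
    commutativeRing : CommutativeRing a ℓ

  open CommutativeRing commutativeRing public

  field
    1≉0         : 1# ≉ 0#
    inverse     : ∀ x → x ≉ 0# → ∃[ y ] y * x ≈ 1#
    enumeration : Inverse setoid (≡.setoid (Fin q))

  open RawSemiringDefs (RawRing.rawSemiring rawRing) public using (_^_)
  open Membership setoid public using (_∈_)
  open UniqueSetoid setoid public using (Unique)
  open Polynomial rawRing public
  open Bivariate rawRing public

  module F[X] = RawRing (rawRing [X])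

  IsPrimitiveElement : Carrier → Set (a ⊔ ℓ)
  IsPrimitiveElement g = g ≉ 0# × (∀ x → x ≉ 0# → ∃[ n ] x ≈ g ^ n)

  -- f has exactly n distinct roots in the field.
  HasRoots : F[X].Carrier → ℕ → Set (a ⊔ ℓ)
  HasRoots f n = ∃[ xs ] Unique xs × length xs ≡ n × (∀ x → x ∈ xs ⇔ IsRoot f x)

module _ {q} (F : FiniteField a ℓ q) where

  private module F = FiniteField F

  record Extension (k : ℕ) : Set (suc (a ⊔ ℓ)) where
    field
      L              : FiniteField a ℓ (q ℕ.^ k)
      embed          : F.Carrier → FiniteField.Carrier L
      isMonomorphism : RingMorphisms.IsRingMonomorphism
                         F.rawRing (FiniteField.rawRing L) embed

    module L = FiniteField L

    IsMinimalPolynomial : F.F[X].Carrier → L.Carrier → Set (a ⊔ ℓ)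
    IsMinimalPolynomial f γ = ∃[ n ]
      F.IsMonicOfDegree f n × L.IsRoot (map embed f) γ ×
      (∀ g m → F.IsMonicOfDegree g m → L.IsRoot (map embed g) γ → n ≤ m)

  IsPrimitivePolynomial : F.F[X].Carrier → Set (suc (a ⊔ ℓ))
  IsPrimitivePolynomial f = ∃[ k ] 1 ≤ k × F.IsMonicOfDegree f k ×
    (Σ[ E ∈ Extension k ] let open Extension E in
      ∃[ γ ] L.IsPrimitiveElement γ × IsMinimalPolynomial f γ)

  record IsOptimalDetermining
           (P : RawRing.Carrier F.R[B,C]) : Set (suc (a ⊔ ℓ)) where
    field
      monic      : ∀ c → F.IsPrimitiveElement c → F.IsMonic (F.specialise P c)
      squareFree : ∀ c → F.IsPrimitiveElement c → F.IsSquareFree (F.specialise P c)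
      roots      : ∀ c → F.IsPrimitiveElement c → ∀ b →
                   F.IsRoot (F.specialise P c) b ⇔
                   IsPrimitivePolynomial (F.quadratic b c)
      product    : ∀ c → F.IsPrimitiveElement c → ∃[ bs ] F.Unique bs ×
                   (∀ b → b F.∈ bs ⇔ IsPrimitivePolynomial (F.quadratic b c)) ×
                   F.specialise P c F.F[X].≈ F.fromRoots bs

{-# OPTIONS --safe #-}
{-
Let N = q + 1 and let c be primitive.  The polynomial V_n(B,c) takes the
value r^n + s^n at b, where r and s are the roots of X² + bX + c.

If r and s lie in F_q, then r^((q-1)/2) and s^((q-1)/2) are signs with
product c^((q-1)/2) = -1, so V_((q-1)/2) vanishes at b and V_(N/2) does
not.  Otherwise s = r^q and r^N = c, so V_(N/2) vanishes at b.  Hence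
every b is a root of V_((q-1)/2) V_(N/2), whose degree is q: neither
factor can have fewer roots than its degree.

Φ_N divides X^(N/2) + 1, so Λ_N(B,c) divides V_(N/2)(B,c), which splits
into distinct linear factors; therefore Λ_N(B,c), monic of degree φ(N), does
too.  It vanishes at b exactly when r^(q-1) has order N, and since
r^N = c has order q - 1 this says that r has order q² - 1.

That Λ_N exists is the fact that Φ_N is palindromic.  The identity
∏_(d|n) Φ_d = X^n - 1, which underlies all of this, is proved over ℤ: an
exact quotient is obtained because distinct Φ_d and Φ_e are comaximal up
to a positive integer, and a monic polynomial dividing k f divides f.
-}
module Submission where

open import Defs
open import Level as Level using (_⊔_)
open import Algebra.Bundles using (CommutativeRing)
open import Algebra.Bundles.Raw using (RawRing)
import Algebra.Definitions.RawMagma as RawMagmaDefs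
import Algebra.Definitions.RawSemiring as RawSemiringDefs
import Algebra.Morphism.Construct.Composition as Composition
open import Algebra.Morphism.Structures using (module RingMorphisms)
import Algebra.Properties.AbelianGroup as AbelianGroupProperties
import Algebra.Properties.CommutativeMonoid.Sum as Sums
import Algebra.Properties.CommutativeSemiring.Exp as Exp
import Algebra.Properties.Ring as RingProperties
import Algebra.Properties.Semiring.Mult as Mult
import Algebra.Solver.Ring as Solver
open import Algebra.Solver.Ring.AlmostCommutativeRing
  using (fromCommutativeRing; _-Raw-AlmostCommutative⟶_)
open import Algebra.Structures using (IsCommutativeRing)
open import Data.Bool.Base using (if_then_else_)
open import Data.Empty using (⊥-elim)
open import Data.Fin.Base as Fin using (Fin; toℕ; fromℕ<; combine; remQuot)
open import Data.Fin.Permutation using (Permutation′; permutation)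
import Data.Fin.Properties as Fin
open import Data.Integer.Base as ℤ using (ℤ; +_; -[1+_])
import Data.Integer.Properties as ℤ
open import Data.List.Base
  using (List; []; _∷_; _++_; length; map; filter; foldr; replicate; tabulate; take; upTo)
import Data.List.Membership.Setoid as Membership
import Data.List.Membership.Setoid.Properties as MembershipProperties
open import Data.List.Properties
  using (applyUpTo-∷ʳ; filter-++; filter-accept; filter-reject; length-++; length-map;
         length-tabulate; length-take; map-++; map-∘)
open import Data.List.Relation.Unary.All as All using (All; []; _∷_)
import Data.List.Relation.Unary.All.Properties as AllProperties
open import Data.List.Relation.Unary.AllPairs using ([]; _∷_)
import Data.List.Relation.Unary.Unique.Setoid as UniqueSetoid
import Data.List.Relation.Unary.Unique.Setoid.Properties as UniqueProperties
open import Data.Maybe.Base using (Maybe; just; nothing)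
open import Data.Nat.Base as ℕ using (ℕ; zero; suc; _∸_; _≤_; _<_; z≤n; s≤s)
open import Data.Nat.Coprimality using (Coprime; coprime?; coprime⇒gcd≡1; gcd≡1⇒coprime)
open import Data.Nat.Divisibility as Div using (_∣_; _∣?_; divides)
open import Data.Nat.DivMod using (_%_; _/_; m%n<n; m≡m%n+[m/n]*n; m*n/n≡m)
open import Data.Nat.GCD
  using (gcd; gcd-GCD; gcd[m,n]∣m; gcd[m,n]∣n; gcd[m,n]≢0; c*gcd[m,n]≡gcd[cm,cn]; module Bézout)
open import Data.Nat.Primality using (Prime; prime[2]; euclidsLemma; prime⇒irreducible)
import Data.Nat.Properties as ℕ
import Data.Nat.Solver as ℕ-Solver
open import Data.Product.Base using (_×_; _,_; proj₁; proj₂; ∃-syntax)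
open import Data.Sum.Base as Sum using (_⊎_; inj₁; inj₂)
open import Function.Bundles using (_⇔_; mk⇔; Equivalence; Inverse)
open import Relation.Binary.Definitions using (Decidable; tri<; tri≈; tri>)
open import Relation.Binary.PropositionalEquality.Core as ≡ using (_≡_; _≢_)
open import Relation.Binary.PropositionalEquality.Properties as ≡ using (module ≡-Reasoning)
import Relation.Binary.Reasoning.Setoid as SetoidReasoning
open import Relation.Nullary.Decidable using (_×-dec_)
open import Relation.Nullary.Decidable.Core using (Dec; yes; no; does; ¬?)
open import Relation.Nullary.Negation.Core using (¬_; contradiction)
import Relation.Unary as Unary

-- A finite field is given only as a ring with `q` elements, with no stated characteristic. The
-- primitive element `c` supplies `x^q = x`, and from this come the additivity of `s ↦ s^q` against
-- the base field and the description of its fixed points. Odd order enters through `q · 1 = 0` with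
-- `q = 2 m + 1`: then `x + x = 0` implies `x = 0`, and this turns `v = - v`, the effect of
-- exchanging `α` and `β` on the second component `v` of `Φʰᵒᵐ`, into `v = 0`. The same equation
-- makes `N = q + 1` act as 1, so no divisor of `N` vanishes in the field and a root of `Φ_N` has
-- exact order `N`. Roots can be counted only once degrees in `B` are known, but the atom is a
-- formula in `α` and `β` in which `B` is hidden. Hence a weight on `F[B][T] / (T² + B T + c)`:
-- modulo `T` the two roots become 0 and `- B`, so the leading coefficient is `(-1)^n` for `V_n`
-- with `n ≥ 1`, and `(-1)^φ(N)` for `Λ_N`.

-- Ring homomorphisms

module _ {a ℓ b m} (R : CommutativeRing a ℓ) (S : CommutativeRing b m) where

  private
    module R = CommutativeRing R
    module S = CommutativeRing S
    module Exp-R = Exp R.commutativeSemiring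
    module Exp-S = Exp S.commutativeSemiring

  IsHom : (R.Carrier → S.Carrier) → Set (a ⊔ ℓ ⊔ m)
  IsHom = RingMorphisms.IsRingHomomorphism R.rawRing S.rawRing

  -- Zero and negation are preserved automatically: `f 0#` is idempotent for addition, and `f (- x)`
  -- is an additive inverse of `f x`.
  isHom : ∀ {f : R.Carrier → S.Carrier} →
          (∀ {x y} → x R.≈ y → f x S.≈ f y) →
          (∀ x y → f (x R.+ y) S.≈ f x S.+ f y) →
          (∀ x y → f (x R.* y) S.≈ f x S.* f y) →
          f R.1# S.≈ S.1# → IsHom f
  isHom {f} f-cong f-+ f-* f-1 = record
    { isSemiringHomomorphism = record
      { isNearSemiringHomomorphism = record
        { +-isMonoidHomomorphism = record
          { isMagmaHomomorphism = record
            { isRelHomomorphism = record { cong = f-cong }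
            ; homo = f-+
            }
          ; ε-homo = f-0
          }
        ; *-homo = f-*
        }
      ; 1#-homo = f-1
      }
    ; -‿homo = λ x → G.inverseˡ-unique (f (R.- x)) (f x)
        (S.trans (S.sym (f-+ _ _)) (S.trans (f-cong (R.-‿inverseˡ x)) f-0))
    }
    where
    module G = AbelianGroupProperties S.+-abelianGroup
    f-0 : f R.0# S.≈ S.0#
    f-0 = RingProperties.x+x≈x⇒x≈0 S.ring _
      (S.trans (S.sym (f-+ _ _)) (f-cong (R.+-identityˡ R.0#)))

  module IsHom {f : R.Carrier → S.Carrier} (h : IsHom f) where

    open RingMorphisms.IsRingHomomorphism h public
      using (⟦⟧-cong; +-homo; *-homo; 0#-homo; 1#-homo; -‿homo)

    ^-homo : ∀ x n → f (x Exp-R.^ n) S.≈ f x Exp-S.^ n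
    ^-homo x zero    = 1#-homo
    ^-homo x (suc n) = S.trans (*-homo _ _) (S.*-congˡ (^-homo x n))

    ×1-homo : ∀ n → f (Mult._×_ R.semiring n R.1#) S.≈ Mult._×_ S.semiring n S.1#
    ×1-homo zero    = 0#-homo
    ×1-homo (suc n) = S.trans (+-homo _ _) (S.+-cong 1#-homo (×1-homo n))

-- The canonical map from the integers, and a ring solver with integer constants

module Integers {a ℓ} (R : CommutativeRing a ℓ) where

  open CommutativeRing R
  open Mult semiring using (×-homo-+; ×1-homo-*) renaming (_×_ to _·_)
  open RingProperties ring
  open AbelianGroupProperties +-abelianGroup using (⁻¹-∙-comm; ⁻¹-involutive; ε⁻¹≈ε)
  open SetoidReasoning setoid

  private
    ⟦_⟧ : ℤ → Carrier
    ⟦_⟧ = fromℤ rawRing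

    -- Proved by hand, because the ring solver below rests on `fromℤ` being a homomorphism, which in
    -- turn uses this cancellation.
    x+y-[x+z] : ∀ x y z → (x + y) + - (x + z) ≈ y + - z
    x+y-[x+z] x y z = begin
      (x + y) + - (x + z)   ≈⟨ +-cong (+-comm x y) (-‿cong (+-comm x z)) ⟩
      (y + x) + - (z + x)   ≈⟨ +-congˡ (⁻¹-∙-comm z x) ⟨
      (y + x) + (- z + - x) ≈⟨ +-congˡ (+-comm _ _) ⟩
      (y + x) + (- x + - z) ≈⟨ +-assoc _ _ _ ⟩
      y + (x + (- x + - z)) ≈⟨ +-congˡ (+-assoc _ _ _) ⟨
      y + ((x + - x) + - z) ≈⟨ +-congˡ (+-congʳ (-‿inverseʳ x)) ⟩
      y + (0# + - z)        ≈⟨ +-congˡ (+-identityˡ _) ⟩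
      y + - z               ∎

    -‿homo : ∀ i → ⟦ ℤ.- i ⟧ ≈ - ⟦ i ⟧
    -‿homo (+ zero)  = sym ε⁻¹≈ε
    -‿homo (+ suc n) = refl
    -‿homo -[1+ n ]  = sym (⁻¹-involutive _)

    ⊖-homo : ∀ m n → ⟦ m ℤ.⊖ n ⟧ ≈ m · 1# + - (n · 1#)
    ⊖-homo m       zero    = sym (trans (+-congˡ ε⁻¹≈ε) (+-identityʳ _))
    ⊖-homo zero    (suc n) = sym (+-identityˡ _)
    ⊖-homo (suc m) (suc n) = begin
      ⟦ suc m ℤ.⊖ suc n ⟧             ≡⟨ ≡.cong ⟦_⟧ (ℤ.[1+m]⊖[1+n]≡m⊖n m n) ⟩
      ⟦ m ℤ.⊖ n ⟧                     ≈⟨ ⊖-homo m n ⟩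
      m · 1# + - (n · 1#)             ≈⟨ x+y-[x+z] 1# _ _ ⟨
      suc m · 1# + - (suc n · 1#)     ∎

    +-homo : ∀ i j → ⟦ i ℤ.+ j ⟧ ≈ ⟦ i ⟧ + ⟦ j ⟧
    +-homo (+ m)    (+ n)    = ×-homo-+ 1# m n
    +-homo (+ m)    -[1+ n ] = ⊖-homo m (suc n)
    +-homo -[1+ m ] (+ n)    = trans (⊖-homo n (suc m)) (+-comm _ _)
    +-homo -[1+ m ] -[1+ n ] = begin
      - (suc (suc (m ℕ.+ n)) · 1#)        ≡⟨ ≡.cong (λ k → - (suc k · 1#)) (ℕ.+-suc m n) ⟨
      - ((suc m ℕ.+ suc n) · 1#)          ≈⟨ -‿cong (×-homo-+ 1# (suc m) (suc n)) ⟩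
      - (suc m · 1# + suc n · 1#)         ≈⟨ ⁻¹-∙-comm _ _ ⟨
      - (suc m · 1#) + - (suc n · 1#)     ∎

    *-homo⁺ : ∀ m n → ⟦ + m ℤ.* + n ⟧ ≈ ⟦ + m ⟧ * ⟦ + n ⟧
    *-homo⁺ m n = trans (reflexive (≡.cong ⟦_⟧ (≡.sym (ℤ.pos-* m n)))) (×1-homo-* m n)

    *-homo : ∀ i j → ⟦ i ℤ.* j ⟧ ≈ ⟦ i ⟧ * ⟦ j ⟧
    *-homo (+ m)      (+ n)      = *-homo⁺ m n
    *-homo (+ m)      -[1+ n ]   = begin
      ⟦ + m ℤ.* -[1+ n ] ⟧        ≡⟨ ≡.cong ⟦_⟧ (ℤ.neg-distribʳ-* (+ m) (+ suc n)) ⟨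
      ⟦ ℤ.- (+ m ℤ.* + suc n) ⟧   ≈⟨ -‿homo (+ m ℤ.* + suc n) ⟩
      - ⟦ + m ℤ.* + suc n ⟧       ≈⟨ -‿cong (*-homo⁺ m (suc n)) ⟩
      - (⟦ + m ⟧ * ⟦ + suc n ⟧)   ≈⟨ -‿distribʳ-* _ _ ⟩
      ⟦ + m ⟧ * - ⟦ + suc n ⟧     ∎
    *-homo -[1+ m ]   (+ n)      = begin
      ⟦ -[1+ m ] ℤ.* + n ⟧        ≡⟨ ≡.cong ⟦_⟧ (ℤ.neg-distribˡ-* (+ suc m) (+ n)) ⟨
      ⟦ ℤ.- (+ suc m ℤ.* + n) ⟧   ≈⟨ -‿homo (+ suc m ℤ.* + n) ⟩
      - ⟦ + suc m ℤ.* + n ⟧       ≈⟨ -‿cong (*-homo⁺ (suc m) n) ⟩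
      - (⟦ + suc m ⟧ * ⟦ + n ⟧)   ≈⟨ -‿distribˡ-* _ _ ⟩
      - ⟦ + suc m ⟧ * ⟦ + n ⟧     ∎
    *-homo -[1+ m ]   -[1+ n ]   = begin
      ⟦ + suc m ℤ.* + suc n ⟧                 ≈⟨ *-homo⁺ (suc m) (suc n) ⟩
      ⟦ + suc m ⟧ * ⟦ + suc n ⟧               ≈⟨ ⁻¹-involutive _ ⟨
      - - (⟦ + suc m ⟧ * ⟦ + suc n ⟧)         ≈⟨ -‿cong (-‿distribʳ-* _ _) ⟩
      - (⟦ + suc m ⟧ * - ⟦ + suc n ⟧)         ≈⟨ -‿distribˡ-* _ _ ⟩
      - ⟦ + suc m ⟧ * - ⟦ + suc n ⟧           ∎

  fromℤ-isHom : IsHom ℤ.+-*-commutativeRing R ⟦_⟧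
  fromℤ-isHom = isHom ℤ.+-*-commutativeRing R
    (λ i≡j → reflexive (≡.cong ⟦_⟧ i≡j)) +-homo *-homo (+-identityʳ 1#)

  -- fromℤ sends 1 to 1# + 0#; the solver needs a literal for 1# itself.
  private
    literal : ℤ → Carrier
    literal (+ 1) = 1#
    literal i     = ⟦ i ⟧

    literal≈ : ∀ i → literal i ≈ ⟦ i ⟧
    literal≈ (+ 0)           = refl
    literal≈ (+ 1)           = sym (+-identityʳ 1#)
    literal≈ (+ suc (suc n)) = refl
    literal≈ -[1+ n ]        = refl

    literal-equal : ∀ i j → Maybe (literal i ≈ literal j)
    literal-equal i j with i ℤ.≟ j
    ... | yes i≡j = just (reflexive (≡.cong literal i≡j))
    ... | no  _   = nothing

    literal-homomorphism : ℤ-rawRing -Raw-AlmostCommutative⟶ fromCommutativeRing R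
    literal-homomorphism = record
      { ⟦_⟧    = literal
      ; +-homo = λ i j → trans (literal≈ (i ℤ.+ j)) (trans (+-homo i j)
                   (sym (+-cong (literal≈ i) (literal≈ j))))
      ; *-homo = λ i j → trans (literal≈ (i ℤ.* j)) (trans (*-homo i j)
                   (sym (*-cong (literal≈ i) (literal≈ j))))
      ; -‿homo = λ i → trans (literal≈ (ℤ.- i)) (trans (-‿homo i)
                   (sym (-‿cong (literal≈ i))))
      ; 0-homo = refl
      ; 1-homo = refl
      }

  module RingSolver =
    Solver ℤ-rawRing (fromCommutativeRing R) literal-homomorphism literal-equal

-- The polynomial ring

module PolynomialRing {a ℓ} (R : CommutativeRing a ℓ) where

  open CommutativeRing R
  open AbelianGroupProperties +-abelianGroup using (ε⁻¹≈ε)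
  open Integers R using (module RingSolver)
  open RingSolver using (solve; _:=_; _:+_; _:*_)
  open SetoidReasoning setoid

  infixl 9 _!_
  _!_ : List Carrier → ℕ → Carrier
  f ! i = coeff rawRing f i

  private
    open module P = RawRing (rawRing [X]) public using ()
      renaming (_≈_ to infix 4 _≈ₚ_; _+_ to infixl 6 _+ₚ_; _*_ to infixl 7 _*ₚ_; -_ to infix 8 -ₚ_)

    scale : Carrier → List Carrier → List Carrier
    scale x = map (x *_)

  !-+ : ∀ f g i → (f +ₚ g) ! i ≈ f ! i + g ! i
  !-+ []      g       i       = sym (+-identityˡ _)
  !-+ (x ∷ f) []      i       = sym (+-identityʳ _)
  !-+ (x ∷ f) (y ∷ g) zero    = refl
  !-+ (x ∷ f) (y ∷ g) (suc i) = !-+ f g i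

  !-scale : ∀ x f i → scale x f ! i ≈ x * f ! i
  !-scale x []      i       = sym (zeroʳ x)
  !-scale x (y ∷ f) zero    = refl
  !-scale x (y ∷ f) (suc i) = !-scale x f i

  !-neg : ∀ f i → (-ₚ f) ! i ≈ - (f ! i)
  !-neg []      i       = sym ε⁻¹≈ε
  !-neg (x ∷ f) zero    = refl
  !-neg (x ∷ f) (suc i) = !-neg f i

  shift-cong : ∀ {f g} → f ≈ₚ g → 0# ∷ f ≈ₚ 0# ∷ g
  shift-cong f≈g zero    = refl
  shift-cong f≈g (suc i) = f≈g i

  shift-+ : ∀ f g i → (0# ∷ (f +ₚ g)) ! i ≈ (0# ∷ f) ! i + (0# ∷ g) ! i
  shift-+ f g zero    = sym (+-identityˡ 0#)
  shift-+ f g (suc i) = !-+ f g i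

  shift-0 : ∀ {f} → f ≈ₚ [] → 0# ∷ f ≈ₚ []
  shift-0 f≈0 zero    = refl
  shift-0 f≈0 (suc i) = f≈0 i

  -- Equality of polynomials is coefficientwise, so the recursion that defines multiplication is
  -- used in this form.
  !-*-∷ : ∀ x f g i → ((x ∷ f) *ₚ g) ! i ≈ x * g ! i + (0# ∷ (f *ₚ g)) ! i
  !-*-∷ x f g i = trans (!-+ (scale x g) _ i) (+-congʳ (!-scale x g i))

  private
    -- A list of zeros also represents the zero polynomial, hence the hypothesis `f ≈ₚ []`. It
    -- settles the case of factors of different length in `*-congₚ`.
    *-zeroˡ : ∀ f g → f ≈ₚ [] → f *ₚ g ≈ₚ []
    *-zeroˡ []      g f≈0 i = refl
    *-zeroˡ (x ∷ f) g f≈0 i = begin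
      ((x ∷ f) *ₚ g) ! i                 ≈⟨ !-*-∷ x f g i ⟩
      x * g ! i + (0# ∷ (f *ₚ g)) ! i    ≈⟨ +-cong (*-congʳ (f≈0 0)) (shift-0 (*-zeroˡ f g (λ j → f≈0 (suc j))) i) ⟩
      0# * g ! i + 0#                    ≈⟨ trans (+-identityʳ _) (zeroˡ _) ⟩
      0#                                 ∎

    *-congₚ : ∀ f f′ g g′ → f ≈ₚ f′ → g ≈ₚ g′ → f *ₚ g ≈ₚ f′ *ₚ g′
    *-congₚ []      []        g g′ f≈ g≈ i = refl
    *-congₚ []      (x ∷ f′)  g g′ f≈ g≈ i = sym (*-zeroˡ (x ∷ f′) g′ (λ j → sym (f≈ j)) i)
    *-congₚ (x ∷ f) []        g g′ f≈ g≈ i = *-zeroˡ (x ∷ f) g f≈ i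
    *-congₚ (x ∷ f) (x′ ∷ f′) g g′ f≈ g≈ i = begin
      ((x ∷ f) *ₚ g) ! i                   ≈⟨ !-*-∷ x f g i ⟩
      x * g ! i + (0# ∷ (f *ₚ g)) ! i      ≈⟨ +-cong (*-cong (f≈ 0) (g≈ i))
                                               (shift-cong (*-congₚ f f′ g g′ (λ j → f≈ (suc j)) g≈) i) ⟩
      x′ * g′ ! i + (0# ∷ (f′ *ₚ g′)) ! i  ≈⟨ !-*-∷ x′ f′ g′ i ⟨
      ((x′ ∷ f′) *ₚ g′) ! i                ∎

    -- The mirror image of `!-*-∷`, a recursion on the right factor. Commutativity is the agreement
    -- of the two recursions.
    *-∷ʳ : ∀ f y g i → (f *ₚ (y ∷ g)) ! i ≈ y * f ! i + (0# ∷ (f *ₚ g)) ! i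
    *-∷ʳ []      y g i       = sym (trans (+-cong (zeroʳ y) (shift-0 (λ _ → refl) i)) (+-identityˡ 0#))
    *-∷ʳ (x ∷ f) y g zero    = +-congʳ (*-comm x y)
    *-∷ʳ (x ∷ f) y g (suc i) = begin
      (scale x g +ₚ f *ₚ (y ∷ g)) ! i                     ≈⟨ !-+ (scale x g) _ i ⟩
      scale x g ! i + (f *ₚ (y ∷ g)) ! i                  ≈⟨ +-cong (!-scale x g i) (*-∷ʳ f y g i) ⟩
      x * g ! i + (y * f ! i + (0# ∷ (f *ₚ g)) ! i)       ≈⟨ solve 3 (λ u v w → u :+ (v :+ w) := v :+ (u :+ w)) refl _ _ _ ⟩
      y * f ! i + (x * g ! i + (0# ∷ (f *ₚ g)) ! i)       ≈⟨ +-congˡ (!-*-∷ x f g i) ⟨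
      y * f ! i + ((x ∷ f) *ₚ g) ! i                      ∎

    *-commₚ : ∀ f g → f *ₚ g ≈ₚ g *ₚ f
    *-commₚ []      []      i = refl
    *-commₚ []      (y ∷ g) i = sym (trans (!-*-∷ y g [] i)
      (trans (+-cong (zeroʳ y) (shift-0 (λ j → sym (*-commₚ [] g j)) i)) (+-identityˡ 0#)))
    *-commₚ (x ∷ f) g       i = begin
      ((x ∷ f) *ₚ g) ! i                ≈⟨ !-*-∷ x f g i ⟩
      x * g ! i + (0# ∷ (f *ₚ g)) ! i   ≈⟨ +-congˡ (shift-cong (*-commₚ f g) i) ⟩
      x * g ! i + (0# ∷ (g *ₚ f)) ! i   ≈⟨ *-∷ʳ g x f i ⟨
      (g *ₚ (x ∷ f)) ! i                ∎

    distribʳₚ : ∀ h f g → (f +ₚ g) *ₚ h ≈ₚ f *ₚ h +ₚ g *ₚ h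
    distribʳₚ h []      g       i = refl
    distribʳₚ h (x ∷ f) []      i = sym (trans (!-+ ((x ∷ f) *ₚ h) [] i) (+-identityʳ _))
    distribʳₚ h (x ∷ f) (y ∷ g) i = begin
      ((x + y ∷ (f +ₚ g)) *ₚ h) ! i
        ≈⟨ !-*-∷ (x + y) (f +ₚ g) h i ⟩
      (x + y) * h ! i + (0# ∷ ((f +ₚ g) *ₚ h)) ! i
        ≈⟨ +-congˡ (shift-cong (distribʳₚ h f g) i) ⟩
      (x + y) * h ! i + (0# ∷ (f *ₚ h +ₚ g *ₚ h)) ! i
        ≈⟨ +-congˡ (shift-+ (f *ₚ h) (g *ₚ h) i) ⟩
      (x + y) * h ! i + ((0# ∷ (f *ₚ h)) ! i + (0# ∷ (g *ₚ h)) ! i)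
        ≈⟨ solve 5 (λ x y h u v → (x :+ y) :* h :+ (u :+ v) := (x :* h :+ u) :+ (y :* h :+ v)) refl _ _ _ _ _ ⟩
      (x * h ! i + (0# ∷ (f *ₚ h)) ! i) + (y * h ! i + (0# ∷ (g *ₚ h)) ! i)
        ≈⟨ +-cong (!-*-∷ x f h i) (!-*-∷ y g h i) ⟨
      ((x ∷ f) *ₚ h) ! i + ((y ∷ g) *ₚ h) ! i
        ≈⟨ !-+ ((x ∷ f) *ₚ h) _ i ⟨
      ((x ∷ f) *ₚ h +ₚ (y ∷ g) *ₚ h) ! i
        ∎

    shift-* : ∀ f g → (0# ∷ f) *ₚ g ≈ₚ 0# ∷ (f *ₚ g)
    shift-* f g i = trans (!-*-∷ 0# f g i) (trans (+-congʳ (zeroˡ _)) (+-identityˡ _))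

    scale-* : ∀ x f g → scale x f *ₚ g ≈ₚ scale x (f *ₚ g)
    scale-* x []      g i = refl
    scale-* x (y ∷ f) g i = begin
      (scale x (y ∷ f) *ₚ g) ! i                    ≈⟨ !-*-∷ (x * y) (scale x f) g i ⟩
      x * y * g ! i + (0# ∷ (scale x f *ₚ g)) ! i   ≈⟨ +-cong (*-assoc _ _ _) (shift-cong (scale-* x f g) i) ⟩
      x * (y * g ! i) + (0# ∷ scale x (f *ₚ g)) ! i ≈⟨ +-congˡ (scale-shift i) ⟩
      x * (y * g ! i) + x * (0# ∷ (f *ₚ g)) ! i     ≈⟨ distribˡ x _ _ ⟨
      x * (y * g ! i + (0# ∷ (f *ₚ g)) ! i)         ≈⟨ *-congˡ (!-*-∷ y f g i) ⟨
      x * ((y ∷ f) *ₚ g) ! i                        ≈⟨ !-scale x ((y ∷ f) *ₚ g) i ⟨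
      scale x ((y ∷ f) *ₚ g) ! i                    ∎
      where
      scale-shift : ∀ i → (0# ∷ scale x (f *ₚ g)) ! i ≈ x * (0# ∷ (f *ₚ g)) ! i
      scale-shift zero    = sym (zeroʳ x)
      scale-shift (suc i) = !-scale x (f *ₚ g) i

    *-assocₚ : ∀ f g h → (f *ₚ g) *ₚ h ≈ₚ f *ₚ (g *ₚ h)
    *-assocₚ []      g h i = refl
    *-assocₚ (x ∷ f) g h i = begin
      ((x ∷ f) *ₚ g *ₚ h) ! i
        ≈⟨ distribʳₚ h (scale x g) (0# ∷ (f *ₚ g)) i ⟩
      (scale x g *ₚ h +ₚ (0# ∷ (f *ₚ g)) *ₚ h) ! i
        ≈⟨ !-+ (scale x g *ₚ h) _ i ⟩
      (scale x g *ₚ h) ! i + ((0# ∷ (f *ₚ g)) *ₚ h) ! i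
        ≈⟨ +-cong (scale-* x g h i) (shift-* (f *ₚ g) h i) ⟩
      scale x (g *ₚ h) ! i + (0# ∷ (f *ₚ g *ₚ h)) ! i
        ≈⟨ +-cong (!-scale x (g *ₚ h) i) (shift-cong (*-assocₚ f g h) i) ⟩
      x * (g *ₚ h) ! i + (0# ∷ (f *ₚ (g *ₚ h))) ! i
        ≈⟨ !-*-∷ x f (g *ₚ h) i ⟨
      ((x ∷ f) *ₚ (g *ₚ h)) ! i
        ∎

    *-identityˡₚ : ∀ f → (1# ∷ []) *ₚ f ≈ₚ f
    *-identityˡₚ f i = trans (!-*-∷ 1# [] f i)
      (trans (+-cong (*-identityˡ _) (shift-0 (λ _ → refl) i)) (+-identityʳ _))

  opaque

    polynomial-isCommutativeRing : IsCommutativeRing _≈ₚ_ _+ₚ_ _*ₚ_ -ₚ_ [] (1# ∷ [])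
    polynomial-isCommutativeRing = record
      { isRing = record
        { +-isAbelianGroup = record
          { isGroup = record
            { isMonoid = record
              { isSemigroup = record
                { isMagma = record
                  { isEquivalence = record
                    { refl  = λ i → refl
                    ; sym   = λ f≈g i → sym (f≈g i)
                    ; trans = λ f≈g g≈h i → trans (f≈g i) (g≈h i)
                    }
                  ; ∙-cong = λ {f} {f′} {g} {g′} f≈ g≈ i →
                      trans (!-+ f g i) (trans (+-cong (f≈ i) (g≈ i)) (sym (!-+ f′ g′ i)))
                  }
                ; assoc = λ f g h i → begin
                    (f +ₚ g +ₚ h) ! i        ≈⟨ trans (!-+ (f +ₚ g) h i) (+-congʳ (!-+ f g i)) ⟩
                    f ! i + g ! i + h ! i    ≈⟨ +-assoc _ _ _ ⟩
                    f ! i + (g ! i + h ! i)  ≈⟨ trans (!-+ f (g +ₚ h) i) (+-congˡ (!-+ g h i)) ⟨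
                    (f +ₚ (g +ₚ h)) ! i      ∎
                }
              ; identity = (λ f i → refl) , λ f i → trans (!-+ f [] i) (+-identityʳ _)
              }
            ; inverse =
                (λ f i → trans (!-+ (-ₚ f) f i) (trans (+-congʳ (!-neg f i)) (-‿inverseˡ _))) ,
                (λ f i → trans (!-+ f (-ₚ f) i) (trans (+-congˡ (!-neg f i)) (-‿inverseʳ _)))
            ; ⁻¹-cong = λ {f} {g} f≈g i → trans (!-neg f i) (trans (-‿cong (f≈g i)) (sym (!-neg g i)))
            }
          ; comm = λ f g i → trans (!-+ f g i) (trans (+-comm _ _) (sym (!-+ g f i)))
          }
        ; *-cong     = λ {f} {f′} {g} {g′} → *-congₚ f f′ g g′
        ; *-assoc    = *-assocₚ
        ; *-identity = *-identityˡₚ , λ f i → trans (*-commₚ f (1# ∷ []) i) (*-identityˡₚ f i)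
        ; distrib    =
            (λ h f g i → begin
              (h *ₚ (f +ₚ g)) ! i               ≈⟨ *-commₚ h (f +ₚ g) i ⟩
              ((f +ₚ g) *ₚ h) ! i               ≈⟨ distribʳₚ h f g i ⟩
              (f *ₚ h +ₚ g *ₚ h) ! i            ≈⟨ !-+ (f *ₚ h) _ i ⟩
              (f *ₚ h) ! i + (g *ₚ h) ! i       ≈⟨ +-cong (*-commₚ f h i) (*-commₚ g h i) ⟩
              (h *ₚ f) ! i + (h *ₚ g) ! i       ≈⟨ !-+ (h *ₚ f) _ i ⟨
              (h *ₚ f +ₚ h *ₚ g) ! i            ∎) ,
            distribʳₚ
        }
      ; *-comm = *-commₚ
      }

  polynomialRing : CommutativeRing a ℓ
  polynomialRing = record
    { Carrier           = List Carrier
    ; _≈_               = _≈ₚ_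
    ; _+_               = _+ₚ_
    ; _*_               = _*ₚ_
    ; -_                = -ₚ_
    ; 0#                = []
    ; 1#                = 1# ∷ []
    ; isCommutativeRing = polynomial-isCommutativeRing
    }

-- Evaluation, degrees, monic polynomials and homogenisation

module Evaluation {a ℓ} (R : CommutativeRing a ℓ) where

  open CommutativeRing R
  open PolynomialRing R public
  open Polynomial rawRing public
  open Integers R using (module RingSolver)
  open RingSolver using (solve; _:=_; _:+_; _:*_; con)
  open SetoidReasoning setoid
  open AbelianGroupProperties +-abelianGroup using (x∙y⁻¹≈ε⇒x≈y; ε⁻¹≈ε)
  open Exp commutativeSemiring using (_^_; ^-cong; ^-distrib-*; ^-homo-*)

  const-isHom : IsHom R polynomialRing const
  const-isHom = isHom R polynomialRing
    (λ { x≈y zero → x≈y ; x≈y (suc i) → refl })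
    (λ { x y zero → refl ; x y (suc i) → refl })
    (λ { x y zero → sym (+-identityʳ _) ; x y (suc i) → refl })
    (λ i → refl)

  eval-zero : ∀ f x → f ≈ₚ [] → eval f x ≈ 0#
  eval-zero []      x f≈0 = refl
  eval-zero (y ∷ f) x f≈0 = trans
    (+-cong (f≈0 0) (*-congˡ (eval-zero f x (λ i → f≈0 (suc i)))))
    (trans (+-identityˡ _) (zeroʳ x))

  eval-cong : ∀ f g {x y} → f ≈ₚ g → x ≈ y → eval f x ≈ eval g y
  eval-cong []      g       f≈g x≈y = sym (eval-zero g _ (λ i → sym (f≈g i)))
  eval-cong (u ∷ f) []      f≈g x≈y = eval-zero (u ∷ f) _ f≈g
  eval-cong (u ∷ f) (v ∷ g) f≈g x≈y =
    +-cong (f≈g 0) (*-cong x≈y (eval-cong f g (λ i → f≈g (suc i)) x≈y))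

  eval-+ : ∀ f g x → eval (f +ₚ g) x ≈ eval f x + eval g x
  eval-+ []      g       x = sym (+-identityˡ _)
  eval-+ (u ∷ f) []      x = sym (+-identityʳ _)
  eval-+ (u ∷ f) (v ∷ g) x = trans (+-congˡ (*-congˡ (eval-+ f g x)))
    (solve 5 (λ u v x r s → (u :+ v) :+ x :* (r :+ s) := (u :+ x :* r) :+ (v :+ x :* s)) refl u v x _ _)

  eval-scale : ∀ y f x → eval (map (y *_) f) x ≈ y * eval f x
  eval-scale y []      x = sym (zeroʳ y)
  eval-scale y (u ∷ f) x = trans (+-congˡ (*-congˡ (eval-scale y f x)))
    (solve 4 (λ y u x r → y :* u :+ x :* (y :* r) := y :* (u :+ x :* r)) refl y u x _)

  eval-* : ∀ f g x → eval (f *ₚ g) x ≈ eval f x * eval g x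
  eval-* []      g x = sym (zeroˡ _)
  eval-* (u ∷ f) g x = begin
    eval (map (u *_) g +ₚ (0# ∷ (f *ₚ g))) x               ≈⟨ eval-+ (map (u *_) g) _ x ⟩
    eval (map (u *_) g) x + (0# + x * eval (f *ₚ g) x)     ≈⟨ +-cong (eval-scale u g x) (+-congˡ (*-congˡ (eval-* f g x))) ⟩
    u * eval g x + (0# + x * (eval f x * eval g x))        ≈⟨ solve 4 (λ u x r s → u :* s :+ (con (+ 0) :+ x :* (r :* s)) := (u :+ x :* r) :* s) refl u x _ _ ⟩
    (u + x * eval f x) * eval g x                          ∎

  eval-const : ∀ u x → eval (const u) x ≈ u
  eval-const u x = trans (+-congˡ (zeroʳ x)) (+-identityʳ u)

  eval-X : ∀ x → eval X x ≈ x
  eval-X x = solve 1 (λ x → con (+ 0) :+ x :* (con (+ 1) :+ x :* con (+ 0)) := x) refl x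

  eval-isHom : ∀ x → IsHom polynomialRing R (λ f → eval f x)
  eval-isHom x = isHom polynomialRing R
    (λ {f} {g} f≈g → eval-cong f g f≈g refl)
    (λ f g → eval-+ f g x) (λ f g → eval-* f g x) (eval-const 1# x)

  DegreeAtMost : List Carrier → ℕ → Set ℓ
  DegreeAtMost f n = ∀ m → n < m → f ! m ≈ 0#

  DegreeAtMost-resp : ∀ f g {n} → f ≈ₚ g → DegreeAtMost f n → DegreeAtMost g n
  DegreeAtMost-resp f g f≈g d m n<m = trans (sym (f≈g m)) (d m n<m)

  DegreeAtMost-mono : ∀ f {m n} → m ≤ n → DegreeAtMost f m → DegreeAtMost f n
  DegreeAtMost-mono f m≤n d k n<k = d k (ℕ.≤-<-trans m≤n n<k)

  DegreeAtMost-+ : ∀ f g {n} → DegreeAtMost f n → DegreeAtMost g n → DegreeAtMost (f +ₚ g) n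
  DegreeAtMost-+ f g df dg m n<m =
    trans (!-+ f g m) (trans (+-cong (df m n<m) (dg m n<m)) (+-identityˡ 0#))

  DegreeAtMost-neg : ∀ f {n} → DegreeAtMost f n → DegreeAtMost (-ₚ f) n
  DegreeAtMost-neg f df m n<m = trans (!-neg f m) (trans (-‿cong (df m n<m)) ε⁻¹≈ε)

  !-length : ∀ f {i} → length f ≤ i → f ! i ≈ 0#
  !-length []      l≤i       = refl
  !-length (x ∷ f) (s≤s l≤i) = !-length f l≤i

  private
    tail : ∀ {x} f {n} → DegreeAtMost (x ∷ f) (suc n) → DegreeAtMost f n
    tail f d m n<m = d (suc m) (s≤s n<m)

    tail-0 : ∀ {x} f → DegreeAtMost (x ∷ f) 0 → f ≈ₚ []
    tail-0 f d i = d (suc i) (s≤s z≤n)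

    ∷-* : ∀ x f g → f ≈ₚ [] → (x ∷ f) *ₚ g ≈ₚ map (x *_) g
    ∷-* x f g f≈0 i = begin
      ((x ∷ f) *ₚ g) ! i                ≈⟨ !-*-∷ x f g i ⟩
      x * g ! i + (0# ∷ (f *ₚ g)) ! i   ≈⟨ +-cong (sym (!-scale x g i))
        (shift-0 (CommutativeRing.*-cong polynomialRing {f} {[]} {g} {g} f≈0 (λ j → refl)) i) ⟩
      map (x *_) g ! i + 0#             ≈⟨ +-identityʳ _ ⟩
      map (x *_) g ! i                  ∎

  DegreeAtMost-* : ∀ f g {m n} → DegreeAtMost f m → DegreeAtMost g n → DegreeAtMost (f *ₚ g) (m ℕ.+ n)
  DegreeAtMost-* []      g df dg k l = refl
  DegreeAtMost-* (x ∷ f) g {zero} df dg k l = trans (∷-* x f g (tail-0 f df) k)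
    (trans (!-scale x g k) (trans (*-congˡ (dg k l)) (zeroʳ x)))
  DegreeAtMost-* (x ∷ f) g {suc m} {n} df dg (suc k) (s≤s l) = trans (!-*-∷ x f g (suc k))
    (trans (+-cong (trans (*-congˡ (dg (suc k) (ℕ.≤-<-trans (ℕ.m≤n+m n m) (ℕ.m≤n⇒m≤1+n l)))) (zeroʳ x))
      (DegreeAtMost-* f g (tail f df) dg k l)) (+-identityˡ 0#))

  -- Upper bounds on the degrees suffice, over any ring: only the product of the two extreme
  -- coefficients reaches degree `m + n`.
  !-top : ∀ f g {m n} → DegreeAtMost f m → DegreeAtMost g n → (f *ₚ g) ! (m ℕ.+ n) ≈ f ! m * g ! n
  !-top []      g df dg = sym (zeroˡ _)
  !-top (x ∷ f) g {zero} {n} df dg = trans (∷-* x f g (tail-0 f df) n) (!-scale x g n)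
  !-top (x ∷ f) g {suc m} {n} df dg = trans (!-*-∷ x f g (suc (m ℕ.+ n)))
    (trans (+-cong (trans (*-congˡ (dg _ (s≤s (ℕ.m≤n+m n m)))) (zeroʳ x))
      (!-top f g (tail f df) dg)) (+-identityˡ _))

  isMonic-resp : ∀ f g {n} → f ≈ₚ g → IsMonicOfDegree f n → IsMonicOfDegree g n
  isMonic-resp f g f≈g (lead , d) = trans (sym (f≈g _)) lead , DegreeAtMost-resp f g f≈g d

  isMonic-* : ∀ f g {m n} → IsMonicOfDegree f m → IsMonicOfDegree g n → IsMonicOfDegree (f *ₚ g) (m ℕ.+ n)
  isMonic-* f g (f-lead , df) (g-lead , dg) =
    trans (!-top f g df dg) (trans (*-cong f-lead g-lead) (*-identityˡ 1#)) , DegreeAtMost-* f g df dg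

  isMonic-1 : IsMonicOfDegree (1# ∷ []) 0
  isMonic-1 = refl , λ { (suc m) _ → refl }

  isMonic-+ : ∀ f g {m n} → m < n → DegreeAtMost f m → IsMonicOfDegree g n → IsMonicOfDegree (f +ₚ g) n
  isMonic-+ f g m<n df (lead , dg) =
    trans (!-+ f g _) (trans (+-cong (df _ m<n) lead) (+-identityˡ 1#)) ,
    DegreeAtMost-+ f g (DegreeAtMost-mono f (ℕ.<⇒≤ m<n) df) dg

  -- For g monic the leading coefficient of g h is that of h, so the
  -- coefficients of h can be shown to vanish from the top downwards.
  cofactor-bounded : ∀ g h {m} k → IsMonicOfDegree g m →
    (∀ i → k ℕ.+ m ≤ i → (g *ₚ h) ! i ≈ 0#) → ∀ j → k ≤ j → h ! j ≈ 0#
  cofactor-bounded g h {m} k (lead , dg) gh≈0 = descend (length h) (λ j → !-length h)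
    where
    descend : ∀ t → (∀ j → t ≤ j → h ! j ≈ 0#) → ∀ j → k ≤ j → h ! j ≈ 0#
    descend zero    h≈0 j _ = h≈0 j z≤n
    descend (suc t) h≈0 j k≤j with k ℕ.≤? t
    ... | no k≰t  = h≈0 j (ℕ.≤-trans (ℕ.≰⇒> k≰t) k≤j)
    ... | yes k≤t = descend t below j k≤j
      where
      h-t : h ! t ≈ 0#
      h-t = begin
        h ! t                    ≈⟨ *-identityˡ _ ⟨
        1# * h ! t               ≈⟨ *-congʳ lead ⟨
        g ! m * h ! t            ≈⟨ !-top g h dg h≈0 ⟨
        (g *ₚ h) ! (m ℕ.+ t)     ≈⟨ gh≈0 _ (≡.subst (_≤ m ℕ.+ t) (ℕ.+-comm m k) (ℕ.+-monoʳ-≤ m k≤t)) ⟩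
        0#                       ∎
      below : ∀ j → t ≤ j → h ! j ≈ 0#
      below j t≤j with ℕ.m≤n⇒m<n∨m≡n t≤j
      ... | inj₁ t<j    = h≈0 j t<j
      ... | inj₂ ≡.refl = h-t

  monic-cancel-0 : ∀ g h {m} → IsMonicOfDegree g m → g *ₚ h ≈ₚ [] → h ≈ₚ []
  monic-cancel-0 g h mon gh≈0 j = cofactor-bounded g h 0 mon (λ i _ → gh≈0 i) j z≤n

  monic-cancel : ∀ g h h′ {m} → IsMonicOfDegree g m → g *ₚ h ≈ₚ g *ₚ h′ → h ≈ₚ h′
  monic-cancel g h h′ mon gh≈gh′ i = x∙y⁻¹≈ε⇒x≈y (h ! i) (h′ ! i) (begin
    h ! i + - (h′ ! i)     ≈⟨ +-congˡ (!-neg h′ i) ⟨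
    h ! i + (-ₚ h′) ! i    ≈⟨ !-+ h (-ₚ h′) i ⟨
    (h +ₚ -ₚ h′) ! i       ≈⟨ monic-cancel-0 g (h +ₚ -ₚ h′) mon difference i ⟩
    0#                     ∎)
    where
    module P = CommutativeRing polynomialRing
    difference : g *ₚ (h +ₚ -ₚ h′) ≈ₚ []
    difference i = begin
      (g *ₚ (h +ₚ -ₚ h′)) ! i                  ≈⟨ P.distribˡ g h (-ₚ h′) i ⟩
      (g *ₚ h +ₚ g *ₚ (-ₚ h′)) ! i             ≈⟨ !-+ (g *ₚ h) _ i ⟩
      (g *ₚ h) ! i + (g *ₚ (-ₚ h′)) ! i        ≈⟨ +-cong (gh≈gh′ i) (sym (RingProperties.-‿distribʳ-* P.ring g h′ i)) ⟩
      (g *ₚ h′) ! i + (-ₚ (g *ₚ h′)) ! i       ≈⟨ +-congˡ (!-neg (g *ₚ h′) i) ⟩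
      (g *ₚ h′) ! i + - ((g *ₚ h′) ! i)        ≈⟨ -‿inverseʳ _ ⟩
      0#                                       ∎

  -- If `n < m`, the product vanishes from degree `m` on, which forces `h` and with it the product
  -- to be zero. Otherwise `cofactor-bounded` bounds the degree of `h`, and its leading coefficient
  -- is read off at the top of the product.
  isMonic-cofactor : 1# ≉ 0# → ∀ g h {m n} → IsMonicOfDegree g m →
    IsMonicOfDegree (g *ₚ h) n → m ≤ n × IsMonicOfDegree h (n ∸ m)
  isMonic-cofactor 1≉0 g h {m} {n} g-mon@(g-lead , dg) (gh-lead , dgh) with m ℕ.≤? n
  ... | no m≰n  = contradiction (trans (sym gh-lead) (gh≈0 n)) 1≉0
    where
    gh≈0 : g *ₚ h ≈ₚ []
    gh≈0 i = trans (CommutativeRing.*-cong polynomialRing {g} {g} {h} {[]} (λ _ → refl)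
        (λ j → cofactor-bounded g h 0 g-mon (λ k m≤k → dgh k (ℕ.≤-trans (ℕ.≰⇒> m≰n) m≤k)) j z≤n) i)
      (CommutativeRing.zeroʳ polynomialRing g i)
  ... | yes m≤n = m≤n , lead , dh
    where
    dh : DegreeAtMost h (n ∸ m)
    dh = cofactor-bounded g h (suc (n ∸ m)) g-mon
      (λ i le → dgh i (≡.subst (λ k → suc k ≤ i) (ℕ.m∸n+n≡m m≤n) le))
    lead : h ! (n ∸ m) ≈ 1#
    lead = begin
      h ! (n ∸ m)                    ≈⟨ *-identityˡ _ ⟨
      1# * h ! (n ∸ m)               ≈⟨ *-congʳ g-lead ⟨
      g ! m * h ! (n ∸ m)            ≈⟨ !-top g h dg dh ⟨
      (g *ₚ h) ! (m ℕ.+ (n ∸ m))     ≡⟨ ≡.cong ((g *ₚ h) !_) (ℕ.m+[n∸m]≡n m≤n) ⟩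
      (g *ₚ h) ! n                   ≈⟨ gh-lead ⟩
      1#                             ∎

  isMonic-unique : 1# ≉ 0# → ∀ f {m n} → IsMonicOfDegree f m → IsMonicOfDegree f n → m ≡ n
  isMonic-unique 1≉0 f {m} {n} (lead , d) (lead′ , d′) with ℕ.<-cmp m n
  ... | tri< m<n _ _ = contradiction (trans (sym lead′) (d n m<n)) 1≉0
  ... | tri≈ _ m≡n _ = m≡n
  ... | tri> _ _ n<m = contradiction (trans (sym lead) (d′ m n<m)) 1≉0

  -- The binary form `∑ uᵢ xⁱ y^(m - i)` in Horner style. Coefficients beyond degree `m` are
  -- ignored, so the identities that involve several degrees need a bound `DegreeAtMost`.
  homogenize : ℕ → List Carrier → Carrier → Carrier → Carrier
  homogenize m       []      x y = 0#
  homogenize zero    (u ∷ f) x y = u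
  homogenize (suc m) (u ∷ f) x y = u * y ^ suc m + x * homogenize m f x y

  homogenize-0 : ∀ m f {x y} → f ≈ₚ [] → homogenize m f x y ≈ 0#
  homogenize-0 m       []      f≈0 = refl
  homogenize-0 zero    (u ∷ f) f≈0 = f≈0 0
  homogenize-0 (suc m) (u ∷ f) {x} f≈0 = trans
    (+-cong (trans (*-congʳ (f≈0 0)) (zeroˡ _))
            (trans (*-congˡ (homogenize-0 m f (λ i → f≈0 (suc i)))) (zeroʳ x)))
    (+-identityˡ 0#)

  homogenize-cong : ∀ m f g {x x′ y y′} → f ≈ₚ g → x ≈ x′ → y ≈ y′ →
    homogenize m f x y ≈ homogenize m g x′ y′
  homogenize-cong m       []      g       f≈g p q = sym (homogenize-0 m g (λ i → sym (f≈g i)))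
  homogenize-cong m       (u ∷ f) []      f≈g p q = homogenize-0 m (u ∷ f) f≈g
  homogenize-cong zero    (u ∷ f) (v ∷ g) f≈g p q = f≈g 0
  homogenize-cong (suc m) (u ∷ f) (v ∷ g) f≈g p q = +-cong (*-cong (f≈g 0) (^-cong q (≡.refl {x = suc m})))
    (*-cong p (homogenize-cong m f g (λ i → f≈g (suc i)) p q))

  homogenize-+ : ∀ m f g x y →
    homogenize m (f +ₚ g) x y ≈ homogenize m f x y + homogenize m g x y
  homogenize-+ m       []      g       x y = sym (+-identityˡ _)
  homogenize-+ m       (u ∷ f) []      x y = sym (+-identityʳ _)
  homogenize-+ zero    (u ∷ f) (v ∷ g) x y = refl
  homogenize-+ (suc m) (u ∷ f) (v ∷ g) x y = trans (+-congˡ (*-congˡ (homogenize-+ m f g x y)))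
    (solve 6 (λ u v t x r s → (u :+ v) :* t :+ x :* (r :+ s) := (u :* t :+ x :* r) :+ (v :* t :+ x :* s))
      refl u v (y ^ suc m) x _ _)

  homogenize-scale : ∀ m u f x y → homogenize m (map (u *_) f) x y ≈ u * homogenize m f x y
  homogenize-scale m       u []      x y = sym (zeroʳ u)
  homogenize-scale zero    u (v ∷ f) x y = refl
  homogenize-scale (suc m) u (v ∷ f) x y = trans (+-congˡ (*-congˡ (homogenize-scale m u f x y)))
    (solve 5 (λ u v t x r → u :* v :* t :+ x :* (u :* r) := u :* (v :* t :+ x :* r)) refl u v (y ^ suc m) x _)

  homogenize-raise : ∀ n e f x y → DegreeAtMost f n →
    homogenize (n ℕ.+ e) f x y ≈ y ^ e * homogenize n f x y
  homogenize-raise n       e       []      x y d = sym (zeroʳ _)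
  homogenize-raise zero    zero    (u ∷ f) x y d = sym (*-identityˡ u)
  homogenize-raise zero    (suc e) (u ∷ f) x y d = begin
    u * y ^ suc e + x * homogenize e f x y   ≈⟨ +-cong (*-comm _ _) (*-congˡ (homogenize-0 e f (tail-0 f d))) ⟩
    y ^ suc e * u + x * 0#                   ≈⟨ trans (+-congˡ (zeroʳ x)) (+-identityʳ _) ⟩
    y ^ suc e * u                            ∎
  homogenize-raise (suc n) e (u ∷ f) x y d = begin
    u * y ^ (suc n ℕ.+ e) + x * homogenize (n ℕ.+ e) f x y
      ≈⟨ +-cong (*-congˡ (^-homo-* y (suc n) e)) (*-congˡ (homogenize-raise n e f x y (tail f d))) ⟩
    u * (y ^ suc n * y ^ e) + x * (y ^ e * homogenize n f x y)
      ≈⟨ solve 5 (λ u s t x r → u :* (s :* t) :+ x :* (t :* r) := t :* (u :* s :+ x :* r))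
           refl u (y ^ suc n) (y ^ e) x _ ⟩
    y ^ e * (u * y ^ suc n + x * homogenize n f x y) ∎

  homogenize-* : ∀ m n f g x y → DegreeAtMost f m → DegreeAtMost g n →
    homogenize (m ℕ.+ n) (f *ₚ g) x y ≈ homogenize m f x y * homogenize n g x y
  homogenize-* m       n []      g x y df dg = sym (zeroˡ _)
  homogenize-* zero    n (u ∷ f) g x y df dg = trans
    (homogenize-cong n ((u ∷ f) *ₚ g) (map (u *_) g) (∷-* u f g (tail-0 f df)) refl refl)
    (homogenize-scale n u g x y)
  homogenize-* (suc m) n (u ∷ f) g x y df dg = begin
    homogenize (suc m ℕ.+ n) (map (u *_) g +ₚ (0# ∷ (f *ₚ g))) x y
      ≈⟨ homogenize-+ (suc m ℕ.+ n) (map (u *_) g) _ x y ⟩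
    homogenize (suc m ℕ.+ n) (map (u *_) g) x y + (0# * y ^ suc (m ℕ.+ n) + x * homogenize (m ℕ.+ n) (f *ₚ g) x y)
      ≈⟨ +-cong (homogenize-scale (suc m ℕ.+ n) u g x y) (+-cong (zeroˡ _) (*-congˡ (homogenize-* m n f g x y (tail f df) dg))) ⟩
    u * homogenize (suc m ℕ.+ n) g x y + (0# + x * (homogenize m f x y * homogenize n g x y))
      -- `g` has degree at most `n`, so homogenising it in degree `suc m + n` only adds the factor
      -- `y ^ suc m`.
      ≈⟨ +-congʳ (*-congˡ (trans (reflexive (≡.cong (λ k → homogenize k g x y) (ℕ.+-comm (suc m) n)))
           (homogenize-raise n (suc m) g x y dg))) ⟩
    u * (y ^ suc m * homogenize n g x y) + (0# + x * (homogenize m f x y * homogenize n g x y))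
      ≈⟨ solve 5 (λ u t x r s → u :* (t :* s) :+ (con (+ 0) :+ x :* (r :* s)) := (u :* t :+ x :* r) :* s)
           refl u (y ^ suc m) x _ _ ⟩
    (u * y ^ suc m + x * homogenize m f x y) * homogenize n g x y
      ∎

  homogenize-1 : ∀ n f x → DegreeAtMost f n → homogenize n f x 1# ≈ eval f x
  homogenize-1 n       []      x d = refl
  homogenize-1 zero    (u ∷ f) x d = sym (trans (+-congˡ (trans (*-congˡ (eval-zero f x (tail-0 f d))) (zeroʳ x))) (+-identityʳ u))
  homogenize-1 (suc n) (u ∷ f) x d =
    +-cong (trans (*-congˡ (1^ (suc n))) (*-identityʳ u)) (*-congˡ (homogenize-1 n f x (tail f d)))
    where
    1^ : ∀ k → 1# ^ k ≈ 1#
    1^ zero    = refl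
    1^ (suc k) = trans (*-identityˡ _) (1^ k)

  homogenize-dilate : ∀ n f t x y → DegreeAtMost f n →
    homogenize n f (t * x) (t * y) ≈ t ^ n * homogenize n f x y
  homogenize-dilate n       []      t x y d = sym (zeroʳ _)
  homogenize-dilate zero    (u ∷ f) t x y d = sym (*-identityˡ u)
  homogenize-dilate (suc n) (u ∷ f) t x y d = begin
    u * (t * y) ^ suc n + t * x * homogenize n f (t * x) (t * y)
      ≈⟨ +-cong (*-congˡ (^-distrib-* t y (suc n))) (*-congˡ (homogenize-dilate n f t x y (tail f d))) ⟩
    u * (t ^ suc n * y ^ suc n) + t * x * (t ^ n * homogenize n f x y)
      ≈⟨ solve 6 (λ u t t′ s x r → u :* (t :* t′ :* s) :+ t :* x :* (t′ :* r) := t :* t′ :* (u :* s :+ x :* r))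
           refl u t (t ^ n) (y ^ suc n) x _ ⟩
    t ^ suc n * (u * y ^ suc n + x * homogenize n f x y)
      ∎

  open RawSemiringDefs (RawRing.rawSemiring rawRing) using (sum)

  -- Brings the explicit sum in the definition of `Φʰᵒᵐ` into the Horner form on which the
  -- inductions run.
  sum-homogenize : ∀ m f x y →
    sum {suc m} (λ i → f ! toℕ i * x ^ toℕ i * y ^ (m ∸ toℕ i)) ≈ homogenize m f x y
  sum-homogenize m [] x y = zeros (suc m) (λ i → x ^ toℕ i) (λ i → y ^ (m ∸ toℕ i))
    where
    zeros : ∀ n (s t : Fin n → Carrier) → sum {n} (λ i → 0# * s i * t i) ≈ 0#
    zeros zero    s t = refl
    zeros (suc n) s t = trans
      (+-cong (trans (*-congʳ (zeroˡ _)) (zeroˡ _)) (zeros n (λ i → s (Fin.suc i)) (λ i → t (Fin.suc i))))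
      (+-identityˡ 0#)
  sum-homogenize zero    (u ∷ f) x y = trans (+-identityʳ _) (trans (*-identityʳ _) (*-identityʳ u))
  sum-homogenize (suc m) (u ∷ f) x y = +-cong (*-congʳ (*-identityʳ u)) (begin
    sum {suc m} (λ i → f ! toℕ i * (x * x ^ toℕ i) * y ^ (m ∸ toℕ i))
      ≈⟨ pull (suc m) (λ i → f ! toℕ i) (λ i → x ^ toℕ i) (λ i → y ^ (m ∸ toℕ i)) ⟩
    x * sum {suc m} (λ i → f ! toℕ i * x ^ toℕ i * y ^ (m ∸ toℕ i))
      ≈⟨ *-congˡ (sum-homogenize m f x y) ⟩
    x * homogenize m f x y
      ∎)
    where
    pull : ∀ n (r s t : Fin n → Carrier) →
      sum {n} (λ i → r i * (x * s i) * t i) ≈ x * sum {n} (λ i → r i * s i * t i)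
    pull zero    r s t = sym (zeroʳ x)
    pull (suc n) r s t = trans
      (+-congˡ (pull n (λ i → r (Fin.suc i)) (λ i → s (Fin.suc i)) (λ i → t (Fin.suc i))))
      (solve 5 (λ r x s t z → r :* (x :* s) :* t :+ x :* z := x :* (r :* s :* t :+ z)) refl _ x _ _ _)

-- Coefficientwise maps of polynomials

module _ {a ℓ b m} (R : CommutativeRing a ℓ) (S : CommutativeRing b m) where

  private
    module R = CommutativeRing R
    module S = CommutativeRing S
    module R[X] = Evaluation R
    module S[X] = Evaluation S

  module MapHom {f : R.Carrier → S.Carrier} (h : IsHom R S f) where

    open IsHom R S h

    map-! : ∀ p i → map f p S[X].! i S.≈ f (p R[X].! i)
    map-! []      i       = S.sym 0#-homo
    map-! (x ∷ p) zero    = S.refl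
    map-! (x ∷ p) (suc i) = map-! p i

    private
      map-+ : ∀ p q → map f (p R[X].+ₚ q) S[X].≈ₚ map f p S[X].+ₚ map f q
      map-+ p q i = begin
        map f (p R[X].+ₚ q) S[X].! i                  ≈⟨ map-! (p R[X].+ₚ q) i ⟩
        f ((p R[X].+ₚ q) R[X].! i)                    ≈⟨ ⟦⟧-cong (R[X].!-+ p q i) ⟩
        f (p R[X].! i R.+ q R[X].! i)                 ≈⟨ +-homo _ _ ⟩
        f (p R[X].! i) S.+ f (q R[X].! i)             ≈⟨ S.+-cong (map-! p i) (map-! q i) ⟨
        map f p S[X].! i S.+ map f q S[X].! i         ≈⟨ S[X].!-+ (map f p) (map f q) i ⟨
        (map f p S[X].+ₚ map f q) S[X].! i            ∎
        where open SetoidReasoning S.setoid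

      map-* : ∀ p q → map f (p R[X].*ₚ q) S[X].≈ₚ map f p S[X].*ₚ map f q
      map-* []      q i = S.refl
      map-* (x ∷ p) q i = begin
        map f ((x ∷ p) R[X].*ₚ q) S[X].! i
          ≈⟨ map-! ((x ∷ p) R[X].*ₚ q) i ⟩
        f (((x ∷ p) R[X].*ₚ q) R[X].! i)
          ≈⟨ ⟦⟧-cong (R[X].!-*-∷ x p q i) ⟩
        f (x R.* q R[X].! i R.+ (R.0# ∷ (p R[X].*ₚ q)) R[X].! i)
          ≈⟨ S.trans (+-homo _ _) (S.+-congʳ (*-homo _ _)) ⟩
        f x S.* f (q R[X].! i) S.+ f ((R.0# ∷ (p R[X].*ₚ q)) R[X].! i)
          ≈⟨ S.+-cong (S.*-congˡ (map-! q i)) (shifted i) ⟨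
        f x S.* map f q S[X].! i S.+ (S.0# ∷ (map f p S[X].*ₚ map f q)) S[X].! i
          ≈⟨ S[X].!-*-∷ (f x) (map f p) (map f q) i ⟨
        (map f (x ∷ p) S[X].*ₚ map f q) S[X].! i
          ∎
        where
        open SetoidReasoning S.setoid
        shifted : ∀ i → (S.0# ∷ (map f p S[X].*ₚ map f q)) S[X].! i S.≈ f ((R.0# ∷ (p R[X].*ₚ q)) R[X].! i)
        shifted zero    = S.sym 0#-homo
        shifted (suc i) = S.trans (S.sym (map-* p q i)) (map-! (p R[X].*ₚ q) i)

    map-isHom : IsHom R[X].polynomialRing S[X].polynomialRing (map f)
    map-isHom = isHom R[X].polynomialRing S[X].polynomialRing
      (λ {p} {q} p≈q i → S.trans (map-! p i) (S.trans (⟦⟧-cong (p≈q i)) (S.sym (map-! q i))))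
      map-+ map-* (λ { zero → 1#-homo ; (suc i) → S.refl })

    map-DegreeAtMost : ∀ p {n} → R[X].DegreeAtMost p n → S[X].DegreeAtMost (map f p) n
    map-DegreeAtMost p d k n<k = S.trans (map-! p k) (S.trans (⟦⟧-cong (d k n<k)) 0#-homo)

    map-isMonic : ∀ p {n} → R[X].IsMonicOfDegree p n → S[X].IsMonicOfDegree (map f p) n
    map-isMonic p (lead , d) =
      S.trans (map-! p _) (S.trans (⟦⟧-cong lead) 1#-homo) , map-DegreeAtMost p d

    eval-map : ∀ p x → f (R[X].eval p x) S.≈ S[X].eval (map f p) (f x)
    eval-map []      x = 0#-homo
    eval-map (u ∷ p) x = S.trans (+-homo _ _)
      (S.+-congˡ (S.trans (*-homo _ _) (S.*-congˡ (eval-map p x))))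

    homogenize-map : ∀ n p x y → f (R[X].homogenize n p x y) S.≈ S[X].homogenize n (map f p) (f x) (f y)
    homogenize-map n       []      x y = 0#-homo
    homogenize-map zero    (u ∷ p) x y = S.refl
    homogenize-map (suc n) (u ∷ p) x y = S.trans (+-homo _ _)
      (S.+-cong (S.trans (*-homo _ _) (S.*-congˡ (^-homo y (suc n))))
                (S.trans (*-homo _ _) (S.*-congˡ (homogenize-map n p x y))))

-- Counting, and the sum of the totients of the divisors

module Counting where

  open import Data.Nat.Base using (_+_; _*_)

  indicator : ∀ {p} {P : Set p} → Dec P → ℕ
  indicator P? = if does P? then 1 else 0

  indicator-yes : ∀ {p} {P : Set p} (P? : Dec P) → P → indicator P? ≡ 1
  indicator-yes (yes _) p = ≡.refl
  indicator-yes (no ¬p) p = contradiction p ¬p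

  indicator-no : ∀ {p} {P : Set p} (P? : Dec P) → ¬ P → indicator P? ≡ 0
  indicator-no (yes p) ¬p = contradiction p ¬p
  indicator-no (no _)  ¬p = ≡.refl

  -- The number of j with 1 ≤ j ≤ n and P j
  count : ∀ {p} {P : ℕ → Set p} → Unary.Decidable P → ℕ → ℕ
  count P? zero    = 0
  count P? (suc n) = indicator (P? (suc n)) + count P? n

  count-cong : ∀ {p q} {P : ℕ → Set p} {Q : ℕ → Set q} (P? : Unary.Decidable P) (Q? : Unary.Decidable Q) →
    (∀ j → P j → Q j) → (∀ j → Q j → P j) → ∀ n → count P? n ≡ count Q? n
  count-cong P? Q? P⇒Q Q⇒P zero    = ≡.refl
  count-cong P? Q? P⇒Q Q⇒P (suc n) = ≡.cong₂ _+_ step (count-cong P? Q? P⇒Q Q⇒P n)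
    where
    step : indicator (P? (suc n)) ≡ indicator (Q? (suc n))
    step with P? (suc n)
    ... | yes p = ≡.sym (indicator-yes (Q? (suc n)) (P⇒Q _ p))
    ... | no ¬p = ≡.sym (indicator-no (Q? (suc n)) (λ q → ¬p (Q⇒P _ q)))

  count-none : ∀ {p} {P : ℕ → Set p} (P? : Unary.Decidable P) m n →
    (∀ j → n < j → j ≤ m + n → ¬ P j) → count P? (m + n) ≡ count P? n
  count-none P? zero    n none = ≡.refl
  count-none P? (suc m) n none = ≡.cong₂ _+_
    (indicator-no (P? _) (none _ (s≤s (ℕ.m≤n+m n m)) ℕ.≤-refl))
    (count-none P? m n (λ j n<j j≤ → none j n<j (ℕ.m≤n⇒m≤1+n j≤)))

  count-unique : ∀ {p} {P : ℕ → Set p} (P? : Unary.Decidable P) n k → 1 ≤ k → k ≤ n → P k →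
    (∀ j → P j → j ≡ k) → count P? n ≡ 1
  count-unique P? zero    zero    () k≤n p unique
  count-unique P? (suc n) k 1≤k k≤n p unique with ℕ.m≤n⇒m<n∨m≡n k≤n
  ... | inj₁ (s≤s k≤n′) = ≡.cong₂ _+_
    (indicator-no (P? (suc n)) (λ q → ℕ.<⇒≢ (s≤s k≤n′) (≡.sym (unique _ q))))
    (count-unique P? n k 1≤k k≤n′ p unique)
  ... | inj₂ ≡.refl = ≡.cong₂ _+_ (indicator-yes (P? (suc n)) p)
    (≡.trans (≡.cong (count P?) (≡.sym (ℕ.+-identityʳ n)))
      (count-none P? n 0 (λ j _ j≤n q →
        ℕ.<⇒≢ (s≤s (≡.subst (j ≤_) (ℕ.+-identityʳ n) j≤n)) (unique j q))))

  -- None of the `g` numbers strictly between consecutive multiples of `suc g` satisfies `P`, so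
  -- each block contributes only its top element.
  count-multiples : ∀ {p} {P : ℕ → Set p} (P? : Unary.Decidable P) g → (∀ j → P j → suc g ∣ j) →
    ∀ d → count P? (d * suc g) ≡ count (λ k → P? (k * suc g)) d
  count-multiples P? g P⇒∣ zero    = ≡.refl
  count-multiples P? g P⇒∣ (suc d) = ≡.cong (ℕ._+_ (indicator (P? (suc d * suc g)))) (≡.trans
    (count-none P? g (d * suc g) (λ j lo hi p → between j lo hi (P⇒∣ j p)))
    (count-multiples P? g P⇒∣ d))
    where
    between : ∀ j → d * suc g < j → j ≤ g + d * suc g → ¬ suc g ∣ j
    between j lo hi (divides k ≡.refl) =
      ℕ.<⇒≱ (ℕ.*-cancelʳ-< (suc g) d k lo) (ℕ.s≤s⁻¹ (ℕ.*-cancelʳ-< (suc g) k (suc d) (s≤s hi)))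

  length-filter≡count : ∀ {p} {P : ℕ → Set p} (P? : Unary.Decidable P) n →
    length (filter P? (map suc (upTo n))) ≡ count P? n
  length-filter≡count P? zero    = ≡.refl
  length-filter≡count P? (suc n) = begin
    length (filter P? (map suc (upTo (suc n))))
      ≡⟨ ≡.cong (λ l → length (filter P? (map suc l))) (applyUpTo-∷ʳ (λ k → k) n) ⟨
    length (filter P? (map suc (upTo n ++ n ∷ [])))
      ≡⟨ ≡.cong (λ l → length (filter P? l)) (map-++ suc (upTo n) (n ∷ [])) ⟩
    length (filter P? (map suc (upTo n) ++ suc n ∷ []))
      ≡⟨ ≡.cong length (filter-++ P? (map suc (upTo n)) (suc n ∷ [])) ⟩
    length (filter P? (map suc (upTo n)) ++ filter P? (suc n ∷ []))
      ≡⟨ length-++ (filter P? (map suc (upTo n))) ⟩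
    length (filter P? (map suc (upTo n))) + length (filter P? (suc n ∷ []))
      ≡⟨ ≡.cong₂ _+_ (length-filter≡count P? n) last ⟩
    count P? n + indicator (P? (suc n))
      ≡⟨ ℕ.+-comm (count P? n) _ ⟩
    count P? (suc n)
      ∎
    where
    open ≡-Reasoning
    last : length (filter P? (suc n ∷ [])) ≡ indicator (P? (suc n))
    last with P? (suc n)
    ... | yes _ = ≡.refl
    ... | no  _ = ≡.refl

  φ≡count : ∀ n → φ n ≡ count (λ k → coprime? k n) n
  φ≡count n = length-filter≡count (λ k → coprime? k n) n

  -- The bound on the divisors is kept apart from `n`: the bound `n` gives all divisors, and its
  -- predecessor the proper ones.
  divisorSum : (ℕ → ℕ) → ℕ → ℕ → ℕ
  divisorSum f n zero    = 0
  divisorSum f n (suc m) = (if does (suc m ∣? n) then f (suc m) else 0) + divisorSum f n m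

  private
    sumTo : (ℕ → ℕ) → ℕ → ℕ
    sumTo f zero    = 0
    sumTo f (suc m) = f (suc m) + sumTo f m

    double-count : ∀ {r} {R : ℕ → ℕ → Set r} (R? : ∀ j d → Dec (R j d)) m n →
      sumTo (λ d → count (λ j → R? j d) n) m ≡ sumTo (λ j → count (R? j) m) n
    double-count R? zero    zero    = ≡.refl
    double-count R? (suc m) zero    = double-count R? m zero
    double-count R? zero    (suc n) = double-count R? zero n
    double-count R? (suc m) (suc n) = begin
      (a + b) + sumTo (λ d → count (λ j → R? j d) (suc n)) m
        ≡⟨ ≡.cong (ℕ._+_ (a + b)) (double-count R? m (suc n)) ⟩
      (a + b) + (c + sumTo (λ j → count (R? j) m) n)
        ≡⟨ ≡.cong (λ e → (a + b) + (c + e)) (double-count R? m n) ⟨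
      (a + b) + (c + s)
        ≡⟨ swap a b c s ⟩
      (a + c) + (b + s)
        ≡⟨ ≡.cong (ℕ._+_ (a + c)) (double-count R? (suc m) n) ⟩
      (a + c) + sumTo (λ j → count (R? j) (suc m)) n
        ∎
      where
      open ≡-Reasoning
      a b c s : ℕ
      a = indicator (R? (suc n) (suc m))
      b = count (λ j → R? j (suc m)) n
      c = count (R? (suc n)) m
      s = sumTo (λ d → count (λ j → R? j d) n) m
      swap : ∀ a b c s → (a + b) + (c + s) ≡ (a + c) + (b + s)
      swap a b c s = ≡.trans (ℕ.+-assoc a b _) (≡.trans (≡.cong (ℕ._+_ a)
        (≡.trans (≡.sym (ℕ.+-assoc b c s)) (≡.trans (≡.cong (_+ s) (ℕ.+-comm b c)) (ℕ.+-assoc c b s))))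
        (≡.sym (ℕ.+-assoc a c _)))

    sumTo-1 : ∀ f n → (∀ j → 1 ≤ j → j ≤ n → f j ≡ 1) → sumTo f n ≡ n
    sumTo-1 f zero    f≡1 = ≡.refl
    sumTo-1 f (suc n) f≡1 = ≡.cong₂ _+_ (f≡1 (suc n) (s≤s z≤n) ℕ.≤-refl)
      (sumTo-1 f n (λ j 1≤j j≤n → f≡1 j 1≤j (ℕ.m≤n⇒m≤1+n j≤n)))

    -- The relation `d = n / gcd j n`, that is, `d` is the additive order of `j` modulo `n`.
    codivisor? : ∀ n j d → Dec (gcd j n * d ≡ n)
    codivisor? n j d = gcd j n * d ℕ.≟ n

    -- For `suc n = suc d * suc g` the numbers in question are the multiples `k * suc g` with `k`
    -- prime to `suc d`. The decision is an argument so that it can be the very one that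
    -- `divisorSum` branches on.
    count-codivisor : ∀ n d (d∣?n : Dec (suc d ∣ suc n)) →
      count (λ j → codivisor? (suc n) j (suc d)) (suc n) ≡ (if does d∣?n then φ (suc d) else 0)
    count-codivisor n d (no d∤n) = ≡.trans
      (≡.cong (count (λ j → codivisor? (suc n) j (suc d))) (≡.sym (ℕ.+-identityʳ (suc n))))
      (count-none (λ j → codivisor? (suc n) j (suc d)) (suc n) 0
        (λ j _ _ eq → d∤n (divides (gcd j (suc n)) (≡.sym eq))))
    count-codivisor n d (yes (divides (suc g) n≡gd)) = begin
      count (λ j → codivisor? (suc n) j (suc d)) (suc n)
        ≡⟨ ≡.cong (λ k → count (λ j → codivisor? k j (suc d)) k) n≡dg ⟩
      count (λ j → codivisor? (suc d * suc g) j (suc d)) (suc d * suc g)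
        ≡⟨ count-multiples _ g (λ j eq → ≡.subst (_∣ j) (gcd≡ j eq) (gcd[m,n]∣m j _)) (suc d) ⟩
      count (λ k → codivisor? (suc d * suc g) (k * suc g) (suc d)) (suc d)
        ≡⟨ count-cong _ _ to from (suc d) ⟩
      count (λ k → coprime? k (suc d)) (suc d)
        ≡⟨ φ≡count (suc d) ⟨
      φ (suc d)
        ∎
      where
      open ≡-Reasoning
      n≡dg : suc n ≡ suc d * suc g
      n≡dg = ≡.trans n≡gd (ℕ.*-comm (suc g) (suc d))
      gcd≡ : ∀ j → gcd j (suc d * suc g) * suc d ≡ suc d * suc g → gcd j (suc d * suc g) ≡ suc g
      gcd≡ j eq = ℕ.*-cancelʳ-≡ _ (suc g) (suc d) (≡.trans eq (ℕ.*-comm (suc d) (suc g)))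
      factor : ∀ k → gcd (k * suc g) (suc d * suc g) ≡ suc g * gcd k (suc d)
      factor k = ≡.trans (≡.cong₂ gcd (ℕ.*-comm k (suc g)) (ℕ.*-comm (suc d) (suc g)))
        (≡.sym (c*gcd[m,n]≡gcd[cm,cn] (suc g) k (suc d)))
      to : ∀ k → gcd (k * suc g) (suc d * suc g) * suc d ≡ suc d * suc g → Coprime k (suc d)
      to k eq = gcd≡1⇒coprime (ℕ.*-cancelˡ-≡ _ 1 (suc g)
        (≡.trans (≡.sym (factor k)) (≡.trans (gcd≡ (k * suc g) eq) (≡.sym (ℕ.*-identityʳ (suc g))))))
      from : ∀ k → Coprime k (suc d) → gcd (k * suc g) (suc d * suc g) * suc d ≡ suc d * suc g
      from k cop = ≡.trans (≡.cong (_* suc d) (≡.trans (factor k)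
        (≡.trans (≡.cong (suc g *_) (coprime⇒gcd≡1 cop)) (ℕ.*-identityʳ (suc g)))))
        (ℕ.*-comm (suc g) (suc d))

  -- Gauss's identity, by counting the pairs `(j , d)` with `gcd j n * d ≡ n` in two ways: each `j`
  -- has exactly one `d`, and each divisor `d` has `φ d` values of `j`.
  divisorSum-φ : ∀ n → 1 ≤ n → divisorSum φ n n ≡ n
  divisorSum-φ (suc n) _ = begin
    divisorSum φ (suc n) (suc n)                                              ≡⟨ counted (suc n) ⟨
    sumTo (λ d → count (λ j → codivisor? (suc n) j d) (suc n)) (suc n)        ≡⟨ double-count (codivisor? (suc n)) (suc n) (suc n) ⟩
    sumTo (λ j → count (codivisor? (suc n) j) (suc n)) (suc n)                ≡⟨ sumTo-1 _ (suc n) (λ j _ _ → unique j) ⟩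
    suc n                                                                     ∎
    where
    open ≡-Reasoning
    counted : ∀ m → sumTo (λ d → count (λ j → codivisor? (suc n) j d) (suc n)) m ≡ divisorSum φ (suc n) m
    counted zero    = ≡.refl
    counted (suc m) = ≡.cong₂ _+_ (count-codivisor n m (suc m ∣? suc n)) (counted m)
    unique : ∀ j → count (codivisor? (suc n) j) (suc n) ≡ 1
    unique j = unique′ (gcd[m,n]∣n j (suc n))
      where
      unique′ : gcd j (suc n) ∣ suc n → count (codivisor? (suc n) j) (suc n) ≡ 1
      unique′ (divides (suc k) n≡kg) =
        count-unique (codivisor? (suc n) j) (suc n) (suc k) (s≤s z≤n)
          (Div.∣⇒≤ (divides (gcd j (suc n)) (≡.sym eq))) eq
          (λ d eq′ → ℕ.*-cancelˡ-≡ d (suc k) (gcd j (suc n)) {{nonZero}} (≡.trans eq′ (≡.sym eq)))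
        where
        eq : gcd j (suc n) * suc k ≡ suc n
        eq = ≡.trans (ℕ.*-comm (gcd j (suc n)) (suc k)) (≡.sym n≡kg)
        nonZero : ℕ.NonZero (gcd j (suc n))
        nonZero = ℕ.≢-nonZero (λ g≡0 → ℕ.0≢1+n (≡.trans (≡.sym (≡.cong (_* suc k) g≡0)) eq))

-- Geometric sums, and comaximality up to an integer

module Powers {a ℓ} (R : CommutativeRing a ℓ) where

  open CommutativeRing R
  open Exp commutativeSemiring using (_^_; ^-congʳ; ^-congˡ; ^-homo-*; ^-assocʳ)
  open Mult semiring using (×1-homo-*) renaming (_×_ to _·_)
  open Integers R using (module RingSolver)
  open RingSolver using (solve; _:=_; _:+_; _:*_; :-_; con)
  open SetoidReasoning setoid

  1^ : ∀ n → 1# ^ n ≈ 1#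
  1^ zero    = refl
  1^ (suc n) = trans (*-identityˡ _) (1^ n)

  ^≈1 : ∀ {x} n → x ≈ 1# → x ^ n ≈ 1#
  ^≈1 n x≈1 = trans (^-congˡ n x≈1) (1^ n)

  geometric : Carrier → ℕ → Carrier
  geometric x zero    = 0#
  geometric x (suc k) = 1# + x * geometric x k

  geometric-telescope : ∀ x k → (x + - 1#) * geometric x k ≈ x ^ k + - 1#
  geometric-telescope x zero    = solve 1 (λ x → (x :+ :- con (+ 1)) :* con (+ 0) := con (+ 1) :+ :- con (+ 1)) refl x
  geometric-telescope x (suc k) = begin
    (x + - 1#) * (1# + x * geometric x k)
      ≈⟨ solve 2 (λ x s → (x :+ :- con (+ 1)) :* (con (+ 1) :+ x :* s) := x :+ :- con (+ 1) :+ x :* ((x :+ :- con (+ 1)) :* s)) refl x _ ⟩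
    x + - 1# + x * ((x + - 1#) * geometric x k)
      ≈⟨ +-congˡ (*-congˡ (geometric-telescope x k)) ⟩
    x + - 1# + x * (x ^ k + - 1#)
      ≈⟨ solve 2 (λ x s → x :+ :- con (+ 1) :+ x :* (s :+ :- con (+ 1)) := x :* s :+ :- con (+ 1)) refl x _ ⟩
    x ^ suc k + - 1#
      ∎

  geometric-cong : ∀ k {x y} → x ≈ y → geometric x k ≈ geometric y k
  geometric-cong zero    x≈y = refl
  geometric-cong (suc k) x≈y = +-congˡ (*-cong x≈y (geometric-cong k x≈y))

  -- Modulo `x - 1` each of the `k` terms is 1. This congruence is where the integers in `Comaximal`
  -- come from.
  geometric-remainder : ∀ x k → ∃[ w ] geometric x k + (x + - 1#) * w ≈ k · 1#
  geometric-remainder x zero    = 0# , solve 1 (λ x → con (+ 0) :+ (x :+ :- con (+ 1)) :* con (+ 0) := con (+ 0)) refl x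
  geometric-remainder x (suc k) with geometric-remainder x k
  ... | w , eq = w + - geometric x k , trans
    (solve 3 (λ x s w → con (+ 1) :+ x :* s :+ (x :+ :- con (+ 1)) :* (w :+ :- s) :=
      con (+ 1) :+ (s :+ (x :+ :- con (+ 1)) :* w)) refl x _ w)
    (+-congˡ eq)

  geometric-1 : ∀ k {x} → x ≈ 1# → geometric x k ≈ k · 1#
  geometric-1 zero    x≈1 = refl
  geometric-1 (suc k) x≈1 = +-congˡ (trans (*-cong x≈1 (geometric-1 k x≈1)) (*-identityˡ _))

  ^-1-multiple : ∀ x m k → ∃[ w ] w * (x ^ m + - 1#) ≈ x ^ (k ℕ.* m) + - 1#
  ^-1-multiple x m k = geometric (x ^ m) k , trans (*-comm _ _) (trans (geometric-telescope (x ^ m) k)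
    (+-congʳ (trans (^-assocʳ x m k) (^-congʳ x (ℕ.*-comm m k)))))

  private
    -- From `u m = d + v n` one gets `x^d - 1 = (x^(u m) - 1) - x^d (x^(v n) -
    -- 1)`, and the two brackets are multiples of `x^m - 1` and `x^n - 1`.
    bézout-step : ∀ x d m n u v → d ℕ.+ v ℕ.* n ≡ u ℕ.* m →
      ∃[ s ] ∃[ t ] s * (x ^ m + - 1#) + t * (x ^ n + - 1#) ≈ x ^ d + - 1#
    bézout-step x d m n u v eq = s , - (x ^ d * t) , (begin
      s * (x ^ m + - 1#) + - (x ^ d * t) * (x ^ n + - 1#)
        ≈⟨ solve 5 (λ s t d m n → s :* (m :+ :- con (+ 1)) :+ :- (d :* t) :* (n :+ :- con (+ 1)) :=
             s :* (m :+ :- con (+ 1)) :+ :- (d :* (t :* (n :+ :- con (+ 1))))) refl s t (x ^ d) (x ^ m) (x ^ n) ⟩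
      s * (x ^ m + - 1#) + - (x ^ d * (t * (x ^ n + - 1#)))
        ≈⟨ +-cong s-eq (-‿cong (*-congˡ t-eq)) ⟩
      x ^ (u ℕ.* m) + - 1# + - (x ^ d * (x ^ (v ℕ.* n) + - 1#))
        ≈⟨ +-congʳ (+-congʳ (trans (^-congʳ x (≡.sym eq)) (^-homo-* x d (v ℕ.* n)))) ⟩
      x ^ d * x ^ (v ℕ.* n) + - 1# + - (x ^ d * (x ^ (v ℕ.* n) + - 1#))
        ≈⟨ solve 2 (λ d n → d :* n :+ :- con (+ 1) :+ :- (d :* (n :+ :- con (+ 1))) := d :+ :- con (+ 1)) refl (x ^ d) _ ⟩
      x ^ d + - 1#
        ∎)
      where
      s t : Carrier
      s = proj₁ (^-1-multiple x m u)
      t = proj₁ (^-1-multiple x n v)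
      s-eq : s * (x ^ m + - 1#) ≈ x ^ (u ℕ.* m) + - 1#
      s-eq = proj₂ (^-1-multiple x m u)
      t-eq : t * (x ^ n + - 1#) ≈ x ^ (v ℕ.* n) + - 1#
      t-eq = proj₂ (^-1-multiple x n v)

  ^-1-bézout : ∀ x {d m n} → Bézout.Identity d m n →
    ∃[ s ] ∃[ t ] s * (x ^ m + - 1#) + t * (x ^ n + - 1#) ≈ x ^ d + - 1#
  ^-1-bézout x {d} {m} {n} (Bézout.+- u v eq) = bézout-step x d m n u v eq
  ^-1-bézout x {d} {m} {n} (Bézout.-+ u v eq) =
    let s , t , eq′ = bézout-step x d n m v u eq in t , s , trans (+-comm _ _) eq′

  -- The ideal `(f , g)` contains a positive integer. In ℤ[X] the integer cannot always be 1: the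
  -- ideal generated by `X - 1` and `X + 1` contains 2 but not 1.
  Comaximal : Carrier → Carrier → Set _
  Comaximal f g = ∃[ k ] 1 ≤ k × ∃[ u ] ∃[ v ] u * f + v * g ≈ k · 1#

  comaximal-1 : ∀ f → Comaximal f 1#
  comaximal-1 f = 1 , s≤s z≤n , 0# , 1# ,
    solve 1 (λ f → con (+ 0) :* f :+ con (+ 1) :* con (+ 1) := con (+ 1) :+ con (+ 0)) refl f

  comaximal-* : ∀ f g h → Comaximal f g → Comaximal f h → Comaximal f (g * h)
  comaximal-* f g h (k , 1≤k , u , v , eq) (l , 1≤l , s , t , eq′) =
    k ℕ.* l , ℕ.*-mono-≤ 1≤k 1≤l , u * (s * f + t * h) + v * g * s , v * t , (begin
      (u * (s * f + t * h) + v * g * s) * f + v * t * (g * h)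
        ≈⟨ solve 7 (λ f g h u v s t → (u :* (s :* f :+ t :* h) :+ v :* g :* s) :* f :+ v :* t :* (g :* h) :=
             (u :* f :+ v :* g) :* (s :* f :+ t :* h)) refl f g h u v s t ⟩
      (u * f + v * g) * (s * f + t * h)     ≈⟨ *-cong eq eq′ ⟩
      (k · 1#) * (l · 1#)                   ≈⟨ ×1-homo-* k l ⟨
      (k ℕ.* l) · 1#                        ∎)

  -- In `k F = u f F + v g F` substitute `F = g b` in the first summand and `F = f a` in the second;
  -- both become multiples of `f g`.
  comaximal-divides : ∀ f g F a b → Comaximal f g → f * a ≈ F → g * b ≈ F →
    ∃[ k ] 1 ≤ k × ∃[ h ] f * g * h ≈ (k · 1#) * F
  comaximal-divides f g F a b (k , 1≤k , u , v , eq) fa≈F gb≈F = k , 1≤k , u * b + v * a , (begin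
    f * g * (u * b + v * a)
      ≈⟨ solve 6 (λ f g a b u v → f :* g :* (u :* b :+ v :* a) := u :* f :* (g :* b) :+ v :* g :* (f :* a)) refl f g a b u v ⟩
    u * f * (g * b) + v * g * (f * a)  ≈⟨ +-cong (*-congˡ gb≈F) (*-congˡ fa≈F) ⟩
    u * f * F + v * g * F              ≈⟨ distribʳ F _ _ ⟨
    (u * f + v * g) * F                ≈⟨ *-congʳ eq ⟩
    (k · 1#) * F                       ∎)

  -- Modulo (f , h) one has x ^ g = 1, hence there 0 = f G = k.
  comaximal-geometric : ∀ x f h G g k {a b s t xᵈ xᵉ} → 1 ≤ k → f * G ≈ geometric (x ^ g) k →
    s * (xᵈ + - 1#) + t * (xᵉ + - 1#) ≈ x ^ g + - 1# →
    f * a ≈ xᵈ + - 1# → h * b ≈ xᵉ + - 1# → Comaximal f h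
  comaximal-geometric x f h G g k {a} {b} {s} {t} {xᵈ} {xᵉ} 1≤k fG≈ xᵍ-1≈ fa≈ hb≈
    with geometric-remainder (x ^ g) k
  ... | w , eq = k , 1≤k , G + s * a * w , t * b * w , (begin
    (G + s * a * w) * f + t * b * w * h
      ≈⟨ solve 8 (λ f h G a b s t w → (G :+ s :* a :* w) :* f :+ t :* b :* w :* h :=
           f :* G :+ (s :* (f :* a) :+ t :* (h :* b)) :* w) refl f h G a b s t w ⟩
    f * G + (s * (f * a) + t * (h * b)) * w
      ≈⟨ +-cong fG≈ (*-congʳ (+-cong (*-congˡ fa≈) (*-congˡ hb≈))) ⟩
    geometric (x ^ g) k + (s * (xᵈ + - 1#) + t * (xᵉ + - 1#)) * w
      ≈⟨ +-congˡ (*-congʳ xᵍ-1≈) ⟩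
    geometric (x ^ g) k + (x ^ g + - 1#) * w
      ≈⟨ eq ⟩
    k · 1#
      ∎)

-- Division by a monic polynomial

module Division {a ℓ} (R : CommutativeRing a ℓ) where

  open CommutativeRing R
  open Evaluation R
  open Integers R using (module RingSolver)
  open RingSolver using (solve; _:=_; _:+_; :-_)
  open SetoidReasoning setoid
  open AbelianGroupProperties +-abelianGroup using (ε⁻¹≈ε)

  -- Stronger than `IsMonicOfDegree`: the list has no trailing zeros. `quotRem` and `quot` read the
  -- degree of the divisor off its length, so divisors have to be of this kind.
  IsMonicList : List Carrier → ℕ → Set ℓ
  IsMonicList f n = length f ≡ suc n × f ! n ≈ 1#

  isMonicList⇒isMonic : ∀ f {n} → IsMonicList f n → IsMonicOfDegree f n
  isMonicList⇒isMonic f (len , lead) =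
    lead , λ m n<m → !-length f (≡.subst (_≤ m) (≡.sym len) n<m)

  length-+ : ∀ f g → length (f +ₚ g) ≡ length f ℕ.⊔ length g
  length-+ []      g       = ≡.refl
  length-+ (x ∷ f) []      = ≡.refl
  length-+ (x ∷ f) (y ∷ g) = ≡.cong suc (length-+ f g)

  length-* : ∀ x f g {n} → length g ≡ suc n → length ((x ∷ f) *ₚ g) ≡ suc (length f ℕ.+ n)
  length-* x f g {n} len = ≡.trans (length-+ (map (x *_) g) _)
    (≡.trans (≡.cong (ℕ._⊔ suc (length (f *ₚ g))) (≡.trans (length-map (x *_) g) len))
      (≡.cong suc (rest f)))
    where
    rest : ∀ f → n ℕ.⊔ length (f *ₚ g) ≡ length f ℕ.+ n
    rest []      = ℕ.⊔-identityʳ n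
    rest (y ∷ f) = ≡.trans (≡.cong (n ℕ.⊔_) (length-* y f g len)) (ℕ.m≤n⇒m⊔n≡n (ℕ.m≤n+m n (suc (length f))))

  isMonicList-* : ∀ f g {m n} → IsMonicList f m → IsMonicList g n → IsMonicList (f *ₚ g) (m ℕ.+ n)
  isMonicList-* (x ∷ f) g {m} {n} F@(len , _) G@(len′ , _) =
    ≡.trans (length-* x f g len′) (≡.cong (ℕ._+ n) len) ,
    proj₁ (isMonic-* (x ∷ f) g (isMonicList⇒isMonic (x ∷ f) F) (isMonicList⇒isMonic g G))

  module _ (g : List Carrier) {m} (g-monic : IsMonicList g m) where

    private
      g-m : g ! m ≈ 1#
      g-m = proj₂ g-monic
      g-above : DegreeAtMost g m
      g-above = proj₂ (isMonicList⇒isMonic g g-monic)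

    quotient remainder : List Carrier → List Carrier
    quotient  f = proj₁ (quotRem f g)
    remainder f = proj₂ (quotRem f g)

    private
      top : Carrier → List Carrier → Carrier
      top x r = (x ∷ r) ! ℕ.pred (length g)

      top≈ : ∀ x r → top x r ≈ (x ∷ r) ! m
      top≈ x r = reflexive (≡.cong (λ l → (x ∷ r) ! ℕ.pred l) (proj₁ g-monic))

      const-* : ∀ t i → (const t *ₚ g) ! i ≈ t * g ! i
      const-* t i = trans (!-*-∷ t [] g i) (trans (+-congˡ (shift-0 (λ _ → refl) i)) (+-identityʳ _))

      !-remainder : ∀ x f i → remainder (x ∷ f) ! i ≈
        (x ∷ remainder f) ! i + - (top x (remainder f) * g ! i)
      !-remainder x f i = trans (!-+ (x ∷ remainder f) (-ₚ (const (top x (remainder f)) *ₚ g)) i)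
        (+-congˡ (trans (!-neg (const (top x (remainder f)) *ₚ g) i) (-‿cong (const-* (top x (remainder f)) i))))

    division : ∀ f → f ≈ₚ quotient f *ₚ g +ₚ remainder f
    division []      i = refl
    division (x ∷ f) i = sym (begin
      (quotient (x ∷ f) *ₚ g +ₚ remainder (x ∷ f)) ! i
        ≈⟨ trans (!-+ (quotient (x ∷ f) *ₚ g) (remainder (x ∷ f)) i)
             (+-cong (!-*-∷ t (quotient f) g i) (!-remainder x f i)) ⟩
      (t * g ! i + (0# ∷ (quotient f *ₚ g)) ! i) + ((x ∷ remainder f) ! i + - (t * g ! i))
        ≈⟨ solve 3 (λ u v w → (u :+ v) :+ (w :+ :- u) := v :+ w) refl _ _ _ ⟩
      (0# ∷ (quotient f *ₚ g)) ! i + (x ∷ remainder f) ! i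
        ≈⟨ combined i ⟩
      (x ∷ f) ! i
        ∎)
      where
      t : Carrier
      t = top x (remainder f)
      combined : ∀ i → (0# ∷ (quotient f *ₚ g)) ! i + (x ∷ remainder f) ! i ≈ (x ∷ f) ! i
      combined zero    = +-identityˡ x
      combined (suc i) = trans (sym (!-+ (quotient f *ₚ g) (remainder f) i)) (sym (division f i))

    -- In degree `m` the multiple `t g` is chosen to cancel; in higher degrees both the shifted old
    -- remainder and `g` vanish.
    remainder-small : ∀ f i → m ≤ i → remainder f ! i ≈ 0#
    remainder-small []      i m≤i = refl
    remainder-small (x ∷ f) i m≤i = trans (!-remainder x f i) (small i m≤i)
      where
      t : Carrier
      t = top x (remainder f)
      small : ∀ i → m ≤ i → (x ∷ remainder f) ! i + - (t * g ! i) ≈ 0#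
      small i m≤i with ℕ.m≤n⇒m<n∨m≡n m≤i
      ... | inj₂ ≡.refl = trans (+-cong (sym (top≈ x (remainder f)))
        (-‿cong (trans (*-congˡ g-m) (*-identityʳ t)))) (-‿inverseʳ t)
      small (suc i) m≤i | inj₁ (s≤s m≤i′) = trans
        (+-cong (remainder-small f i m≤i′) (-‿cong (trans (*-congˡ (g-above (suc i) (s≤s m≤i′))) (zeroʳ t))))
        (trans (+-identityˡ _) ε⁻¹≈ε)

    length-quotient : ∀ f → length (quotient f) ≡ length f
    length-quotient []      = ≡.refl
    length-quotient (x ∷ f) = ≡.cong suc (length-quotient f)

    -- A multiple of the monic g that agrees with r in degrees ≥ m
    -- vanishes there as soon as r does.
    multiple-small : ∀ h r → g *ₚ h ≈ₚ r → (∀ i → m ≤ i → r ! i ≈ 0#) → h ≈ₚ []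
    multiple-small h r gh≈r r-small j = cofactor-bounded g h 0 (isMonicList⇒isMonic g g-monic)
      (λ i m≤i → trans (gh≈r i) (r-small i m≤i)) j z≤n

    -- `g (h - quotient f)` equals the remainder, which vanishes from degree `m` on; as `g` is
    -- monic, `h - quotient f` is zero.
    quotient-unique : ∀ f h → f ≈ₚ g *ₚ h → quotient f ≈ₚ h
    quotient-unique f h f≈gh i = sym (x∙y⁻¹≈ε⇒x≈y _ _ (trans (sym (trans (!-+ h _ i) (+-congˡ (!-neg (quotient f) i))))
      (multiple-small (h +ₚ -ₚ quotient f) (remainder f) difference (remainder-small f) i)))
      where
      open AbelianGroupProperties +-abelianGroup using (x∙y⁻¹≈ε⇒x≈y)
      module P = CommutativeRing polynomialRing
      module PR = RingProperties P.ring
      difference : g *ₚ (h +ₚ -ₚ quotient f) ≈ₚ remainder f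
      difference i = begin
        (g *ₚ (h +ₚ -ₚ quotient f)) ! i
          ≈⟨ P.distribˡ g h (-ₚ quotient f) i ⟩
        (g *ₚ h +ₚ g *ₚ (-ₚ quotient f)) ! i
          ≈⟨ trans (!-+ (g *ₚ h) _ i) (+-cong (sym (f≈gh i)) (sym (PR.-‿distribʳ-* g (quotient f) i))) ⟩
        f ! i + (-ₚ (g *ₚ quotient f)) ! i
          ≈⟨ +-cong (trans (division f i) (!-+ (quotient f *ₚ g) (remainder f) i))
               (trans (!-neg (g *ₚ quotient f) i) (-‿cong (P.*-comm g (quotient f) i))) ⟩
        ((quotient f *ₚ g) ! i + remainder f ! i) + - ((quotient f *ₚ g) ! i)
          ≈⟨ solve 2 (λ u v → (u :+ v) :+ :- u := v) refl _ _ ⟩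
        remainder f ! i
          ∎

  !-take : ∀ k f → (∀ i → k ≤ i → f ! i ≈ 0#) → take k f ≈ₚ f
  !-take zero    f       small i       = sym (small i z≤n)
  !-take (suc k) []      small i       = refl
  !-take (suc k) (x ∷ f) small zero    = refl
  !-take (suc k) (x ∷ f) small (suc i) = !-take k f (λ j k≤j → small (suc j) (s≤s k≤j)) i

  -- The raw quotient has as many entries as `f`, while `h` has degree `n ∸ m`. So `take` drops only
  -- zeros, and the result ends in its leading 1 and can serve as a factor of the next divisor.
  quot-correct : 1# ≉ 0# → ∀ f g h {m n} → IsMonicList f n → IsMonicList g m → f ≈ₚ g *ₚ h →
    m ≤ n × IsMonicList (quot f g) (n ∸ m) × quot f g ≈ₚ h
  quot-correct 1≉0 f g h {m} {n} f-monic g-monic f≈gh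
    with isMonic-cofactor 1≉0 g h (isMonicList⇒isMonic g g-monic)
           (isMonic-resp f (g *ₚ h) f≈gh (isMonicList⇒isMonic f f-monic))
  ... | m≤n , lead , above =
    m≤n , (≡.trans (length-take _ Q) (≡.trans (ℕ.m≤n⇒m⊓n≡m
            (≡.subst₂ _≤_ (≡.sym size) (≡.sym len-Q) (s≤s (ℕ.m∸n≤m n m)))) size)
          , trans (quot≈h (n ∸ m)) lead) , quot≈h
    where
    Q : List Carrier
    Q = quotient g g-monic f
    len-Q : length Q ≡ suc n
    len-Q = ≡.trans (length-quotient g g-monic f) (proj₁ f-monic)
    size : suc (length f) ∸ length g ≡ suc (n ∸ m)
    size = ≡.trans (≡.cong₂ (λ u v → suc u ∸ v) (proj₁ f-monic) (proj₁ g-monic)) (ℕ.+-∸-assoc 1 m≤n)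
    quot≈h : quot f g ≈ₚ h
    quot≈h i = trans
      (!-take _ Q (λ j k≤j → trans (quotient-unique g g-monic f h f≈gh j)
        (above j (≡.subst (_≤ j) size k≤j))) i)
      (quotient-unique g g-monic f h f≈gh i)

-- Reciprocal polynomials

module Reciprocal {a ℓ} (R : CommutativeRing a ℓ) where

  open CommutativeRing R
  open Evaluation R
  open Integers R using (module RingSolver)
  open RingSolver using (solve; _:=_; _:+_; _:*_)
  open SetoidReasoning setoid
  open Exp commutativeSemiring using (_^_)
  module P = CommutativeRing polynomialRing
  open Exp P.commutativeSemiring using () renaming (_^_ to _^ₚ_)
  private module R[X] = Evaluation polynomialRing

  X-* : ∀ f → X *ₚ f ≈ₚ 0# ∷ f
  X-* f i = trans (!-*-∷ 0# (1# ∷ []) f i) (trans (+-congʳ (zeroˡ _))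
    (trans (+-identityˡ _) (shift-cong (P.*-identityˡ f) i)))

  Xⁿ-list : ∀ n → replicate n 0# ++ 1# ∷ [] ≈ₚ X ^ₚ n
  Xⁿ-list zero    i = refl
  Xⁿ-list (suc n) i = sym (trans (X-* (X ^ₚ n) i) (shift-cong (λ j → sym (Xⁿ-list n j)) i))

  homogenize-Xⁿ : ∀ n e x y → homogenize (n ℕ.+ e) (X ^ₚ n) x y ≈ x ^ n * y ^ e
  homogenize-Xⁿ zero    zero    x y = sym (*-identityˡ 1#)
  homogenize-Xⁿ zero    (suc e) x y = trans (+-cong refl (zeroʳ x)) (+-identityʳ _)
  homogenize-Xⁿ (suc n) e       x y = begin
    homogenize (suc n ℕ.+ e) (X *ₚ X ^ₚ n) x y
      ≈⟨ homogenize-cong (suc n ℕ.+ e) (X *ₚ X ^ₚ n) (0# ∷ X ^ₚ n) (X-* (X ^ₚ n)) refl refl ⟩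
    0# * y ^ suc (n ℕ.+ e) + x * homogenize (n ℕ.+ e) (X ^ₚ n) x y
      ≈⟨ +-cong (zeroˡ _) (*-congˡ (homogenize-Xⁿ n e x y)) ⟩
    0# + x * (x ^ n * y ^ e)
      ≈⟨ trans (+-identityˡ _) (sym (*-assoc _ _ _)) ⟩
    x ^ suc n * y ^ e
      ∎

  -- X ^ n f (1 / X)
  reciprocal : ℕ → List Carrier → List Carrier
  reciprocal n f = R[X].homogenize n (map const f) P.1# X

  -- Reversing the coefficients exchanges the two variables. The excess `e` serves the induction:
  -- the tail has nominal degree `n` but is still homogenised in degree `suc n + e`.
  homogenize-reciprocal : ∀ n e f x y →
    homogenize (n ℕ.+ e) (reciprocal n f) x y ≈ y ^ e * homogenize n f y x
  homogenize-reciprocal n       e       []      x y = sym (zeroʳ _)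
  homogenize-reciprocal zero    zero    (u ∷ f) x y = sym (*-identityˡ u)
  homogenize-reciprocal zero    (suc e) (u ∷ f) x y = trans (+-cong (*-comm _ _) (zeroʳ x)) (+-identityʳ _)
  homogenize-reciprocal (suc n) e       (u ∷ f) x y = begin
    homogenize k (const u *ₚ X ^ₚ suc n +ₚ P.1# *ₚ reciprocal n f) x y
      ≈⟨ homogenize-+ k (const u *ₚ X ^ₚ suc n) _ x y ⟩
    homogenize k (const u *ₚ X ^ₚ suc n) x y + homogenize k (P.1# *ₚ reciprocal n f) x y
      ≈⟨ +-cong first second ⟩
    u * (x ^ suc n * y ^ e) + y ^ suc e * homogenize n f y x
      ≈⟨ solve 5 (λ u s t y r → u :* (s :* t) :+ y :* t :* r := t :* (u :* s :+ y :* r)) refl u _ _ y _ ⟩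
    y ^ e * (u * x ^ suc n + y * homogenize n f y x)
      ∎
    where
    k : ℕ
    k = suc n ℕ.+ e
    first : homogenize k (const u *ₚ X ^ₚ suc n) x y ≈ u * (x ^ suc n * y ^ e)
    first = begin
      homogenize k (const u *ₚ X ^ₚ suc n) x y
        ≈⟨ homogenize-* 0 k (const u) (X ^ₚ suc n) x y (λ { (suc m) _ → refl }) X^-degree ⟩
      u * homogenize k (X ^ₚ suc n) x y
        ≈⟨ *-congˡ (homogenize-Xⁿ (suc n) e x y) ⟩
      u * (x ^ suc n * y ^ e)
        ∎
      where
      X^-degree : DegreeAtMost (X ^ₚ suc n) k
      X^-degree = DegreeAtMost-mono (X ^ₚ suc n) (ℕ.m≤m+n (suc n) e)
        (DegreeAtMost-resp (replicate (suc n) 0# ++ 1# ∷ []) (X ^ₚ suc n) (Xⁿ-list (suc n)) (list-degree (suc n)))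
        where
        list-degree : ∀ n → DegreeAtMost (replicate n 0# ++ 1# ∷ []) n
        list-degree zero    (suc m) _         = refl
        list-degree (suc n) (suc m) (s≤s n<m) = list-degree n m n<m
    second : homogenize k (P.1# *ₚ reciprocal n f) x y ≈ y ^ suc e * homogenize n f y x
    second = begin
      homogenize k (P.1# *ₚ reciprocal n f) x y
        ≈⟨ homogenize-cong k (P.1# *ₚ reciprocal n f) (reciprocal n f) (P.*-identityˡ (reciprocal n f)) refl refl ⟩
      homogenize k (reciprocal n f) x y
        ≡⟨ ≡.cong (λ j → homogenize j (reciprocal n f) x y) (≡.sym (ℕ.+-suc n e)) ⟩
      homogenize (n ℕ.+ suc e) (reciprocal n f) x y
        ≈⟨ homogenize-reciprocal n (suc e) f x y ⟩
      y ^ suc e * homogenize n f y x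
        ∎

  reciprocal-cong : ∀ n f g → f ≈ₚ g → reciprocal n f ≈ₚ reciprocal n g
  reciprocal-cong n f g f≈g = R[X].homogenize-cong n (map const f) (map const g) {P.1#} {P.1#} {X} {X}
    (RingMorphisms.IsRingHomomorphism.⟦⟧-cong map-const {f} {g} f≈g) (λ i → refl) (λ i → refl)
    where
    map-const : IsHom polynomialRing R[X].polynomialRing (map const)
    map-const = MapHom.map-isHom R polynomialRing const-isHom

  reciprocal-* : ∀ m n f g → DegreeAtMost f m → DegreeAtMost g n →
    reciprocal (m ℕ.+ n) (f *ₚ g) ≈ₚ reciprocal m f *ₚ reciprocal n g
  reciprocal-* m n f g df dg i = trans
    (R[X].homogenize-cong (m ℕ.+ n) (map const (f *ₚ g)) (map const f R[X].*ₚ map const g) {P.1#} {P.1#} {X} {X}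
      (M.*-homo f g) (λ _ → refl) (λ _ → refl) i)
    (R[X].homogenize-* m n (map const f) (map const g) P.1# X
      (MapHom.map-DegreeAtMost R polynomialRing const-isHom f df)
      (MapHom.map-DegreeAtMost R polynomialRing const-isHom g dg) i)
    where
    module M = RingMorphisms.IsRingHomomorphism (MapHom.map-isHom R polynomialRing const-isHom)

  homogenize-swap : ∀ n f → reciprocal n f ≈ₚ f → ∀ x y → homogenize n f x y ≈ homogenize n f y x
  homogenize-swap n f rec x y = begin
    homogenize n f x y                        ≈⟨ homogenize-cong n (reciprocal n f) f rec refl refl ⟨
    homogenize n (reciprocal n f) x y         ≡⟨ ≡.cong (λ j → homogenize j (reciprocal n f) x y) (ℕ.+-identityʳ n) ⟨
    homogenize (n ℕ.+ 0) (reciprocal n f) x y ≈⟨ homogenize-reciprocal n 0 f x y ⟩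
    1# * homogenize n f y x                   ≈⟨ *-identityˡ _ ⟩
    homogenize n f y x                        ∎

module _ {a ℓ b m} (R : CommutativeRing a ℓ) (S : CommutativeRing b m) where

  private
    module R = CommutativeRing R
    module S = CommutativeRing S
    module R[X] = Evaluation R
    module S[X] = Evaluation S
    module RecR = Reciprocal R
    module RecS = Reciprocal S

  reciprocal-map : ∀ {f : R.Carrier → S.Carrier} → IsHom R S f → ∀ n p →
    map f (RecR.reciprocal n p) S[X].≈ₚ RecS.reciprocal n (map f p)
  reciprocal-map {f} h n p i = S.trans
    (MapHom.homogenize-map R[X].polynomialRing S[X].polynomialRing
      (MapHom.map-isHom R S h) n (map R[X].const p) RecR.P.1# R[X].X i)
    (S.trans (S.reflexive (≡.cong (λ q → S[X][X].homogenize n q (map f RecR.P.1#) (map f R[X].X) S[X].! i)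
        (≡.trans (≡.sym (map-∘ p)) (map-∘ p))))
      (S[X][X].homogenize-cong n (map S[X].const (map f p)) (map S[X].const (map f p))
        {map f RecR.P.1#} {RecS.P.1#} {map f R[X].X} {S[X].X} (λ _ _ → S.refl)
        (λ { zero → 1#-homo ; (suc i) → S.refl })
        (λ { zero → 0#-homo ; (suc zero) → 1#-homo ; (suc (suc i)) → S.refl }) i))
    where
    open IsHom R S h
    module S[X][X] = Evaluation S[X].polynomialRing

-- Identities for cofactors and divisors in a commutative ring

module Rearrangement {a ℓ} (R : CommutativeRing a ℓ) where

  open CommutativeRing R
  open Integers R using (module RingSolver)
  open RingSolver using (solve; _:=_; _:+_; _:*_; :-_; con)

  *-factorˡ : ∀ f a b r → a ≈ b * r → f * a ≈ f * b * r
  *-factorˡ f a b r a≈br = trans (*-congˡ a≈br) (sym (*-assoc f b r))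

  *-factorʳ : ∀ f a b r → a ≈ b * r → f * a ≈ b * (f * r)
  *-factorʳ f a b r a≈br = trans (*-congˡ a≈br)
    (solve 3 (λ f b r → f :* (b :* r) := b :* (f :* r)) refl f b r)

  divides-multiple : ∀ f a w F G → f * a ≈ F → w * F ≈ G → f * (w * a) ≈ G
  divides-multiple f a w F G fa≈F wF≈G = trans
    (solve 3 (λ f a w → f :* (w :* a) := w :* (f :* a)) refl f a w) (trans (*-congˡ fa≈F) wF≈G)

  -- For `cyclotomic-geometric`: `f` is `Φ n`, `D` the product over the proper divisors of `n`, `D′`
  -- that over the divisors of `g`, `E = X^g - 1`, `F = X^n - 1`, and `s` the geometric sum.
  -- Cancelling the monic `E` leaves `f r ≈ s`.
  cofactor-of-telescope : ∀ f D D′ E r s F → D ≈ D′ * r → D′ ≈ E → f * D ≈ F → E * s ≈ F →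
    E * (f * r) ≈ E * s
  cofactor-of-telescope f D D′ E r s F D≈ D′≈E fD≈F Es≈F = trans
    (solve 3 (λ f E r → E :* (f :* r) := f :* (E :* r)) refl f E r)
    (trans (*-congˡ (trans (*-congʳ (sym D′≈E)) (sym D≈))) (trans fD≈F (sym Es≈F)))

  scaled-remainder : ∀ D Q F r h c → F ≈ Q * D + r → D * h ≈ c * F → D * (h + - (c * Q)) ≈ c * r
  scaled-remainder D Q F r h c F≈ Dh≈ = begin
    D * (h + - (c * Q))            ≈⟨ solve 4 (λ D h c Q → D :* (h :+ :- (c :* Q)) := D :* h :+ :- (c :* (Q :* D))) refl D h c Q ⟩
    D * h + - (c * (Q * D))        ≈⟨ +-congʳ (trans Dh≈ (*-congˡ F≈)) ⟩
    c * (Q * D + r) + - (c * (Q * D)) ≈⟨ solve 3 (λ c u r → c :* (u :+ r) :+ :- (c :* u) := c :* r) refl c (Q * D) r ⟩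
    c * r                          ∎
    where open SetoidReasoning setoid

  -- Primes stand for coefficient reversal, which negates both X^n - 1 and
  -- the product D of the Φ_d over the proper divisors d of n.
  reversed-cofactor : ∀ f f′ D D′ E → D′ ≈ - D → f′ * D′ ≈ - E → f * D ≈ E → D * f′ ≈ D * f
  reversed-cofactor f f′ D D′ E D′≈ f′D′≈ fD≈E = begin
    D * f′          ≈⟨ solve 2 (λ D f → D :* f := :- (f :* (:- D))) refl D f′ ⟩
    - (f′ * - D)    ≈⟨ -‿cong (trans (*-congˡ (sym D′≈)) f′D′≈) ⟩
    - - E           ≈⟨ solve 1 (λ E → :- (:- E) := E) refl E ⟩
    E               ≈⟨ trans (sym fD≈E) (*-comm f D) ⟩
    D * f           ∎
    where open SetoidReasoning setoid

  reversed-step : ∀ f f′ D D′ → f′ ≈ f → D′ ≈ - D → f′ * D′ ≈ - (f * D)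
  reversed-step f f′ D D′ f′≈ D′≈ = trans (*-cong f′≈ D′≈)
    (solve 2 (λ f D → f :* (:- D) := :- (f :* D)) refl f D)

  0*t+1*r : ∀ z t r → z ≈ 0# → z * t + 1# * r ≈ r
  0*t+1*r z t r z≈0 = trans (+-congʳ (*-congʳ z≈0))
    (solve 2 (λ t r → con (+ 0) :* t :+ con (+ 1) :* r := r) refl t r)

  -t+1 : ∀ t → - 1# * t + 1# * 1# ≈ - (t + - 1#)
  -t+1 = solve 1 (λ t → :- con (+ 1) :* t :+ con (+ 1) :* con (+ 1) := :- (t :+ :- con (+ 1))) refl

  two-terms : ∀ t → 1# + t * (1# + t * 0#) ≈ 1# + t
  two-terms = solve 1 (λ t → con (+ 1) :+ t :* (con (+ 1) :+ t :* con (+ 0)) := con (+ 1) :+ t) refl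

-- Cyclotomic polynomials over the integers

module Cyclotomic where

  private
    Z : CommutativeRing _ _
    Z = ℤ.+-*-commutativeRing

  open CommutativeRing Z using () renaming (0# to 0ℤ; 1# to 1ℤ)
  open Evaluation Z public
  open Division Z public
  open Reciprocal Z public
  open Counting
  open Exp P.commutativeSemiring using () renaming (_^_ to _^ₚ_)
  open Mult P.semiring using () renaming (_×_ to _·_)
  open Powers polynomialRing public
  open Rearrangement polynomialRing

  Xⁿ-1 : ℕ → List ℤ
  Xⁿ-1 n = X ^ₚ n +ₚ -ₚ P.1#

  Xⁿ⁺¹-1≈ : ∀ n → Xⁿ⁺¹-1 n ≈ₚ Xⁿ-1 (suc n)
  Xⁿ⁺¹-1≈ n i = ≡.sym (≡.trans (!-+ (X ^ₚ suc n) (-ₚ P.1#) i)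
    (≡.trans (≡.cong (ℤ._+ (-ₚ P.1#) ! i) (X-* (X ^ₚ n) i)) (at i)))
    where
    at : ∀ i → (0ℤ ∷ X ^ₚ n) ! i ℤ.+ (-ₚ P.1#) ! i ≡ Xⁿ⁺¹-1 n ! i
    at zero    = ≡.refl
    at (suc i) = ≡.trans (ℤ.+-identityʳ _) (≡.sym (Xⁿ-list n i))

  Xⁿ⁺¹-1-monic : ∀ n → IsMonicList (Xⁿ⁺¹-1 n) (suc n)
  Xⁿ⁺¹-1-monic n = ≡.cong suc (len n) , lead n
    where
    len : ∀ n → length (replicate n 0ℤ ++ 1ℤ ∷ []) ≡ suc n
    len zero    = ≡.refl
    len (suc n) = ≡.cong suc (len n)
    lead : ∀ n → (replicate n 0ℤ ++ 1ℤ ∷ []) ! n ≡ 1ℤ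
    lead zero    = ≡.refl
    lead (suc n) = lead n

  Xⁿ-1-monic : ∀ n → 1 ≤ n → IsMonicOfDegree (Xⁿ-1 n) n
  Xⁿ-1-monic (suc n) _ = isMonic-resp (Xⁿ⁺¹-1 n) (Xⁿ-1 (suc n)) (Xⁿ⁺¹-1≈ n)
    (isMonicList⇒isMonic (Xⁿ⁺¹-1 n) (Xⁿ⁺¹-1-monic n))

  -- Opaque, lest the type checker run the recursion defining cyclotomic.
  opaque

    Φ : ℕ → List ℤ
    Φ = cyclotomic

    divisorProduct : ℕ → ℕ → List ℤ
    divisorProduct n m = foldr _*ₚ_ P.1#
      (map proj₂ (filter (λ dΦ → proj₁ dΦ ∣? n) (cyclotomicsUpTo m)))

    Φ≡cyclotomic : ∀ n → Φ n ≡ cyclotomic n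
    Φ≡cyclotomic n = ≡.refl

    Φ-suc : ∀ n → Φ (suc n) ≡ quot (Xⁿ⁺¹-1 n) (divisorProduct (suc n) n)
    Φ-suc n = ≡.refl

    divisorProduct-0 : ∀ n → divisorProduct n 0 ≡ P.1#
    divisorProduct-0 n = ≡.refl

    divisorProduct-∣ : ∀ {n} m → suc m ∣ n → divisorProduct n (suc m) ≡ Φ (suc m) *ₚ divisorProduct n m
    divisorProduct-∣ {n} m m∣n = ≡.cong (λ l → foldr _*ₚ_ P.1# (map proj₂ l))
      (filter-accept (λ dΦ → proj₁ dΦ ∣? n) {suc m , cyclotomic (suc m)} {cyclotomicsUpTo m} m∣n)

    divisorProduct-∤ : ∀ {n} m → ¬ suc m ∣ n → divisorProduct n (suc m) ≡ divisorProduct n m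
    divisorProduct-∤ {n} m m∤n = ≡.cong (λ l → foldr _*ₚ_ P.1# (map proj₂ l))
      (filter-reject (λ dΦ → proj₁ dΦ ∣? n) {suc m , cyclotomic (suc m)} {cyclotomicsUpTo m} m∤n)

  divisorSum-∣ : ∀ f {n} m → suc m ∣ n → divisorSum f n (suc m) ≡ f (suc m) ℕ.+ divisorSum f n m
  divisorSum-∣ f {n} m m∣n = ≡.cong (ℕ._+ divisorSum f n m) (pick (suc m ∣? n))
    where
    pick : (d : Dec (suc m ∣ n)) → (if does d then f (suc m) else 0) ≡ f (suc m)
    pick (yes _)  = ≡.refl
    pick (no m∤n) = contradiction m∣n m∤n

  divisorSum-∤ : ∀ f {n} m → ¬ suc m ∣ n → divisorSum f n (suc m) ≡ divisorSum f n m
  divisorSum-∤ f {n} m m∤n = ≡.cong (ℕ._+ divisorSum f n m) (pick (suc m ∣? n))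
    where
    pick : (d : Dec (suc m ∣ n)) → (if does d then f (suc m) else 0) ≡ 0
    pick (yes m∣n) = contradiction m∣n m∤n
    pick (no _)    = ≡.refl

  divisorProduct-stable : ∀ g k → 1 ≤ g → divisorProduct g (k ℕ.+ g) ≡ divisorProduct g g
  divisorProduct-stable g       zero    1≤g = ≡.refl
  divisorProduct-stable (suc g) (suc k) 1≤g = ≡.trans
    (divisorProduct-∤ (k ℕ.+ suc g) (Div.>⇒∤ (s≤s (ℕ.m≤n+m (suc g) k))))
    (divisorProduct-stable (suc g) k 1≤g)

  -- Divisors of `g` are divisors of `n`; `r` collects the `Φ d` for which `d` divides `n` but not
  -- `g`.
  divisorProduct-split : ∀ {g n} → g ∣ n → ∀ m →
    ∃[ r ] divisorProduct n m ≈ₚ divisorProduct g m *ₚ r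
  divisorProduct-split {g} {n} g∣n zero    = P.1# , λ i → ≡.trans (≡.cong (_! i) (divisorProduct-0 n))
    (≡.trans (≡.sym (P.*-identityˡ P.1# i)) (≡.cong (λ p → (p *ₚ P.1#) ! i) (≡.sym (divisorProduct-0 g))))
  divisorProduct-split {g} {n} g∣n (suc m) with divisorProduct-split g∣n m | suc m ∣? g | suc m ∣? n
  ... | r , eq | yes m∣g | no m∤n = contradiction (Div.∣-trans m∣g g∣n) m∤n
  ... | r , eq | yes m∣g | yes m∣n = r , λ i → ≡.trans
    (≡.cong (_! i) (divisorProduct-∣ m m∣n)) (≡.trans
    (*-factorˡ (Φ (suc m)) (divisorProduct n m) (divisorProduct g m) r eq i)
    (≡.cong (λ p → (p *ₚ r) ! i) (≡.sym (divisorProduct-∣ m m∣g))))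
  ... | r , eq | no m∤g | yes m∣n = Φ (suc m) *ₚ r , λ i → ≡.trans
    (≡.cong (_! i) (divisorProduct-∣ m m∣n)) (≡.trans
    (*-factorʳ (Φ (suc m)) (divisorProduct n m) (divisorProduct g m) r eq i)
    (≡.cong (λ p → (p *ₚ (Φ (suc m) *ₚ r)) ! i) (≡.sym (divisorProduct-∤ m m∤g))))
  ... | r , eq | no m∤g | no m∤n = r , λ i → ≡.trans
    (≡.cong (_! i) (divisorProduct-∤ m m∤n)) (≡.trans (eq i)
    (≡.cong (λ p → (p *ₚ r) ! i) (≡.sym (divisorProduct-∤ m m∤g))))

  -- The induction hypothesis: the monic shape and the product formula for all smaller indices
  -- together show that the next division is exact.
  record IsCyclotomic (n : ℕ) : Set where
    field
      monic   : IsMonicList (Φ n) (φ n)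
      product : divisorProduct n n ≈ₚ Xⁿ-1 n

  open IsCyclotomic

  divisorProduct-monic : ∀ n m → (∀ d → 1 ≤ d → d ≤ m → IsCyclotomic d) →
    IsMonicList (divisorProduct n m) (divisorSum φ n m)
  divisorProduct-monic n zero    cyc = ≡.subst (λ p → IsMonicList p 0) (≡.sym (divisorProduct-0 n)) (≡.refl , ≡.refl)
  divisorProduct-monic n (suc m) cyc with suc m ∣? n
  ... | yes m∣n = ≡.subst₂ IsMonicList (≡.sym (divisorProduct-∣ m m∣n)) (≡.sym (divisorSum-∣ φ m m∣n))
    (isMonicList-* (Φ (suc m)) (divisorProduct n m)
      (monic (cyc (suc m) (s≤s z≤n) ℕ.≤-refl))
      (divisorProduct-monic n m (λ d 1≤d d≤m → cyc d 1≤d (ℕ.m≤n⇒m≤1+n d≤m))))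
  ... | no m∤n = ≡.subst₂ IsMonicList (≡.sym (divisorProduct-∤ m m∤n)) (≡.sym (divisorSum-∤ φ m m∤n))
    (divisorProduct-monic n m (λ d 1≤d d≤m → cyc d 1≤d (ℕ.m≤n⇒m≤1+n d≤m)))

  divisorProduct-last : ∀ n → divisorProduct (suc n) (suc n) ≡ Φ (suc n) *ₚ divisorProduct (suc n) n
  divisorProduct-last n = divisorProduct-∣ n Div.∣-refl

  cyclotomic-∣ : ∀ n → 1 ≤ n → IsCyclotomic n → ∃[ a ] Φ n *ₚ a ≈ₚ Xⁿ-1 n
  cyclotomic-∣ (suc n) _ cyc = divisorProduct (suc n) n ,
    λ i → ≡.trans (≡.cong (_! i) (≡.sym (divisorProduct-last n))) (product cyc i)

  -- `n` is not a divisor of `g`, so the factor `Φ n` of `X^n - 1` survives in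
  -- `(X^n - 1) / (X^g - 1)`. The division is a cancellation of the monic `X^g - 1`.
  cyclotomic-geometric : ∀ n g k → 1 ≤ g → g < n → n ≡ k ℕ.* g → IsCyclotomic n → IsCyclotomic g →
    ∃[ r ] Φ n *ₚ r ≈ₚ geometric (X ^ₚ g) k
  cyclotomic-geometric (suc n) g k 1≤g (s≤s g≤n) n≡kg cyc-n cyc-g with divisorProduct-split (divides k n≡kg) n
  ... | r , split = r , monic-cancel (Xⁿ-1 g) (Φ (suc n) *ₚ r) (geometric (X ^ₚ g) k)
    (Xⁿ-1-monic g 1≤g)
    (cofactor-of-telescope (Φ (suc n)) (divisorProduct (suc n) n) (divisorProduct g n) (Xⁿ-1 g) r
      (geometric (X ^ₚ g) k) (Xⁿ-1 (suc n)) split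
      (λ i → ≡.trans (≡.cong (_! i) (≡.trans (≡.cong (divisorProduct g) (≡.sym (ℕ.m∸n+n≡m g≤n)))
        (divisorProduct-stable g (n ∸ g) 1≤g))) (product cyc-g i))
      (λ i → ≡.trans (≡.cong (_! i) (≡.sym (divisorProduct-last n))) (product cyc-n i))
      (λ i → ≡.trans (geometric-telescope (X ^ₚ g) k i) (powers i)))
    where
    powers : (X ^ₚ g) ^ₚ k +ₚ -ₚ P.1# ≈ₚ Xⁿ-1 (suc n)
    powers i = ≡.trans (!-+ ((X ^ₚ g) ^ₚ k) (-ₚ P.1#) i) (≡.trans
      (≡.cong (ℤ._+ (-ₚ P.1#) ! i) (≡.trans (Exp.^-assocʳ P.commutativeSemiring X g k i)
        (≡.cong (λ j → (X ^ₚ j) ! i) (≡.trans (ℕ.*-comm g k) (≡.sym n≡kg)))))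
      (≡.sym (!-+ (X ^ₚ suc n) (-ₚ P.1#) i)))

  -- With `g = gcd d e` and `d = k g`, the ideal contains `X^d - 1` and `X^e - 1`, hence `X^g - 1`.
  -- It also contains the geometric sum of `k` powers of `X^g`, which is congruent to `k`. The
  -- hypothesis `e < d` makes `g` a proper divisor of `d`.
  cyclotomic-comaximal : ∀ d e → 1 ≤ e → e < d → (∀ m → 1 ≤ m → m ≤ d → IsCyclotomic m) →
    Comaximal (Φ d) (Φ e)
  cyclotomic-comaximal d e 1≤e e<d cyc with gcd[m,n]∣m d e
  ... | divides k d≡kg
    with cyclotomic-geometric d g k 1≤g g<d d≡kg cyc-d (cyc g 1≤g (ℕ.<⇒≤ g<d))
       | ^-1-bézout X (Bézout.identity (gcd-GCD d e))
       | cyclotomic-∣ d 1≤d cyc-d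
       | cyclotomic-∣ e 1≤e (cyc e 1≤e (ℕ.<⇒≤ e<d))
    where
    g : ℕ
    g = gcd d e
    1≤d : 1 ≤ d
    1≤d = ℕ.≤-trans 1≤e (ℕ.<⇒≤ e<d)
    1≤g : 1 ≤ g
    1≤g = ℕ.n≢0⇒n>0 (gcd[m,n]≢0 d e (inj₁ (ℕ.m<n⇒n≢0 1≤d)))
    g<d : g < d
    g<d = ℕ.≤-<-trans (Div.∣⇒≤ {{ℕ.>-nonZero 1≤e}} (gcd[m,n]∣n d e)) e<d
    cyc-d : IsCyclotomic d
    cyc-d = cyc d 1≤d ℕ.≤-refl
  ... | r , geo | s , t , béz | a , d-eq | b , e-eq =
    comaximal-geometric X (Φ d) (Φ e) r (gcd d e) k {a} {b} {s} {t} {X ^ₚ d} {X ^ₚ e}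
      1≤k geo béz d-eq e-eq
    where
    1≤k : 1 ≤ k
    1≤k = ℕ.n≢0⇒n>0 (λ { ≡.refl → ℕ.m<n⇒n≢0 e<d d≡kg })

  divisorProduct-comaximal : ∀ n d m → m < d → (∀ e → 1 ≤ e → e ≤ d → IsCyclotomic e) →
    Comaximal (Φ d) (divisorProduct n m)
  divisorProduct-comaximal n d zero    m<d cyc = ≡.subst (Comaximal (Φ d)) (≡.sym (divisorProduct-0 n)) (comaximal-1 (Φ d))
  divisorProduct-comaximal n d (suc m) m<d cyc with suc m ∣? n
  ... | yes m∣n = ≡.subst (Comaximal (Φ d)) (≡.sym (divisorProduct-∣ m m∣n))
    (comaximal-* (Φ d) (Φ (suc m)) (divisorProduct n m)
      (cyclotomic-comaximal d (suc m) (s≤s z≤n) m<d cyc)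
      (divisorProduct-comaximal n d m (ℕ.<-trans (ℕ.n<1+n m) m<d) cyc))
  ... | no m∤n = ≡.subst (Comaximal (Φ d)) (≡.sym (divisorProduct-∤ m m∤n))
    (divisorProduct-comaximal n d m (ℕ.<-trans (ℕ.n<1+n m) m<d) cyc)

  ·1≡+ : ∀ k → Mult._×_ (CommutativeRing.semiring Z) k 1ℤ ≡ + k
  ·1≡+ zero    = ≡.refl
  ·1≡+ (suc k) = ≡.cong (ℤ._+_ 1ℤ) (·1≡+ k)

  !-multiple : ∀ k f i → ((k · P.1#) *ₚ f) ! i ≡ + k ℤ.* f ! i
  !-multiple k f i = ≡.trans
    (P.*-cong {k · P.1#} {const (+ k)} {f} {f} scalar (λ _ → ≡.refl) i)
    (≡.trans (!-*-∷ (+ k) [] f i) (≡.trans (≡.cong (ℤ._+_ (+ k ℤ.* f ! i)) (shift-0 {[]} (λ _ → ≡.refl) i)) (ℤ.+-identityʳ _)))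
    where
    scalar : k · P.1# ≈ₚ const (+ k)
    scalar i = ≡.trans (≡.sym (IsHom.×1-homo Z polynomialRing const-isHom k i))
      (≡.cong (λ u → const u ! i) (·1≡+ k))

  -- Divide `F` by `D`: `k` times the remainder is a multiple of the monic `D` but of smaller
  -- degree, hence zero, and ℤ has no torsion.
  divides-torsion-free : ∀ D h F {m} k → IsMonicList D m → 1 ≤ k →
    D *ₚ h ≈ₚ (k · P.1#) *ₚ F → ∃[ h′ ] D *ₚ h′ ≈ₚ F
  divides-torsion-free D h F {m} (suc k) D-monic _ Dh≈kF = Q , λ i → ≡.trans (P.*-comm D Q i)
    (≡.sym (≡.trans (division D D-monic F i) (≡.trans (!-+ (Q *ₚ D) r i)
      (≡.trans (≡.cong (ℤ._+_ ((Q *ₚ D) ! i)) (r≈0 i)) (ℤ.+-identityʳ _)))))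
    where
    c Q r : List ℤ
    c = suc k · P.1#
    Q = quotient D D-monic F
    r = remainder D D-monic F
    E : List ℤ
    E = h +ₚ -ₚ (c *ₚ Q)
    DE≈cr : D *ₚ E ≈ₚ c *ₚ r
    DE≈cr = scaled-remainder D Q F r h c (division D D-monic F) Dh≈kF
    E≈0 : E ≈ₚ []
    E≈0 = multiple-small D D-monic E (c *ₚ r) DE≈cr
      (λ i m≤i → ≡.trans (!-multiple (suc k) r i)
        (≡.trans (≡.cong (ℤ._*_ (+ suc k)) (remainder-small D D-monic F i m≤i)) (ℤ.*-zeroʳ (+ suc k))))
    r≈0 : ∀ i → r ! i ≡ 0ℤ
    r≈0 i = ℤ.*-cancelˡ-≡ (+ suc k) (r ! i) 0ℤ (≡.trans (≡.sym (!-multiple (suc k) r i))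
      (≡.trans (≡.sym (DE≈cr i)) (≡.trans (P.*-cong {D} {D} {E} {[]} (λ _ → ≡.refl) E≈0 i)
        (≡.trans (P.zeroʳ D i) (≡.sym (ℤ.*-zeroʳ (+ suc k)))))))

  -- Induction on the bound: `Φ (suc m)` and the product so far both divide `X^n - 1`, so their
  -- product divides a positive multiple `l` of it, and `l` is removed by monicity.
  divisorProduct-divides : ∀ n m → (∀ d → 1 ≤ d → d ≤ m → IsCyclotomic d) →
    ∃[ h ] divisorProduct n m *ₚ h ≈ₚ Xⁿ-1 n
  divisorProduct-divides n zero    cyc = Xⁿ-1 n ,
    λ i → ≡.trans (≡.cong (λ p → (p *ₚ Xⁿ-1 n) ! i) (divisorProduct-0 n)) (P.*-identityˡ (Xⁿ-1 n) i)
  divisorProduct-divides n (suc m) cyc = step (suc m ∣? n)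
    where
    D : List ℤ
    D = divisorProduct n m
    ih : ∃[ h ] D *ₚ h ≈ₚ Xⁿ-1 n
    ih = divisorProduct-divides n m (λ d 1≤d d≤m → cyc d 1≤d (ℕ.m≤n⇒m≤1+n d≤m))
    Φ-∣ : ∃[ a ] Φ (suc m) *ₚ a ≈ₚ Xⁿ-1 (suc m)
    Φ-∣ = cyclotomic-∣ (suc m) (s≤s z≤n) (cyc (suc m) (s≤s z≤n) ℕ.≤-refl)
    step : Dec (suc m ∣ n) → ∃[ h ] divisorProduct n (suc m) *ₚ h ≈ₚ Xⁿ-1 n
    step (no m∤n) = proj₁ ih ,
      λ i → ≡.trans (≡.cong (λ p → (p *ₚ proj₁ ih) ! i) (divisorProduct-∤ m m∤n)) (proj₂ ih i)
    step (yes m∣n@(divides k n≡)) =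
      proj₁ exact , λ i → ≡.trans (≡.cong (λ p → (p *ₚ proj₁ exact) ! i) (divisorProduct-∣ m m∣n)) (proj₂ exact i)
      where
      multiple : ∃[ w ] w *ₚ Xⁿ-1 (suc m) ≈ₚ X ^ₚ (k ℕ.* suc m) +ₚ -ₚ P.1#
      multiple = ^-1-multiple X (suc m) k
      upToScalar : ∃[ l ] 1 ≤ l × ∃[ h ] Φ (suc m) *ₚ D *ₚ h ≈ₚ (l · P.1#) *ₚ Xⁿ-1 n
      upToScalar = comaximal-divides (Φ (suc m)) D (Xⁿ-1 n) (proj₁ multiple *ₚ proj₁ Φ-∣) (proj₁ ih)
        (divisorProduct-comaximal n (suc m) m ℕ.≤-refl cyc)
        (divides-multiple (Φ (suc m)) (proj₁ Φ-∣) (proj₁ multiple) (Xⁿ-1 (suc m)) (Xⁿ-1 n) (proj₂ Φ-∣)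
          (≡.subst (λ j → proj₁ multiple *ₚ Xⁿ-1 (suc m) ≈ₚ Xⁿ-1 j) (≡.sym n≡) (proj₂ multiple)))
        (proj₂ ih)
      exact : ∃[ h ] Φ (suc m) *ₚ D *ₚ h ≈ₚ Xⁿ-1 n
      exact = divides-torsion-free (Φ (suc m) *ₚ D) (proj₁ (proj₂ (proj₂ upToScalar))) (Xⁿ-1 n) (proj₁ upToScalar)
        (≡.subst₂ IsMonicList (divisorProduct-∣ m m∣n) (≡.refl {x = divisorSum φ n (suc m)})
          (divisorProduct-monic n (suc m) cyc))
        (proj₁ (proj₂ upToScalar)) (proj₂ (proj₂ (proj₂ upToScalar)))

  private
    isCyclotomic-step : ∀ n → (∀ d → 1 ≤ d → d ≤ n → IsCyclotomic d) → IsCyclotomic (suc n)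
    isCyclotomic-step n cyc = record
      { monic   = ≡.subst₂ IsMonicList (≡.sym (Φ-suc n)) degree (proj₁ (proj₂ correct))
      ; product = λ i → ≡.trans (≡.cong (_! i) (divisorProduct-last n))
          (≡.trans (P.*-cong {Φ (suc n)} {proj₁ h} {D} {D}
              (λ j → ≡.trans (≡.cong (_! j) (Φ-suc n)) (proj₂ (proj₂ correct) j)) (λ _ → ≡.refl) i)
            (≡.trans (P.*-comm (proj₁ h) D i) (proj₂ h i)))
      }
      where
      D : List ℤ
      D = divisorProduct (suc n) n
      h : ∃[ h ] D *ₚ h ≈ₚ Xⁿ-1 (suc n)
      h = divisorProduct-divides (suc n) n cyc
      correct : divisorSum φ (suc n) n ≤ suc n ×
        IsMonicList (quot (Xⁿ⁺¹-1 n) D) (suc n ∸ divisorSum φ (suc n) n) × quot (Xⁿ⁺¹-1 n) D ≈ₚ proj₁ h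
      correct = quot-correct (λ ()) (Xⁿ⁺¹-1 n) D (proj₁ h) (Xⁿ⁺¹-1-monic n)
        (divisorProduct-monic (suc n) n cyc) (λ i → ≡.trans (Xⁿ⁺¹-1≈ n i) (≡.sym (proj₂ h i)))
      -- Gauss's identity: the totients of the proper divisors add up to `suc n - φ (suc n)`.
      degree : suc n ∸ divisorSum φ (suc n) n ≡ φ (suc n)
      degree = ≡.trans (≡.cong (_∸ divisorSum φ (suc n) n)
        (≡.trans (≡.sym (divisorSum-φ (suc n) (s≤s z≤n))) (divisorSum-∣ φ n Div.∣-refl)))
        (ℕ.m+n∸n≡m (φ (suc n)) (divisorSum φ (suc n) n))

    isCyclotomic-≤ : ∀ n d → 1 ≤ d → d ≤ n → IsCyclotomic d
    isCyclotomic-≤ zero    zero () d≤n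
    isCyclotomic-≤ (suc n) d 1≤d d≤n with ℕ.m≤n⇒m<n∨m≡n d≤n
    ... | inj₁ (s≤s d≤n′) = isCyclotomic-≤ n d 1≤d d≤n′
    ... | inj₂ ≡.refl     = isCyclotomic-step n (isCyclotomic-≤ n)

  isCyclotomic : ∀ n → 1 ≤ n → IsCyclotomic n
  isCyclotomic n 1≤n = isCyclotomic-≤ n n 1≤n ℕ.≤-refl

-- Palindromicity of the cyclotomic polynomials

module Palindromic where

  open Cyclotomic
  open Counting using (divisorSum; divisorSum-φ)
  open Exp P.commutativeSemiring using () renaming (_^_ to _^ₚ_)
  open Rearrangement polynomialRing

  private
    reciprocal-Xⁿ : ∀ n → reciprocal n (replicate n (+ 0) ++ + 1 ∷ []) ≈ₚ P.1#
    reciprocal-Xⁿ zero    i = ≡.refl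
    reciprocal-Xⁿ (suc n) i = ≡.trans
      (0*t+1*r (const (+ 0)) t r (shift-0 {[]} (λ _ → ≡.refl)) i)
      (reciprocal-Xⁿ n i)
      where
      t r : List ℤ
      t = X ^ₚ suc n
      r = reciprocal n (replicate n (+ 0) ++ + 1 ∷ [])

    reciprocal-Xⁿ-1 : ∀ n → 1 ≤ n → reciprocal n (Xⁿ-1 n) ≈ₚ -ₚ Xⁿ-1 n
    reciprocal-Xⁿ-1 (suc n) _ i = ≡.trans
      (reciprocal-cong (suc n) (Xⁿ-1 (suc n)) (Xⁿ⁺¹-1 n) (λ j → ≡.sym (Xⁿ⁺¹-1≈ n j)) i)
      (≡.trans (P.+-cong {u} {u} {P.1# *ₚ r} {P.1# *ₚ P.1#} (λ _ → ≡.refl)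
          (P.*-cong {P.1#} {P.1#} {r} {P.1#} (λ _ → ≡.refl) (reciprocal-Xⁿ n)) i)
        (-t+1 t i))
      where
      t r u : List ℤ
      t = X ^ₚ suc n
      r = reciprocal n (replicate n (+ 0) ++ + 1 ∷ [])
      u = (-ₚ P.1#) *ₚ t

  Φ-palindromic : ℕ → Set
  Φ-palindromic d = reciprocal (φ d) (Φ d) ≈ₚ Φ d

  open IsCyclotomic

  private
    Φ-degree : ∀ n → 1 ≤ n → DegreeAtMost (Φ n) (φ n)
    Φ-degree n 1≤n = proj₂ (isMonicList⇒isMonic (Φ n) (monic (isCyclotomic n 1≤n)))

    DP-monic : ∀ n m → IsMonicOfDegree (divisorProduct n m) (divisorSum φ n m)
    DP-monic n m = isMonicList⇒isMonic (divisorProduct n m)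
      (divisorProduct-monic n m (λ d 1≤d _ → isCyclotomic d 1≤d))

    1∣ : ∀ {n} → 1 ∣ n
    1∣ {n} = divides n (≡.sym (ℕ.*-identityʳ n))

    divisorProduct-1 : ∀ n → divisorProduct n 1 ≈ₚ Xⁿ-1 1
    divisorProduct-1 n i = ≡.trans (≡.cong (_! i) (≡.trans (divisorProduct-∣ {n} 0 1∣)
      (≡.trans (≡.cong (Φ 1 *ₚ_) (≡.trans (divisorProduct-0 n) (≡.sym (divisorProduct-0 1))))
        (≡.sym (divisorProduct-∣ {1} 0 Div.∣-refl)))))
      (product (isCyclotomic 1 ℕ.≤-refl) i)

    -- The factor for the divisor 1 is `X - 1`, which reversal negates, and every other factor is
    -- palindromic by hypothesis. The bound is `suc m` so that the divisor 1 is always included.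
    reciprocal-divisorProduct : ∀ n m → (∀ d → 2 ≤ d → d ≤ suc m → Φ-palindromic d) →
      reciprocal (divisorSum φ n (suc m)) (divisorProduct n (suc m)) ≈ₚ -ₚ divisorProduct n (suc m)
    reciprocal-divisorProduct n zero    pal i = ≡.trans
      (≡.cong (λ k → reciprocal k (divisorProduct n 1) ! i) (divisorSum-∣ φ {n} 0 1∣))
      (≡.trans (reciprocal-cong 1 (divisorProduct n 1) (Xⁿ-1 1) (divisorProduct-1 n) i)
        (≡.trans (reciprocal-Xⁿ-1 1 ℕ.≤-refl i)
          (P.-‿cong {Xⁿ-1 1} {divisorProduct n 1} (λ j → ≡.sym (divisorProduct-1 n j)) i)))
    reciprocal-divisorProduct n (suc m) pal = step (d ∣? n)
      where
      d : ℕ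
      d = suc (suc m)
      ih : reciprocal (divisorSum φ n (suc m)) (divisorProduct n (suc m)) ≈ₚ -ₚ divisorProduct n (suc m)
      ih = reciprocal-divisorProduct n m (λ e 2≤e e≤ → pal e 2≤e (ℕ.m≤n⇒m≤1+n e≤))
      step : Dec (d ∣ n) → reciprocal (divisorSum φ n d) (divisorProduct n d) ≈ₚ -ₚ divisorProduct n d
      step (no d∤n) = ≡.subst₂ (λ k p → reciprocal k p ≈ₚ -ₚ p)
        (≡.sym (divisorSum-∤ φ (suc m) d∤n)) (≡.sym (divisorProduct-∤ (suc m) d∤n)) ih
      step (yes d∣n) = ≡.subst₂ (λ k p → reciprocal k p ≈ₚ -ₚ p)
        (≡.sym (divisorSum-∣ φ (suc m) d∣n)) (≡.sym (divisorProduct-∣ (suc m) d∣n))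
        (λ i → ≡.trans
          (reciprocal-* (φ d) (divisorSum φ n (suc m)) (Φ d) D (Φ-degree d (s≤s z≤n)) (proj₂ (DP-monic n (suc m))) i)
          (reversed-step (Φ d) (reciprocal (φ d) (Φ d)) D (reciprocal (divisorSum φ n (suc m)) D)
            (pal d (s≤s (s≤s z≤n)) ℕ.≤-refl) ih i))
        where
        D : List ℤ
        D = divisorProduct n (suc m)

    palindromic-step : ∀ m → (∀ d → 2 ≤ d → d ≤ suc m → Φ-palindromic d) → Φ-palindromic (suc (suc m))
    palindromic-step m pal = monic-cancel D f′ (Φ n) (DP-monic n (suc m))
      (reversed-cofactor (Φ n) f′ D D′ (Xⁿ-1 n) (reciprocal-divisorProduct n m pal)
        (λ i → ≡.trans (≡.sym (reciprocal-* (φ n) (divisorSum φ n (suc m)) (Φ n) D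
            (Φ-degree n (s≤s z≤n)) (proj₂ (DP-monic n (suc m))) i))
          (≡.trans (≡.cong (λ k → reciprocal k (Φ n *ₚ D) ! i) degree)
            (≡.trans (reciprocal-cong n (Φ n *ₚ D) (Xⁿ-1 n) ΦD≈ i) (reciprocal-Xⁿ-1 n (s≤s z≤n) i))))
        ΦD≈)
      where
      n : ℕ
      n = suc (suc m)
      D D′ f′ : List ℤ
      D  = divisorProduct n (suc m)
      D′ = reciprocal (divisorSum φ n (suc m)) D
      f′ = reciprocal (φ n) (Φ n)
      ΦD≈ : Φ n *ₚ D ≈ₚ Xⁿ-1 n
      ΦD≈ i = ≡.trans (≡.cong (_! i) (≡.sym (divisorProduct-last (suc m)))) (product (isCyclotomic n (s≤s z≤n)) i)
      degree : φ n ℕ.+ divisorSum φ n (suc m) ≡ n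
      degree = ≡.trans (≡.sym (divisorSum-∣ φ (suc m) Div.∣-refl)) (divisorSum-φ n (s≤s z≤n))

    palindromic-≤ : ∀ m d → 2 ≤ d → d ≤ suc m → Φ-palindromic d
    palindromic-≤ zero    d 2≤d d≤1 = contradiction (ℕ.≤-trans 2≤d d≤1) ℕ.1+n≰n
    palindromic-≤ (suc m) d 2≤d d≤ with ℕ.m≤n⇒m<n∨m≡n d≤
    ... | inj₁ (s≤s d≤′) = palindromic-≤ m d 2≤d d≤′
    ... | inj₂ ≡.refl    = palindromic-step m (palindromic-≤ m)

  palindromic : ∀ d → 2 ≤ d → Φ-palindromic d
  palindromic (suc d) 2≤d = palindromic-≤ d (suc d) 2≤d ℕ.≤-refl

-- Cyclotomic polynomials and forms over a commutative ring

module CyclotomicOver {a ℓ} (S : CommutativeRing a ℓ) where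

  open CommutativeRing S
  private module S[X] = Evaluation S
  open Exp commutativeSemiring using (_^_; ^-congˡ)
  private
    module C = Cyclotomic
    module Powers-S = Powers S

  ℤ-isHom : IsHom ℤ.+-*-commutativeRing S (fromℤ rawRing)
  ℤ-isHom = Integers.fromℤ-isHom S

  private
    map-ℤ : IsHom C.polynomialRing S[X].polynomialRing (map (fromℤ rawRing))
    map-ℤ = MapHom.map-isHom ℤ.+-*-commutativeRing S ℤ-isHom

    evalℤ : Carrier → List ℤ → Carrier
    evalℤ x f = S[X].eval (map (fromℤ rawRing) f) x

    evalℤ-isHom : ∀ x → IsHom C.polynomialRing S (evalℤ x)
    evalℤ-isHom x = Composition.isRingHomomorphism trans map-ℤ (S[X].eval-isHom x)

    module E x = IsHom C.polynomialRing S (evalℤ-isHom x)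
    module M = IsHom C.polynomialRing S[X].polynomialRing map-ℤ

    evalℤ-X : ∀ x → evalℤ x C.X ≈ x
    evalℤ-X x = trans (S[X].eval-cong (map (fromℤ rawRing) C.X) S[X].X map-X refl) (S[X].eval-X x)
      where
      map-X : map (fromℤ rawRing) C.X S[X].≈ₚ S[X].X
      map-X zero          = refl
      map-X (suc zero)    = +-identityʳ 1#
      map-X (suc (suc i)) = refl

  open S[X] using (eval; homogenize; IsMonicOfDegree)

  Φ : ℕ → List Carrier
  Φ n = map (fromℤ rawRing) (C.Φ n)

  Φ≡cyclotomicOver : ∀ n → Φ n ≡ cyclotomicOver rawRing n
  Φ≡cyclotomicOver n = ≡.cong (map (fromℤ rawRing)) (C.Φ≡cyclotomic n)

  Φʰ : ℕ → Carrier → Carrier → Carrier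
  Φʰ n = homogenize (φ n) (Φ n)

  Φ-monic : ∀ n → 1 ≤ n → IsMonicOfDegree (Φ n) (φ n)
  Φ-monic n 1≤n = MapHom.map-isMonic ℤ.+-*-commutativeRing S ℤ-isHom (C.Φ n)
    (C.isMonicList⇒isMonic (C.Φ n) (C.IsCyclotomic.monic (C.isCyclotomic n 1≤n)))

  Φʰ-swap : ∀ n → 2 ≤ n → ∀ x y → Φʰ n x y ≈ Φʰ n y x
  Φʰ-swap n 2≤n = Reciprocal.homogenize-swap S (φ n) (Φ n) (λ i → trans
    (sym (reciprocal-map ℤ.+-*-commutativeRing S ℤ-isHom (φ n) (C.Φ n) i))
    (M.⟦⟧-cong {C.reciprocal (φ n) (C.Φ n)} {C.Φ n} (Palindromic.palindromic n 2≤n) i))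

  Φʰ-1 : ∀ n → 1 ≤ n → ∀ x → Φʰ n x 1# ≈ eval (Φ n) x
  Φʰ-1 n 1≤n x = S[X].homogenize-1 (φ n) (Φ n) x (proj₂ (Φ-monic n 1≤n))

  -- By symmetry of the form the constant coefficient equals the leading one. For `n = 1` it would
  -- be -1.
  Φʰ-0 : ∀ n → 2 ≤ n → Φʰ n 0# 1# ≈ 1#
  Φʰ-0 n 2≤n = trans (Φʰ-swap n 2≤n 0# 1#) (trans (lead (φ n) (Φ n)) (proj₁ (Φ-monic n (ℕ.<⇒≤ 2≤n))))
    where
    lead : ∀ m f → homogenize m f 1# 0# ≈ f S[X].! m
    lead m       []      = refl
    lead zero    (u ∷ f) = refl
    lead (suc m) (u ∷ f) = trans (+-cong (trans (*-congˡ (zeroˡ _)) (zeroʳ u)) (trans (*-identityˡ _) (lead m f)))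
      (+-identityˡ _)

  Φʰ-dilate : ∀ n → 1 ≤ n → ∀ t x y → Φʰ n (t * x) (t * y) ≈ t ^ φ n * Φʰ n x y
  Φʰ-dilate n 1≤n t x y = S[X].homogenize-dilate (φ n) (Φ n) t x y (proj₂ (Φ-monic n 1≤n))

  Φʰ-cong : ∀ n {x x′ y y′} → x ≈ x′ → y ≈ y′ → Φʰ n x y ≈ Φʰ n x′ y′
  Φʰ-cong n = S[X].homogenize-cong (φ n) (Φ n) (Φ n) (λ _ → refl)

  Φ-∣ : ∀ n → 1 ≤ n → ∀ x → ∃[ s ] eval (Φ n) x * s ≈ x ^ n + - 1#
  Φ-∣ n 1≤n x = evalℤ x s , trans (sym (E.*-homo x (C.Φ n) s))
    (trans (E.⟦⟧-cong x {C.Φ n C.*ₚ s} {C.Xⁿ-1 n} eq) (evalℤ-Xⁿ-1 n))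
    where
    s : List ℤ
    s = proj₁ (C.cyclotomic-∣ n 1≤n (C.isCyclotomic n 1≤n))
    eq : C.Φ n C.*ₚ s C.≈ₚ C.Xⁿ-1 n
    eq = proj₂ (C.cyclotomic-∣ n 1≤n (C.isCyclotomic n 1≤n))
    evalℤ-Xⁿ-1 : ∀ n → evalℤ x (C.Xⁿ-1 n) ≈ x ^ n + - 1#
    evalℤ-Xⁿ-1 n = trans (E.+-homo x (Exp._^_ C.P.commutativeSemiring C.X n) (C.-ₚ C.P.1#))
      (+-cong (trans (E.^-homo x C.X n) (^-congˡ n (evalℤ-X x)))
        (trans (E.-‿homo x C.P.1#) (-‿cong (E.1#-homo x))))

  Φ-geometric : ∀ n g k → 1 ≤ g → g < n → n ≡ k ℕ.* g → ∀ x →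
    ∃[ s ] eval (Φ n) x * s ≈ Powers-S.geometric (x ^ g) k
  Φ-geometric n g k 1≤g g<n n≡kg x = evalℤ x r , trans (sym (E.*-homo x (C.Φ n) r))
    (trans (E.⟦⟧-cong x {C.Φ n C.*ₚ r} {C.geometric Xᵍ k} (proj₂ geo))
    (trans (evalℤ-geometric Xᵍ k) (Powers-S.geometric-cong k (trans (E.^-homo x C.X g) (^-congˡ g (evalℤ-X x))))))
    where
    Xᵍ : List ℤ
    Xᵍ = Exp._^_ C.P.commutativeSemiring C.X g
    geo : ∃[ r ] C.Φ n C.*ₚ r C.≈ₚ C.geometric Xᵍ k
    geo = C.cyclotomic-geometric n g k 1≤g g<n n≡kg
      (C.isCyclotomic n (ℕ.≤-trans 1≤g (ℕ.<⇒≤ g<n))) (C.isCyclotomic g 1≤g)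
    r : List ℤ
    r = proj₁ geo
    evalℤ-geometric : ∀ f k → evalℤ x (C.geometric f k) ≈ Powers-S.geometric (evalℤ x f) k
    evalℤ-geometric f zero    = E.0#-homo x
    evalℤ-geometric f (suc k) = trans (E.+-homo x C.P.1# (f C.*ₚ C.geometric f k))
      (+-cong (E.1#-homo x) (trans (E.*-homo x f (C.geometric f k)) (*-congˡ (evalℤ-geometric f k))))

  -- `(X^(2g) - 1) / (X^g - 1) = 1 + X^g` is a multiple of `Φ (2g)`. Homogenising the cofactor in
  -- the complementary degree `g - φ (2g)` yields a factorisation of `x^g + y^g`.
  Φʰ-half : ∀ g → 1 ≤ g → ∀ x y → ∃[ w ] Φʰ (2 ℕ.* g) x y * w ≈ x ^ g + y ^ g
  Φʰ-half g 1≤g x y = homogenize (g ∸ φ n) r′ x y , trans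
    (sym (S[X].homogenize-* (φ n) (g ∸ φ n) (Φ n) r′ x y (proj₂ (Φ-monic n 1≤n))
      (MapHom.map-DegreeAtMost ℤ.+-*-commutativeRing S ℤ-isHom r (proj₂ (proj₂ r-monic)))))
    (trans (reflexive (≡.cong (λ k → homogenize k (Φ n S[X].*ₚ r′) x y) (ℕ.m+[n∸m]≡n (proj₁ r-monic))))
    (trans (S[X].homogenize-cong g (Φ n S[X].*ₚ r′) (1ₚ S[X].+ₚ Xᵍ) Φr≈ refl refl)
    (trans (S[X].homogenize-+ g 1ₚ Xᵍ x y)
    (trans (+-cong (trans (Reciprocal.homogenize-Xⁿ S 0 g x y) (*-identityˡ _))
      (trans (reflexive (≡.cong (λ k → homogenize k Xᵍ x y) (≡.sym (ℕ.+-identityʳ g))))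
        (trans (Reciprocal.homogenize-Xⁿ S g 0 x y) (*-identityʳ _))))
      (+-comm _ _)))))
    where
    n : ℕ
    n = 2 ℕ.* g
    1≤n : 1 ≤ n
    1≤n = ℕ.≤-trans 1≤g (ℕ.m≤m+n g (g ℕ.+ 0))
    g<n : g < n
    g<n = ℕ.m<m+n g (ℕ.≤-trans 1≤g (ℕ.m≤m+n g 0))
    Xᵍℤ : List ℤ
    Xᵍℤ = Exp._^_ C.P.commutativeSemiring C.X g
    1ₚ Xᵍ : List Carrier
    1ₚ = CommutativeRing.1# S[X].polynomialRing
    Xᵍ = Exp._^_ (CommutativeRing.commutativeSemiring S[X].polynomialRing) S[X].X g
    geo : ∃[ r ] C.Φ n C.*ₚ r C.≈ₚ C.geometric Xᵍℤ 2
    geo = C.cyclotomic-geometric n g 2 1≤g g<n ≡.refl (C.isCyclotomic n 1≤n) (C.isCyclotomic g 1≤g)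
    r : List ℤ
    r = proj₁ geo
    r′ : List Carrier
    r′ = map (fromℤ rawRing) r
    two-terms : C.geometric Xᵍℤ 2 C.≈ₚ C.P.1# C.+ₚ Xᵍℤ
    two-terms = Rearrangement.two-terms C.polynomialRing Xᵍℤ
    Xᵍ-monic : C.IsMonicOfDegree Xᵍℤ g
    Xᵍ-monic = X^-monic g
      where
      X^-monic : ∀ k → C.IsMonicOfDegree (Exp._^_ C.P.commutativeSemiring C.X k) k
      X^-monic zero    = C.isMonic-1
      X^-monic (suc k) = C.isMonic-* C.X (Exp._^_ C.P.commutativeSemiring C.X k) {1} {k}
        (≡.refl , λ { (suc (suc m)) _ → ≡.refl ; (suc zero) (s≤s ()) }) (X^-monic k)
    r-monic : φ n ≤ g × C.IsMonicOfDegree r (g ∸ φ n)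
    r-monic = C.isMonic-cofactor (λ ()) (C.Φ n) r
      (C.isMonicList⇒isMonic (C.Φ n) (C.IsCyclotomic.monic (C.isCyclotomic n 1≤n)))
      (C.isMonic-resp (C.P.1# C.+ₚ Xᵍℤ) (C.Φ n C.*ₚ r)
        (λ i → ≡.trans (≡.sym (two-terms i)) (≡.sym (proj₂ geo i)))
        (C.isMonic-+ C.P.1# Xᵍℤ 1≤g (proj₂ C.isMonic-1) Xᵍ-monic))
    map-X : map (fromℤ rawRing) C.X S[X].≈ₚ S[X].X
    map-X zero          = refl
    map-X (suc zero)    = +-identityʳ 1#
    map-X (suc (suc i)) = refl
    Φr≈ : Φ n S[X].*ₚ r′ S[X].≈ₚ 1ₚ S[X].+ₚ Xᵍ
    Φr≈ i = trans (sym (M.*-homo (C.Φ n) r i))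
      (trans (M.⟦⟧-cong {C.Φ n C.*ₚ r} {C.P.1# C.+ₚ Xᵍℤ} (λ j → ≡.trans (proj₂ geo j) (two-terms j)) i)
      (trans (M.+-homo C.P.1# Xᵍℤ i)
      (CommutativeRing.+-cong S[X].polynomialRing
        {map (fromℤ rawRing) C.P.1#} {1ₚ} {map (fromℤ rawRing) Xᵍℤ} {Xᵍ} M.1#-homo
        (λ j → trans (M.^-homo C.X g j)
          (Exp.^-congˡ (CommutativeRing.commutativeSemiring S[X].polynomialRing) g
            {map (fromℤ rawRing) C.X} {S[X].X} map-X j)) i)))

  module _ (domain : ∀ x y → x * y ≈ 0# → x ≈ 0# ⊎ y ≈ 0#) (1≉0 : 1# ≉ 0#) where

    private
      divisorProduct-root : ∀ x n m → evalℤ x (C.divisorProduct n m) ≈ 0# →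
        ∃[ d ] 1 ≤ d × d ≤ m × d ∣ n × eval (Φ d) x ≈ 0#
      divisorProduct-root x n zero    root = contradiction
        (trans (sym (trans (reflexive (≡.cong (evalℤ x) (C.divisorProduct-0 n))) (E.1#-homo x))) root) 1≉0
      divisorProduct-root x n (suc m) root = step (suc m ∣? n)
        where
        later : evalℤ x (C.divisorProduct n m) ≈ 0# → ∃[ d ] 1 ≤ d × d ≤ suc m × d ∣ n × eval (Φ d) x ≈ 0#
        later root′ with divisorProduct-root x n m root′
        ... | d , 1≤d , d≤m , rest = d , 1≤d , ℕ.m≤n⇒m≤1+n d≤m , rest
        step : Dec (suc m ∣ n) → ∃[ d ] 1 ≤ d × d ≤ suc m × d ∣ n × eval (Φ d) x ≈ 0#
        step (no m∤n)  = later (trans (reflexive (≡.cong (evalℤ x) (≡.sym (C.divisorProduct-∤ m m∤n)))) root)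
        step (yes m∣n) = split (domain _ _ (trans (sym (E.*-homo x (C.Φ (suc m)) (C.divisorProduct n m)))
          (trans (reflexive (≡.cong (evalℤ x) (≡.sym (C.divisorProduct-∣ m m∣n)))) root)))
          where
          split : evalℤ x (C.Φ (suc m)) ≈ 0# ⊎ evalℤ x (C.divisorProduct n m) ≈ 0# → _
          split (inj₁ here)  = suc m , s≤s z≤n , ℕ.≤-refl , m∣n , here
          split (inj₂ there) = later there

    -- The product of the `Φ d` over the divisors of `n` vanishes at `x`, so in a domain some `Φ d`
    -- does. Then `x^d = 1`, which excludes `d < n`.
    Φ-root : ∀ n → 1 ≤ n → ∀ x → x ^ n ≈ 1# → (∀ d → 1 ≤ d → d < n → x ^ d ≉ 1#) → eval (Φ n) x ≈ 0#
    Φ-root n 1≤n x xⁿ≈1 order = conclude (divisorProduct-root x n n (trans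
      (E.⟦⟧-cong x {C.divisorProduct n n} {C.Xⁿ-1 n} (C.IsCyclotomic.product (C.isCyclotomic n 1≤n)))
      (trans (E.+-homo x (Exp._^_ C.P.commutativeSemiring C.X n) (C.-ₚ C.P.1#))
        (trans (+-cong (trans (E.^-homo x C.X n) (trans (^-congˡ n (evalℤ-X x)) xⁿ≈1))
          (trans (E.-‿homo x C.P.1#) (-‿cong (E.1#-homo x)))) (-‿inverseʳ 1#)))))
      where
      conclude : ∃[ d ] 1 ≤ d × d ≤ n × d ∣ n × eval (Φ d) x ≈ 0# → eval (Φ n) x ≈ 0#
      conclude (d , 1≤d , d≤n , _ , root) with ℕ.m≤n⇒m<n∨m≡n d≤n
      ... | inj₂ ≡.refl = root
      ... | inj₁ d<n    = contradiction
        (x∙y⁻¹≈ε⇒x≈y (x ^ d) 1# (trans (sym (proj₂ (Φ-∣ d 1≤d x))) (trans (*-congʳ root) (zeroˡ _))))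
        (order d 1≤d d<n)
        where open AbelianGroupProperties +-abelianGroup using (x∙y⁻¹≈ε⇒x≈y)

-- Adjoining a root of a quadratic polynomial

module QuadraticExtension {a ℓ} (R : CommutativeRing a ℓ) (b c : CommutativeRing.Carrier R) where

  open CommutativeRing R
  open AdjoinQuadraticRoot rawRing b c public
  open Integers R using (module RingSolver)
  open RingSolver using (solve; _:=_; _:+_; _:*_; :-_; con)

  private module Raw = RawRing extension

  -- Opaque, so that comparing two extensions never unfolds these proofs.
  opaque

    extension-isCommutativeRing : IsCommutativeRing Raw._≈_ Raw._+_ Raw._*_ Raw.-_ Raw.0# Raw.1#
    extension-isCommutativeRing = record
      { isRing = record
        { +-isAbelianGroup = record
          { isGroup = record
            { isMonoid = record
              { isSemigroup = record
                { isMagma = record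
                  { isEquivalence = record
                    { refl  = refl , refl
                    ; sym   = λ (p , q) → sym p , sym q
                    ; trans = λ (p , q) (p′ , q′) → trans p p′ , trans q q′
                    }
                  ; ∙-cong = λ (p , q) (p′ , q′) → +-cong p p′ , +-cong q q′
                  }
                ; assoc = λ _ _ _ → +-assoc _ _ _ , +-assoc _ _ _
                }
              ; identity = (λ _ → +-identityˡ _ , +-identityˡ _) , (λ _ → +-identityʳ _ , +-identityʳ _)
              }
            ; inverse = (λ _ → -‿inverseˡ _ , -‿inverseˡ _) , (λ _ → -‿inverseʳ _ , -‿inverseʳ _)
            ; ⁻¹-cong = λ (p , q) → -‿cong p , -‿cong q
            }
          ; comm = λ _ _ → +-comm _ _ , +-comm _ _
          }
        ; *-cong = λ (p , q) (p′ , q′) →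
            +-cong (*-cong p p′) (-‿cong (*-congˡ (*-cong q q′))) ,
            +-cong (+-cong (*-cong p q′) (*-cong q p′)) (-‿cong (*-congˡ (*-cong q q′)))
        ; *-assoc = λ (u , v) (u′ , v′) (u″ , v″) →
            solve 8 (λ b c u v u′ v′ u″ v″ →
              let u₁ = u :* u′ :+ :- (c :* (v :* v′)) ; v₁ = u :* v′ :+ v :* u′ :+ :- (b :* (v :* v′))
                  u₂ = u′ :* u″ :+ :- (c :* (v′ :* v″)) ; v₂ = u′ :* v″ :+ v′ :* u″ :+ :- (b :* (v′ :* v″))
              in u₁ :* u″ :+ :- (c :* (v₁ :* v″)) := u :* u₂ :+ :- (c :* (v :* v₂))) refl b c u v u′ v′ u″ v″ ,
            solve 8 (λ b c u v u′ v′ u″ v″ →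
              let u₁ = u :* u′ :+ :- (c :* (v :* v′)) ; v₁ = u :* v′ :+ v :* u′ :+ :- (b :* (v :* v′))
                  u₂ = u′ :* u″ :+ :- (c :* (v′ :* v″)) ; v₂ = u′ :* v″ :+ v′ :* u″ :+ :- (b :* (v′ :* v″))
              in u₁ :* v″ :+ v₁ :* u″ :+ :- (b :* (v₁ :* v″)) := u :* v₂ :+ v :* u₂ :+ :- (b :* (v :* v₂)))
              refl b c u v u′ v′ u″ v″
        ; *-identity =
            (λ (u , v) →
              solve 3 (λ c u v → con (+ 1) :* u :+ :- (c :* (con (+ 0) :* v)) := u) refl c u v ,
              solve 3 (λ b u v → con (+ 1) :* v :+ con (+ 0) :* u :+ :- (b :* (con (+ 0) :* v)) := v) refl b u v) ,
            (λ (u , v) →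
              solve 3 (λ c u v → u :* con (+ 1) :+ :- (c :* (v :* con (+ 0))) := u) refl c u v ,
              solve 3 (λ b u v → u :* con (+ 0) :+ v :* con (+ 1) :+ :- (b :* (v :* con (+ 0))) := v) refl b u v)
        ; distrib =
            (λ (u , v) (u′ , v′) (u″ , v″) →
              solve 7 (λ c u v u′ v′ u″ v″ → u :* (u′ :+ u″) :+ :- (c :* (v :* (v′ :+ v″))) :=
                (u :* u′ :+ :- (c :* (v :* v′))) :+ (u :* u″ :+ :- (c :* (v :* v″)))) refl c u v u′ v′ u″ v″ ,
              solve 7 (λ b u v u′ v′ u″ v″ →
                u :* (v′ :+ v″) :+ v :* (u′ :+ u″) :+ :- (b :* (v :* (v′ :+ v″))) :=
                (u :* v′ :+ v :* u′ :+ :- (b :* (v :* v′))) :+ (u :* v″ :+ v :* u″ :+ :- (b :* (v :* v″))))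
                refl b u v u′ v′ u″ v″) ,
            (λ (u , v) (u′ , v′) (u″ , v″) →
              solve 7 (λ c u v u′ v′ u″ v″ → (u′ :+ u″) :* u :+ :- (c :* ((v′ :+ v″) :* v)) :=
                (u′ :* u :+ :- (c :* (v′ :* v))) :+ (u″ :* u :+ :- (c :* (v″ :* v)))) refl c u v u′ v′ u″ v″ ,
              solve 7 (λ b u v u′ v′ u″ v″ →
                (u′ :+ u″) :* v :+ (v′ :+ v″) :* u :+ :- (b :* ((v′ :+ v″) :* v)) :=
                (u′ :* v :+ v′ :* u :+ :- (b :* (v′ :* v))) :+ (u″ :* v :+ v″ :* u :+ :- (b :* (v″ :* v))))
                refl b u v u′ v′ u″ v″)
        }
      ; *-comm = λ (u , v) (u′ , v′) →
          solve 5 (λ c u v u′ v′ → u :* u′ :+ :- (c :* (v :* v′)) := u′ :* u :+ :- (c :* (v′ :* v))) refl c u v u′ v′ ,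
          solve 5 (λ b u v u′ v′ → u :* v′ :+ v :* u′ :+ :- (b :* (v :* v′)) :=
            u′ :* v :+ v′ :* u :+ :- (b :* (v′ :* v))) refl b u v u′ v′
      }

  quadraticExtension : CommutativeRing a ℓ
  quadraticExtension = record
    { Carrier           = Raw.Carrier
    ; _≈_               = Raw._≈_
    ; _+_               = Raw._+_
    ; _*_               = Raw._*_
    ; -_                = Raw.-_
    ; 0#                = Raw.0#
    ; 1#                = Raw.1#
    ; isCommutativeRing = extension-isCommutativeRing
    }

  private module E = CommutativeRing quadraticExtension

  ι-isHom : IsHom R quadraticExtension ι
  ι-isHom = isHom R quadraticExtension (λ x≈y → x≈y , refl)
    (λ x y → refl , sym (+-identityˡ 0#))
    (λ x y → solve 3 (λ c x y → x :* y := x :* y :+ :- (c :* (con (+ 0) :* con (+ 0)))) refl c x y ,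
      solve 3 (λ b x y → con (+ 0) := x :* con (+ 0) :+ con (+ 0) :* y :+ :- (b :* (con (+ 0) :* con (+ 0)))) refl b x y)
    (refl , refl)

  root₁-root : root₁ E.* root₁ E.+ ι b E.* root₁ E.+ ι c E.≈ E.0#
  root₁-root =
    solve 2 (λ b c → con (+ 0) :* con (+ 0) :+ :- (c :* (con (+ 1) :* con (+ 1)))
      :+ (b :* con (+ 0) :+ :- (c :* (con (+ 0) :* con (+ 1)))) :+ c := con (+ 0)) refl b c ,
    solve 1 (λ b → con (+ 0) :* con (+ 1) :+ con (+ 1) :* con (+ 0) :+ :- (b :* (con (+ 1) :* con (+ 1)))
      :+ (b :* con (+ 1) :+ con (+ 0) :* con (+ 0) :+ :- (b :* (con (+ 0) :* con (+ 1)))) :+ con (+ 0) := con (+ 0)) refl b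

  root₂≈ : root₂ E.≈ E.- ι b E.+ E.- root₁
  root₂≈ = solve 1 (λ b → :- b := :- b :+ :- con (+ 0)) refl b ,
    solve 1 (λ b → :- con (+ 1) := :- con (+ 0) :+ :- con (+ 1)) refl b

  module _ {e m} (S : CommutativeRing e m) where

    private module S = CommutativeRing S

    -- The universal property: `θ` extends by sending the class of `T` to a root `t`. The exchange
    -- of `α` and `β`, the specialisation `C = c` and the evaluation at an actual root are all
    -- obtained in this way.
    adjoin : (Carrier → S.Carrier) → S.Carrier → E.Carrier → S.Carrier
    adjoin θ t (u , v) = θ u S.+ θ v S.* t

    adjoin-isHom : ∀ {θ} → IsHom R S θ → ∀ t → t S.* t S.+ θ b S.* t S.+ θ c S.≈ S.0# →
      IsHom quadraticExtension S (adjoin θ t)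
    adjoin-isHom {θ} h t root = isHom quadraticExtension S
      (λ (p , q) → S.+-cong (⟦⟧-cong p) (S.*-congʳ (⟦⟧-cong q)))
      (λ (u , v) (u′ , v′) → S.trans (S.+-cong (+-homo u u′) (S.*-congʳ (+-homo v v′)))
        (sum-rule (θ u) (θ v) (θ u′) (θ v′)))
      (λ (u , v) (u′ , v′) → S.trans
        (S.+-cong
          (S.trans (+-homo _ _) (S.+-cong (*-homo u u′) (S.trans (-‿homo _) (S.-‿cong (S.trans (*-homo c _) (S.*-congˡ (*-homo v v′)))))))
          (S.*-congʳ (S.trans (+-homo _ _) (S.+-cong (S.trans (+-homo _ _) (S.+-cong (*-homo u v′) (*-homo v u′)))
            (S.trans (-‿homo _) (S.-‿cong (S.trans (*-homo b _) (S.*-congˡ (*-homo v v′)))))))))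
        (product-rule (θ u) (θ v) (θ u′) (θ v′)))
      (S.trans (S.+-cong 1#-homo (S.trans (S.*-congʳ 0#-homo) (S.zeroˡ t))) (S.+-identityʳ _))
      where
      open IsHom R S h
      module RS = Integers.RingSolver S
      sum-rule : ∀ u v u′ v′ → (u S.+ u′) S.+ (v S.+ v′) S.* t S.≈ (u S.+ v S.* t) S.+ (u′ S.+ v′ S.* t)
      sum-rule u v u′ v′ = RS.solve 5 (λ u v u′ v′ t → ((u RS.:+ u′) RS.:+ (v RS.:+ v′) RS.:* t) RS.:=
        ((u RS.:+ v RS.:* t) RS.:+ (u′ RS.:+ v′ RS.:* t))) S.refl u v u′ v′ t
      product-rule : ∀ u v u′ v′ →
        (u S.* u′ S.+ S.- (θ c S.* (v S.* v′))) S.+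
          (u S.* v′ S.+ v S.* u′ S.+ S.- (θ b S.* (v S.* v′))) S.* t S.≈
        (u S.+ v S.* t) S.* (u′ S.+ v′ S.* t)
      product-rule u v u′ v′ = begin
        (u S.* u′ S.+ S.- (θ c S.* (v S.* v′))) S.+
          (u S.* v′ S.+ v S.* u′ S.+ S.- (θ b S.* (v S.* v′))) S.* t
          -- The two sides differ by `v v′` times the value of the quadratic at `t`, which is zero.
          ≈⟨ RS.solve 7 (λ b c t u v u′ v′ →
               ((u RS.:* u′ RS.:+ RS.:- (c RS.:* (v RS.:* v′))) RS.:+
                (u RS.:* v′ RS.:+ v RS.:* u′ RS.:+ RS.:- (b RS.:* (v RS.:* v′))) RS.:* t) RS.:=
               ((u RS.:+ v RS.:* t) RS.:* (u′ RS.:+ v′ RS.:* t) RS.:+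
                RS.:- (v RS.:* v′ RS.:* (t RS.:* t RS.:+ b RS.:* t RS.:+ c))))
               S.refl (θ b) (θ c) t u v u′ v′ ⟩
        (u S.+ v S.* t) S.* (u′ S.+ v′ S.* t) S.+ S.- (v S.* v′ S.* (t S.* t S.+ θ b S.* t S.+ θ c))
          ≈⟨ S.+-congˡ (S.-‿cong (S.trans (S.*-congˡ root) (S.zeroʳ _))) ⟩
        (u S.+ v S.* t) S.* (u′ S.+ v′ S.* t) S.+ S.- S.0#
          ≈⟨ S.trans (S.+-congˡ (AbelianGroupProperties.ε⁻¹≈ε S.+-abelianGroup)) (S.+-identityʳ _) ⟩
        (u S.+ v S.* t) S.* (u′ S.+ v′ S.* t)
          ∎
        where open SetoidReasoning S.setoid

    module _ {θ} (h : IsHom R S θ) (t : S.Carrier) where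

      open IsHom R S h

      adjoin-ι : ∀ u → adjoin θ t (ι u) S.≈ θ u
      adjoin-ι u = S.trans (S.+-congˡ (S.trans (S.*-congʳ 0#-homo) (S.zeroˡ t))) (S.+-identityʳ _)

      adjoin-root₁ : adjoin θ t root₁ S.≈ t
      adjoin-root₁ = S.trans (S.+-cong 0#-homo (S.trans (S.*-congʳ 1#-homo) (S.*-identityˡ t))) (S.+-identityˡ t)

      adjoin-root₂ : adjoin θ t root₂ S.≈ S.- θ b S.+ S.- t
      adjoin-root₂ = S.+-cong (-‿homo b) (S.trans (S.*-congʳ (S.trans (-‿homo 1#) (S.-‿cong 1#-homo)))
        (RingProperties.-1*x≈-x S.ring t))

-- Polynomials over a field with decidable equality

record IsDiscreteField {a ℓ} (R : CommutativeRing a ℓ) : Set (a ⊔ ℓ) where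

  open CommutativeRing R

  field
    1≉0     : 1# ≉ 0#
    inverse : ∀ x → x ≉ 0# → ∃[ y ] y * x ≈ 1#
    _≟_     : Decidable _≈_

  domain : ∀ x y → x * y ≈ 0# → x ≈ 0# ⊎ y ≈ 0#
  domain x y xy≈0 with x ≟ 0#
  ... | yes x≈0 = inj₁ x≈0
  ... | no  x≉0 = inj₂ (begin
    y                ≈⟨ *-identityˡ y ⟨
    1# * y           ≈⟨ *-congʳ (proj₂ (inverse x x≉0)) ⟨
    x⁻¹ * x * y      ≈⟨ *-assoc _ _ _ ⟩
    x⁻¹ * (x * y)    ≈⟨ *-congˡ xy≈0 ⟩
    x⁻¹ * 0#         ≈⟨ zeroʳ _ ⟩
    0#               ∎)
    where
    open SetoidReasoning setoid
    x⁻¹ : Carrier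
    x⁻¹ = proj₁ (inverse x x≉0)

module Field {a ℓ} (R : CommutativeRing a ℓ) (isField : IsDiscreteField R) where

  open CommutativeRing R
  open IsDiscreteField isField
  open Evaluation R
  open Division R
  private module P = CommutativeRing polynomialRing
  open Integers R using (module RingSolver)
  open RingSolver using (solve; _:=_; _:+_; _:*_; :-_; con)
  open AbelianGroupProperties +-abelianGroup using (x∙y⁻¹≈ε⇒x≈y; inverseˡ-unique)
  open Exp commutativeSemiring using (_^_)
  open UniqueSetoid setoid using (Unique)
  open SetoidReasoning setoid

  ≉0-* : ∀ {x y} → x ≉ 0# → y ≉ 0# → x * y ≉ 0#
  ≉0-* {x} {y} x≉0 y≉0 xy≈0 with domain x y xy≈0
  ... | inj₁ x≈0 = x≉0 x≈0
  ... | inj₂ y≈0 = y≉0 y≈0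

  ≉0-^ : ∀ {x} n → x ≉ 0# → x ^ n ≉ 0#
  ≉0-^ zero    x≉0 = 1≉0
  ≉0-^ (suc n) x≉0 = ≉0-* x≉0 (≉0-^ n x≉0)

  *-cancelˡ : ∀ x {y z} → x ≉ 0# → x * y ≈ x * z → y ≈ z
  *-cancelˡ x {y} {z} x≉0 xy≈xz =
    Sum.[ (λ x≈0 → contradiction x≈0 x≉0) , x∙y⁻¹≈ε⇒x≈y y z ]′ (domain x (y + - z) (begin
      x * (y + - z)        ≈⟨ solve 3 (λ x y z → x :* (y :+ :- z) := x :* y :+ :- (x :* z)) refl x y z ⟩
      x * y + - (x * z)    ≈⟨ +-congʳ xy≈xz ⟩
      x * z + - (x * z)    ≈⟨ -‿inverseʳ _ ⟩
      0#                   ∎))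

  x²≈1 : ∀ x → x * x ≈ 1# → x ≈ 1# ⊎ x ≈ - 1#
  x²≈1 x xx≈1 = Sum.map (x∙y⁻¹≈ε⇒x≈y x 1#) (inverseˡ-unique x 1#) (domain (x + - 1#) (x + 1#) (begin
    (x + - 1#) * (x + 1#)   ≈⟨ solve 1 (λ x → (x :+ :- con (+ 1)) :* (x :+ con (+ 1)) := x :* x :+ :- con (+ 1)) refl x ⟩
    x * x + - 1#            ≈⟨ +-congʳ xx≈1 ⟩
    1# + - 1#               ≈⟨ -‿inverseʳ 1# ⟩
    0#                      ∎))

  linear : Carrier → List Carrier
  linear x = X +ₚ const (- x)

  linear-monicList : ∀ x → IsMonicList (linear x) 1
  linear-monicList x = ≡.refl , refl

  linear-monic : ∀ x → IsMonicOfDegree (linear x) 1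
  linear-monic x = isMonicList⇒isMonic (linear x) (linear-monicList x)

  eval-linear : ∀ x y → eval (linear x) y ≈ y + - x
  eval-linear x y = solve 2 (λ x y → con (+ 0) :+ :- x :+ y :* (con (+ 1) :+ y :* con (+ 0)) := y :+ :- x) refl x y

  linear-root : ∀ x → eval (linear x) x ≈ 0#
  linear-root x = trans (eval-linear x x) (-‿inverseʳ x)

  linear-nonroot : ∀ {x y} → x ≉ y → eval (linear x) y ≉ 0#
  linear-nonroot {x} {y} x≉y root = x≉y (sym (x∙y⁻¹≈ε⇒x≈y y x (trans (sym (eval-linear x y)) root)))

  factor : ∀ f x → IsRoot f x → ∃[ g ] f ≈ₚ linear x *ₚ g
  factor f x root = Q , λ i → begin
    f ! i                                 ≈⟨ division l l-monic f i ⟩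
    (Q *ₚ l +ₚ r) ! i                     ≈⟨ !-+ (Q *ₚ l) r i ⟩
    (Q *ₚ l) ! i + r ! i                  ≈⟨ +-cong (P.*-comm Q l i) (r≈0 i) ⟩
    (l *ₚ Q) ! i + 0#                     ≈⟨ +-identityʳ _ ⟩
    (l *ₚ Q) ! i                          ∎
    where
    l Q r : List Carrier
    l = linear x
    l-monic : IsMonicList l 1
    l-monic = linear-monicList x
    Q = quotient l l-monic f
    r = remainder l l-monic f
    r-const : r ≈ₚ const (r ! 0)
    r-const zero    = refl
    r-const (suc i) = remainder-small l l-monic f (suc i) (s≤s z≤n)
    r0≈0 : r ! 0 ≈ 0#
    r0≈0 = begin
      r ! 0                              ≈⟨ eval-const (r ! 0) x ⟨
      eval (const (r ! 0)) x             ≈⟨ eval-cong r (const (r ! 0)) r-const refl ⟨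
      eval r x                           ≈⟨ +-identityˡ _ ⟨
      0# + eval r x                      ≈⟨ +-congʳ (trans (*-congˡ (linear-root x)) (zeroʳ _)) ⟨
      eval Q x * eval l x + eval r x     ≈⟨ +-congʳ (eval-* Q l x) ⟨
      eval (Q *ₚ l) x + eval r x         ≈⟨ eval-+ (Q *ₚ l) r x ⟨
      eval (Q *ₚ l +ₚ r) x               ≈⟨ eval-cong f (Q *ₚ l +ₚ r) (division l l-monic f) refl ⟨
      eval f x                           ≈⟨ root ⟩
      0#                                 ∎
    r≈0 : ∀ i → r ! i ≈ 0#
    r≈0 zero    = r0≈0
    r≈0 (suc i) = r-const (suc i)

  factor-root : ∀ f g x {y} → f ≈ₚ linear x *ₚ g → x ≉ y → IsRoot f y → IsRoot g y
  factor-root f g x {y} f≈ x≉y root = Sum.[ (λ r → contradiction r (linear-nonroot x≉y)) , (λ r → r) ]′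
    (domain (eval (linear x) y) (eval g y)
      (trans (sym (eval-* (linear x) g y)) (trans (sym (eval-cong f (linear x *ₚ g) f≈ refl)) root)))

  fromRoots-monic : ∀ xs → IsMonicOfDegree (fromRoots xs) (length xs)
  fromRoots-monic []       = isMonic-1
  fromRoots-monic (x ∷ xs) = isMonic-* (linear x) (fromRoots xs) (linear-monic x) (fromRoots-monic xs)

  fromRoots-factor : ∀ f xs → Unique xs → All (IsRoot f) xs → ∃[ g ] f ≈ₚ fromRoots xs *ₚ g
  fromRoots-factor f []       _                 _              = f , λ i → sym (P.*-identityˡ f i)
  fromRoots-factor f (x ∷ xs) (x∉xs ∷ xs-unique) (root ∷ roots) =
    proj₁ rest , λ i → trans (proj₂ split i)
      (*-factorˡ (linear x) (proj₁ split) (fromRoots xs) (proj₁ rest) (proj₂ rest) i)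
    where
    open Rearrangement polynomialRing
    split : ∃[ g ] f ≈ₚ linear x *ₚ g
    split = factor f x root
    roots′ : ∀ {ys} → All (x ≉_) ys → All (IsRoot f) ys → All (IsRoot (proj₁ split)) ys
    roots′ []           []       = []
    roots′ (x≉y ∷ x∉ys) (r ∷ rs) = factor-root f (proj₁ split) x (proj₂ split) x≉y r ∷ roots′ x∉ys rs
    rest : ∃[ g ] proj₁ split ≈ₚ fromRoots xs *ₚ g
    rest = fromRoots-factor (proj₁ split) xs xs-unique (roots′ x∉xs roots)

  length-roots : ∀ f {n} → IsMonicOfDegree f n → ∀ xs → Unique xs → All (IsRoot f) xs → length xs ≤ n
  length-roots f f-monic xs unique roots = proj₁ (isMonic-cofactor 1≉0 (fromRoots xs) (proj₁ split)
    (fromRoots-monic xs) (isMonic-resp f (fromRoots xs *ₚ proj₁ split) (proj₂ split) f-monic))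
    where
    split : ∃[ g ] f ≈ₚ fromRoots xs *ₚ g
    split = fromRoots-factor f xs unique roots

  -- The cofactor of `fromRoots xs` in `f` is monic of degree 0, hence 1.
  fromRoots-complete : ∀ f {n} → IsMonicOfDegree f n → ∀ xs → length xs ≡ n → Unique xs →
    All (IsRoot f) xs → f ≈ₚ fromRoots xs
  fromRoots-complete f f-monic xs ≡.refl unique roots i = begin
    f ! i                           ≈⟨ proj₂ split i ⟩
    (fromRoots xs *ₚ g) ! i         ≈⟨ P.*-cong {fromRoots xs} {fromRoots xs} {g} {P.1#} (λ _ → refl) g≈1 i ⟩
    (fromRoots xs *ₚ P.1#) ! i      ≈⟨ P.*-identityʳ (fromRoots xs) i ⟩
    fromRoots xs ! i                ∎
    where
    split : ∃[ g ] f ≈ₚ fromRoots xs *ₚ g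
    split = fromRoots-factor f xs unique roots
    g : List Carrier
    g = proj₁ split
    g-monic : IsMonicOfDegree g 0
    g-monic = ≡.subst (IsMonicOfDegree g) (ℕ.n∸n≡0 (length xs))
      (proj₂ (isMonic-cofactor 1≉0 (fromRoots xs) g (fromRoots-monic xs)
        (isMonic-resp f (fromRoots xs *ₚ g) (proj₂ split) f-monic)))
    g≈1 : g ≈ₚ P.1#
    g≈1 zero    = proj₁ g-monic
    g≈1 (suc i) = proj₂ g-monic (suc i) (s≤s z≤n)

  root? : ∀ f x → Dec (IsRoot f x)
  root? f x = eval f x ≟ 0#

  private
    length-filter-complement : ∀ f xs →
      length (filter (root? f) xs) ℕ.+ length (filter (λ x → ¬? (root? f x)) xs) ≡ length xs
    length-filter-complement f []       = ≡.refl
    length-filter-complement f (x ∷ xs) with root? f x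
    ... | yes _ = ≡.cong suc (length-filter-complement f xs)
    ... | no  _ = ≡.trans (ℕ.+-suc _ _) (≡.cong suc (length-filter-complement f xs))

  -- Neither factor can have more roots than its degree, so neither can
  -- have fewer.
  length-roots-of-factor : ∀ f g {m n} → IsMonicOfDegree f m → IsMonicOfDegree g n →
    ∀ xs → Unique xs → length xs ≡ m ℕ.+ n → All (IsRoot (f *ₚ g)) xs →
    length (filter (root? f) xs) ≡ m
  length-roots-of-factor f g {m} {n} f-monic g-monic xs unique len roots = ℕ.≤-antisym
    (length-roots f f-monic _ (UniqueProperties.filter⁺ setoid (root? f) unique) (AllProperties.all-filter (root? f) xs))
    (ℕ.+-cancelʳ-≤ n m _ (≡.subst (_≤ length (filter (root? f) xs) ℕ.+ n)
      (≡.trans (length-filter-complement f xs) len)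
      (ℕ.+-monoʳ-≤ (length (filter (root? f) xs))
        (length-roots g g-monic _ (UniqueProperties.filter⁺ setoid nonroot? unique)
          (All.map g-root (All.zip (AllProperties.filter⁺ nonroot? roots , AllProperties.all-filter nonroot? xs)))))))
    where
    nonroot? : ∀ x → Dec (¬ IsRoot f x)
    nonroot? x = ¬? (root? f x)
    g-root : ∀ {x} → IsRoot (f *ₚ g) x × ¬ IsRoot f x → IsRoot g x
    g-root {x} (fg , ¬f) = Sum.[ (λ r → contradiction r ¬f) , (λ r → r) ]′
      (domain (eval f x) (eval g x) (trans (sym (eval-* f g x)) fg))

  open RawMagmaDefs (RawRing.*-rawMagma P.rawRing) using (_,_) renaming (_∣_ to _∣ₚ_)

  fromRoots-nonroot : ∀ {x} xs → All (x ≉_) xs → eval (fromRoots xs) x ≉ 0#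
  fromRoots-nonroot {x} []       _            r = 1≉0 (trans (sym (eval-const 1# x)) r)
  fromRoots-nonroot {x} (y ∷ xs) (x≉y ∷ x∉xs) r =
    Sum.[ linear-nonroot (λ y≈x → x≉y (sym y≈x)) , fromRoots-nonroot xs x∉xs ]′
      (domain (eval (linear y) x) (eval (fromRoots xs) x) (trans (sym (eval-* (linear y) (fromRoots xs) x)) r))

  private
    -- Each `x` of the list is a root of `g` or of `k`, hence of `k`, and is split off from `k`. It
    -- is not a root of `g`, since it would then be a double root, so the hypothesis persists for
    -- the new cofactor. At the end of the list `1 = g k`.
    coprime-cofactor⇒unit : ∀ xs → Unique xs → ∀ g k → fromRoots xs ≈ₚ g *ₚ k →
      (∀ y → IsRoot g y → IsRoot k y) → g ∣ₚ P.1#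
    coprime-cofactor⇒unit []       _                  g k eq g⇒k = k , λ i → trans (P.*-comm k g i) (sym (eq i))
    coprime-cofactor⇒unit (x ∷ xs) (x∉xs ∷ unique) g k eq g⇒k =
      coprime-cofactor⇒unit xs unique g k′ eq′ g⇒k′
      where
      k-root : IsRoot k x
      k-root = Sum.[ g⇒k x , (λ r → r) ]′ (domain (eval g x) (eval k x) (trans (sym (eval-* g k x))
        (trans (sym (eval-cong (fromRoots (x ∷ xs)) (g *ₚ k) eq refl))
        (trans (eval-* (linear x) (fromRoots xs) x) (trans (*-congʳ (linear-root x)) (zeroˡ _))))))
      k′ : List Carrier
      k′ = proj₁ (factor k x k-root)
      k≈ : k ≈ₚ linear x *ₚ k′
      k≈ = proj₂ (factor k x k-root)
      eq′ : fromRoots xs ≈ₚ g *ₚ k′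
      eq′ = monic-cancel (linear x) (fromRoots xs) (g *ₚ k′) (linear-monic x)
        (λ i → trans (eq i) (Rearrangement.*-factorʳ polynomialRing g k (linear x) k′ k≈ i))
      g-nonroot : ¬ IsRoot g x
      g-nonroot r = fromRoots-nonroot xs x∉xs (trans (eval-cong (fromRoots xs) (g *ₚ k′) eq′ refl)
        (trans (eval-* g k′ x) (trans (*-congʳ r) (zeroˡ _))))
      g⇒k′ : ∀ y → IsRoot g y → IsRoot k′ y
      g⇒k′ y r = factor-root k k′ x k≈
        (λ x≈y → g-nonroot (trans (eval-cong g g (λ _ → refl) x≈y) r)) (g⇒k y r)

  -- The preceding lemma applies to `f = g (g h)`, as every root of `g` is a root of the cofactor
  -- `g h`.
  fromRoots-squareFree : ∀ f xs → f ≈ₚ fromRoots xs → Unique xs → IsSquareFree f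
  fromRoots-squareFree f xs f≈ unique g (h , eq) = coprime-cofactor⇒unit xs unique g (g *ₚ h)
    (λ i → trans (sym (f≈ i)) (trans (sym (eq i)) (trans (P.*-comm h (g *ₚ g) i) (P.*-assoc g g h i))))
    (λ y r → trans (eval-* g h y) (trans (*-congʳ r) (zeroˡ _)))

  private
    monic-nonunit : ∀ f {n} → IsMonicOfDegree f (suc n) → ¬ f ∣ₚ P.1#
    monic-nonunit f f-monic (q , qf≈1) = ℕ.1+n≰n (ℕ.≤-trans
      (proj₁ (isMonic-cofactor 1≉0 f q f-monic
        (isMonic-resp P.1# (f *ₚ q) (λ i → trans (sym (qf≈1 i)) (P.*-comm q f i)) isMonic-1))) z≤n)

    degree : ∀ f → f ≈ₚ [] ⊎ ∃[ d ] f ! d ≉ 0# × DegreeAtMost f d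
    degree []      = inj₁ (λ _ → refl)
    degree (u ∷ f) = extend (degree f)
      where
      extend : f ≈ₚ [] ⊎ (∃[ d ] f ! d ≉ 0# × DegreeAtMost f d) →
        (u ∷ f) ≈ₚ [] ⊎ ∃[ d ] (u ∷ f) ! d ≉ 0# × DegreeAtMost (u ∷ f) d
      extend (inj₂ (d , lead , above)) = inj₂ (suc d , lead , λ { (suc m) (s≤s d<m) → above m d<m })
      extend (inj₁ f≈0) with u ≟ 0#
      ... | yes u≈0 = inj₁ (λ { zero → u≈0 ; (suc i) → f≈0 i })
      ... | no  u≉0 = inj₂ (0 , u≉0 , λ { (suc m) _ → f≈0 m })

    constant-unit : ∀ f → f ! 0 ≉ 0# → DegreeAtMost f 0 → f ∣ₚ P.1#
    constant-unit f u≉0 above = const (proj₁ (inverse (f ! 0) u≉0)) , λ i → trans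
      (P.*-cong {const u⁻¹} {const u⁻¹} {f} {const (f ! 0)} (λ _ → refl) f-const i)
      (trans (sym (*-homo u⁻¹ (f ! 0) i)) (⟦⟧-cong (proj₂ (inverse (f ! 0) u≉0)) i))
      where
      open IsHom R polynomialRing const-isHom
      u⁻¹ : Carrier
      u⁻¹ = proj₁ (inverse (f ! 0) u≉0)
      f-const : f ≈ₚ const (f ! 0)
      f-const zero    = refl
      f-const (suc i) = above (suc i) (s≤s z≤n)

    linear-has-root : ∀ f → f ! 1 ≉ 0# → DegreeAtMost f 1 → ∃[ x ] IsRoot f x
    linear-has-root f v≉0 above = x , (begin
      eval f x                         ≈⟨ eval-cong f (f ! 0 ∷ f ! 1 ∷ []) f≈ refl ⟩
      f ! 0 + x * (f ! 1 + x * 0#)     ≈⟨ solve 3 (λ u v w → u :+ :- (u :* w) :* (v :+ :- (u :* w) :* con (+ 0)) :=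
                                             u :+ :- (u :* (w :* v))) refl (f ! 0) (f ! 1) v⁻¹ ⟩
      f ! 0 + - (f ! 0 * (v⁻¹ * f ! 1)) ≈⟨ +-congˡ (-‿cong (trans (*-congˡ (proj₂ (inverse (f ! 1) v≉0))) (*-identityʳ _))) ⟩
      f ! 0 + - (f ! 0)                ≈⟨ -‿inverseʳ _ ⟩
      0#                               ∎)
      where
      v⁻¹ x : Carrier
      v⁻¹ = proj₁ (inverse (f ! 1) v≉0)
      x = - (f ! 0 * v⁻¹)
      f≈ : f ≈ₚ f ! 0 ∷ f ! 1 ∷ []
      f≈ zero          = refl
      f≈ (suc zero)    = refl
      f≈ (suc (suc i)) = above (suc (suc i)) (s≤s (s≤s z≤n))

  quadratic-monic : ∀ b c → IsMonicOfDegree (quadratic b c) 2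
  quadratic-monic b c = isMonicList⇒isMonic (quadratic b c) (≡.refl , refl)

  irreducible⇒rootless : ∀ b c → IsIrreducible (quadratic b c) → ∀ x → ¬ IsRoot (quadratic b c) x
  irreducible⇒rootless b c irr x root =
    Sum.[ monic-nonunit (linear x) (linear-monic x) , monic-nonunit g g-monic ]
      (RawSemiringDefs.Irreducible.split-∣1 irr {linear x} {g} (proj₂ split))
    where
    split : ∃[ g ] quadratic b c ≈ₚ linear x *ₚ g
    split = factor (quadratic b c) x root
    g : List Carrier
    g = proj₁ split
    g-monic : IsMonicOfDegree g 1
    g-monic = proj₂ (isMonic-cofactor 1≉0 (linear x) g (linear-monic x)
      (isMonic-resp (quadratic b c) (linear x *ₚ g) (proj₂ split) (quadratic-monic b c)))

  -- The degrees of two factors add up to 2. Degrees 1 and 1 would produce a root; otherwise one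
  -- factor is a nonzero constant.
  rootless⇒irreducible : ∀ b c → (∀ x → ¬ IsRoot (quadratic b c) x) → IsIrreducible (quadratic b c)
  rootless⇒irreducible b c rootless = record
    { p∤1      = monic-nonunit (quadratic b c) (quadratic-monic b c)
    ; split-∣1 = λ {f} {g} → split f g
    }
    where
    1≈0-absurd : ∀ f g → quadratic b c ≈ₚ f *ₚ g → (f *ₚ g) ! 2 ≈ 0# → f ∣ₚ P.1# ⊎ g ∣ₚ P.1#
    1≈0-absurd f g eq zero₂ = contradiction (trans (eq 2) zero₂) 1≉0
    split : ∀ f g → quadratic b c ≈ₚ f *ₚ g → f ∣ₚ P.1# ⊎ g ∣ₚ P.1#
    split f g eq = cases (degree f) (degree g)
      where
      no-root : ∀ x → IsRoot f x ⊎ IsRoot g x → f ∣ₚ P.1# ⊎ g ∣ₚ P.1#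
      no-root x r = contradiction (trans (eval-cong (quadratic b c) (f *ₚ g) eq refl)
        (trans (eval-* f g x) (vanish r))) (rootless x)
        where
        vanish : IsRoot f x ⊎ IsRoot g x → eval f x * eval g x ≈ 0#
        vanish (inj₁ r) = trans (*-congʳ r) (zeroˡ _)
        vanish (inj₂ r) = trans (*-congˡ r) (zeroʳ _)
      small : ∀ m n → f ! m ≉ 0# → DegreeAtMost f m → g ! n ≉ 0# → DegreeAtMost g n → m ℕ.+ n ≡ 2 →
        f ∣ₚ P.1# ⊎ g ∣ₚ P.1#
      small 0 n  fm df gn dg _      = inj₁ (constant-unit f fm df)
      small 1 1  fm df gn dg _      = let x , r = linear-has-root f fm df in no-root x (inj₁ r)
      small 2 0  fm df gn dg _      = inj₂ (constant-unit g gn dg)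
      small (suc (suc (suc m))) n fm df gn dg ()
      cases : f ≈ₚ [] ⊎ (∃[ d ] f ! d ≉ 0# × DegreeAtMost f d) →
              g ≈ₚ [] ⊎ (∃[ d ] g ! d ≉ 0# × DegreeAtMost g d) → f ∣ₚ P.1# ⊎ g ∣ₚ P.1#
      cases (inj₁ f≈0) _ = 1≈0-absurd f g eq (P.*-cong {f} {[]} {g} {g} f≈0 (λ _ → refl) 2)
      cases (inj₂ _) (inj₁ g≈0) = 1≈0-absurd f g eq
        (trans (P.*-cong {f} {f} {g} {[]} (λ _ → refl) g≈0 2) (P.zeroʳ f 2))
      cases (inj₂ (m , fm , df)) (inj₂ (n , gn , dg)) = small m n fm df gn dg m+n≡2
        where
        top : (quadratic b c) ! (m ℕ.+ n) ≉ 0#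
        top z = ≉0-* fm gn (trans (sym (!-top f g df dg)) (trans (sym (eq (m ℕ.+ n))) z))
        m+n≡2 : m ℕ.+ n ≡ 2
        m+n≡2 with ℕ.<-cmp (m ℕ.+ n) 2
        ... | tri≈ _ e _ = e
        ... | tri> _ _ l = contradiction (proj₂ (quadratic-monic b c) (m ℕ.+ n) l) top
        ... | tri< l _ _ = contradiction (trans (eq 2) (DegreeAtMost-* f g df dg 2 l)) 1≉0

-- Finite fields and their primitive elements

module Enumerated {a ℓ q} (F : FiniteField a ℓ q) where

  private module F = FiniteField F

  fieldRing : CommutativeRing a ℓ
  fieldRing = F.commutativeRing

  open CommutativeRing fieldRing
  open Inverse F.enumeration using (to; from; to-cong; from-cong; strictlyInverseˡ; strictlyInverseʳ)
  open Exp commutativeSemiring using (_^_; ^-congˡ; ^-congʳ; ^-homo-*; ^-assocʳ)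
  open Powers fieldRing using (^≈1)

  private
    index : Carrier → Fin q
    index = to

    element : Fin q → Carrier
    element = from

    index-injective : ∀ {x y} → index x ≡ index y → x ≈ y
    index-injective {x} {y} eq = trans (sym (strictlyInverseʳ x)) (trans (from-cong eq) (strictlyInverseʳ y))

    element-injective : ∀ {i j} → element i ≈ element j → i ≡ j
    element-injective {i} {j} eq = ≡.trans (≡.sym (strictlyInverseˡ i)) (≡.trans (to-cong eq) (strictlyInverseˡ j))

  isDiscreteField : IsDiscreteField fieldRing
  isDiscreteField = record
    { 1≉0     = F.1≉0
    ; inverse = F.inverse
    ; _≟_     = decide
    }
    where
    decide : Decidable _≈_
    decide x y with index x Fin.≟ index y
    ... | yes eq = yes (index-injective eq)
    ... | no neq = no (λ x≈y → neq (to-cong x≈y))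

  open IsDiscreteField isDiscreteField public using (_≟_; domain)
  open Field fieldRing isDiscreteField
  open Evaluation fieldRing
  open UniqueSetoid setoid using (Unique)
  open Membership setoid using (_∈_)

  elements : List Carrier
  elements = tabulate element

  length-elements : length elements ≡ q
  length-elements = length-tabulate element

  elements-unique : Unique elements
  elements-unique = UniqueProperties.tabulate⁺ setoid element-injective

  ∈-elements : ∀ x → x ∈ elements
  ∈-elements x = MembershipProperties.∈-resp-≈ setoid (strictlyInverseʳ x)
    (MembershipProperties.∈-tabulate⁺ setoid (index x))

  root-exists? : ∀ f → Dec (∃[ x ] IsRoot f x)
  root-exists? f = decide (Fin.any? (λ i → root? f (element i)))
    where
    decide : Dec (∃[ i ] IsRoot f (element i)) → Dec (∃[ x ] IsRoot f x)
    decide (yes (i , r)) = yes (element i , r)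
    decide (no none)     = no (λ (x , r) → none (index x ,
      trans (eval-cong f f (λ _ → refl) (strictlyInverseʳ x)) r))

  card>1 : 1 < q
  card>1 = Fin.injective⇒≤ {f = pair} pair-injective
    where
    pair : Fin 2 → Fin q
    pair Fin.zero    = index 0#
    pair (Fin.suc _) = index 1#
    pair-injective : ∀ {i j} → pair i ≡ pair j → i ≡ j
    pair-injective {Fin.zero}         {Fin.zero}         eq = ≡.refl
    pair-injective {Fin.zero}         {Fin.suc Fin.zero} eq = contradiction (sym (index-injective eq)) F.1≉0
    pair-injective {Fin.suc Fin.zero} {Fin.zero}         eq = contradiction (index-injective eq) F.1≉0
    pair-injective {Fin.suc Fin.zero} {Fin.suc Fin.zero} eq = ≡.refl

  -- x ↦ x + 1 permutes the field, so the sum of all elements equals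
  -- itself plus q · 1.
  card·1≈0 : Mult._×_ semiring q 1# ≈ 0#
  card·1≈0 = identityʳ-unique (sum element) (Mult._×_ semiring q 1#) (begin
    sum element + Mult._×_ semiring q 1#   ≈⟨ +-congˡ (sum-replicate q) ⟨
    sum element + sum {q} (λ _ → 1#)       ≈⟨ ∑-distrib-+ {q} element (λ _ → 1#) ⟨
    sum {q} (λ i → element i + 1#)         ≈⟨ sum-cong-≋ {q} (λ i → strictlyInverseʳ (element i + 1#)) ⟨
    sum {q} (λ i → element (shift i))      ≈⟨ sum-permute element translation ⟨
    sum element                            ∎)
    where
    open Sums +-commutativeMonoid
    open AbelianGroupProperties +-abelianGroup using (identityʳ-unique)
    open SetoidReasoning setoid
    shift unshift : Fin q → Fin q
    shift   i = index (element i + 1#)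
    unshift i = index (element i + - 1#)
    translation : Permutation′ q
    translation = permutation shift unshift
      (λ i → ≡.trans (to-cong (trans (+-congʳ (strictlyInverseʳ _))
        (trans (+-assoc _ _ _) (trans (+-congˡ (-‿inverseˡ 1#)) (+-identityʳ _))))) (strictlyInverseˡ i))
      (λ i → ≡.trans (to-cong (trans (+-congʳ (strictlyInverseʳ _))
        (trans (+-assoc _ _ _) (trans (+-congˡ (-‿inverseʳ 1#)) (+-identityʳ _))))) (strictlyInverseˡ i))

  module Primitive {g : Carrier} (g-primitive : F.IsPrimitiveElement g) where

    private
      g≉0 : g ≉ 0#
      g≉0 = proj₁ g-primitive

    -- If `g ^ m = 1`, then 0 and the `g ^ i` with `i < m` exhaust the field, which therefore has at
    -- most `suc m` elements.
    order-≥ : ∀ m → 1 ≤ m → g ^ m ≈ 1# → q ≤ suc m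
    order-≥ m@(suc _) _ gᵐ≈1 = Fin.injective⇒≤ {f = λ i → encode (element i) (element i ≟ 0#)}
      (λ {i} {j} eq → element-injective (trans (sym (decode-encode (element i) (element i ≟ 0#)))
        (trans (reflexive (≡.cong decode eq)) (decode-encode (element j) (element j ≟ 0#)))))
      where
      decode : Fin (suc m) → Carrier
      decode Fin.zero    = 0#
      decode (Fin.suc i) = g ^ toℕ i
      encode : ∀ x → Dec (x ≈ 0#) → Fin (suc m)
      encode x (yes _)  = Fin.zero
      encode x (no x≉0) = Fin.suc (fromℕ< (m%n<n (proj₁ (proj₂ g-primitive x x≉0)) m))
      decode-encode : ∀ x (d : Dec (x ≈ 0#)) → decode (encode x d) ≈ x
      decode-encode x (yes x≈0) = sym x≈0
      decode-encode x (no x≉0)  = begin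
        g ^ toℕ (fromℕ< (m%n<n n m))       ≈⟨ ^-congʳ g (Fin.toℕ-fromℕ< (m%n<n n m)) ⟩
        g ^ (n % m)                        ≈⟨ *-identityʳ _ ⟨
        g ^ (n % m) * 1#                   ≈⟨ *-congˡ (^≈1 (n / m) gᵐ≈1) ⟨
        g ^ (n % m) * (g ^ m) ^ (n / m)    ≈⟨ *-congˡ (trans (^-assocʳ g m (n / m)) (^-congʳ g (ℕ.*-comm m (n / m)))) ⟩
        g ^ (n % m) * g ^ (n / m ℕ.* m)    ≈⟨ ^-homo-* g (n % m) (n / m ℕ.* m) ⟨
        g ^ (n % m ℕ.+ n / m ℕ.* m)        ≈⟨ ^-congʳ g (m≡m%n+[m/n]*n n m) ⟨
        g ^ n                              ≈⟨ proj₂ (proj₂ g-primitive x x≉0) ⟨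
        x                                  ∎
        where
        open SetoidReasoning setoid
        n : ℕ
        n = proj₁ (proj₂ g-primitive x x≉0)

    -- Two of the `q + 1` elements 0, `g ^ 0`, ..., `g ^ (q - 1)` coincide, which gives `g ^ k = 1`
    -- for some `k` with `1 ≤ k ≤ q - 1`. By `order-≥` this `k` is `q - 1`.
    gᵠ⁻¹≈1 : g ^ (q ∸ 1) ≈ 1#
    gᵠ⁻¹≈1 = collision (Fin.pigeonhole (ℕ.n<1+n q) slot)
      where
      slot : Fin (suc q) → Fin q
      slot Fin.zero    = index 0#
      slot (Fin.suc i) = index (g ^ toℕ i)
      collision : (∃[ i ] ∃[ j ] i Fin.< j × slot i ≡ slot j) → g ^ (q ∸ 1) ≈ 1#
      collision (Fin.zero , Fin.suc j , _ , eq) =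
        contradiction (sym (index-injective eq)) (≉0-^ (toℕ j) g≉0)
      collision (Fin.suc i , Fin.suc j , s≤s i<j , eq) = trans (^-congʳ g (≡.sym k≡q-1)) gᵏ≈1
        where
        k : ℕ
        k = toℕ j ∸ toℕ i
        gᵏ≈1 : g ^ k ≈ 1#
        gᵏ≈1 = *-cancelˡ (g ^ toℕ i) (≉0-^ (toℕ i) g≉0) (trans (sym (^-homo-* g (toℕ i) k))
          (trans (^-congʳ g (ℕ.m+[n∸m]≡n (ℕ.<⇒≤ i<j))) (trans (sym (index-injective eq)) (sym (*-identityʳ _)))))
        k≡q-1 : k ≡ q ∸ 1
        k≡q-1 = ℕ.≤-antisym
          (ℕ.≤-trans (ℕ.m∸n≤m (toℕ j) (toℕ i)) (ℕ.<⇒≤pred (Fin.toℕ<n j)))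
          (ℕ.∸-monoˡ-≤ 1 (order-≥ k (ℕ.m<n⇒0<n∸m i<j) gᵏ≈1))

    xᵠ⁻¹≈1 : ∀ {x} → x ≉ 0# → x ^ (q ∸ 1) ≈ 1#
    xᵠ⁻¹≈1 {x} x≉0 = begin
      x ^ (q ∸ 1)           ≈⟨ ^-congˡ (q ∸ 1) (proj₂ (proj₂ g-primitive x x≉0)) ⟩
      (g ^ n) ^ (q ∸ 1)     ≈⟨ ^-assocʳ g n (q ∸ 1) ⟩
      g ^ (n ℕ.* (q ∸ 1))   ≈⟨ ^-congʳ g (ℕ.*-comm n (q ∸ 1)) ⟩
      g ^ ((q ∸ 1) ℕ.* n)   ≈⟨ ^-assocʳ g (q ∸ 1) n ⟨
      (g ^ (q ∸ 1)) ^ n     ≈⟨ ^≈1 n gᵠ⁻¹≈1 ⟩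
      1#                    ∎
      where
      open SetoidReasoning setoid
      n : ℕ
      n = proj₁ (proj₂ g-primitive x x≉0)

    xᵠ≈x : ∀ x → x ^ q ≈ x
    xᵠ≈x x = trans (^-congʳ x (≡.sym (ℕ.m+[n∸m]≡n (ℕ.<⇒≤ card>1)))) (cases (x ≟ 0#))
      where
      cases : Dec (x ≈ 0#) → x * x ^ (q ∸ 1) ≈ x
      cases (yes x≈0) = trans (*-congʳ x≈0) (trans (zeroˡ _) (sym x≈0))
      cases (no x≉0)  = trans (*-congˡ (xᵠ⁻¹≈1 x≉0)) (*-identityʳ x)

  -- If `x` were none of the `g ^ i` with `i < q - 1`, these powers together with 0 and `x` would
  -- fill `q + 1` places. The only collision left is between two powers, and it gives `g ^ k = 1`
  -- with `suc k < q`.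
  primitive-of-order : ∀ g → g ≉ 0# → (∀ m → 1 ≤ m → g ^ m ≈ 1# → q ≤ suc m) → F.IsPrimitiveElement g
  primitive-of-order g g≉0 order = g≉0 , power
    where
    power : ∀ x → x ≉ 0# → ∃[ n ] x ≈ g ^ n
    power x x≉0 = decided (Fin.any? (λ (i : Fin (q ∸ 1)) → x ≟ (g ^ toℕ i)))
      where
      decided : Dec (∃[ i ] x ≈ g ^ toℕ {q ∸ 1} i) → ∃[ n ] x ≈ g ^ n
      decided (yes (i , x≈gⁱ)) = toℕ i , x≈gⁱ
      decided (no x-new)       = ⊥-elim (collision (Fin.pigeonhole q< slot))
        where
        slot : Fin (suc (suc (q ∸ 1))) → Fin q
        slot Fin.zero              = index 0#
        slot (Fin.suc Fin.zero)    = index x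
        slot (Fin.suc (Fin.suc i)) = index (g ^ toℕ i)
        q< : q < suc (suc (q ∸ 1))
        q< = s≤s (ℕ.m≤n+m∸n q 1)
        collision : ¬ (∃[ i ] ∃[ j ] i Fin.< j × slot i ≡ slot j)
        collision (Fin.zero , Fin.suc Fin.zero , _ , eq) = x≉0 (sym (index-injective eq))
        collision (Fin.zero , Fin.suc (Fin.suc j) , _ , eq) = ≉0-^ (toℕ j) g≉0 (sym (index-injective eq))
        collision (Fin.suc Fin.zero , Fin.suc Fin.zero , s≤s () , _)
        collision (Fin.suc Fin.zero , Fin.suc (Fin.suc j) , _ , eq) = x-new (j , index-injective eq)
        collision (Fin.suc (Fin.suc i) , Fin.suc Fin.zero , s≤s () , _)
        collision (Fin.suc (Fin.suc i) , Fin.suc (Fin.suc j) , s≤s (s≤s i<j) , eq) =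
          ℕ.<⇒≱ {suc k} {q} (≡.subst (suc k <_) (ℕ.m+[n∸m]≡n (ℕ.<⇒≤ card>1))
            (s≤s (ℕ.≤-<-trans (ℕ.m∸n≤m (toℕ j) (toℕ i)) (Fin.toℕ<n j))))
            (order k (ℕ.m<n⇒0<n∸m i<j) gᵏ≈1)
          where
          k : ℕ
          k = toℕ j ∸ toℕ i
          gᵏ≈1 : g ^ k ≈ 1#
          gᵏ≈1 = *-cancelˡ (g ^ toℕ i) (≉0-^ (toℕ i) g≉0) (trans (sym (^-homo-* g (toℕ i) k))
            (trans (^-congʳ g (ℕ.m+[n∸m]≡n (ℕ.<⇒≤ i<j))) (trans (sym (index-injective eq)) (sym (*-identityʳ _)))))

-- The Frobenius map in rings over a finite field

module Frobenius {a ℓ q} (F : FiniteField a ℓ q)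
  {g : FiniteField.Carrier F} (g-primitive : FiniteField.IsPrimitiveElement F g)
  {e m} (S : CommutativeRing e m) (θ : FiniteField.Carrier F → CommutativeRing.Carrier S)
  (θ-isHom : IsHom (FiniteField.commutativeRing F) S θ) where

  private
    R : CommutativeRing a ℓ
    R = FiniteField.commutativeRing F
    module R = CommutativeRing R
    module S[X] = Evaluation S
    module θ = IsHom R S θ-isHom

  open Enumerated F
  open Primitive g-primitive using (xᵠ≈x)
  open Field R isDiscreteField
  open Evaluation R
  open CommutativeRing S
  open Exp commutativeSemiring using (_^_; ^-congˡ; ^-congʳ; ^-homo-*; ^-assocʳ; ^-distrib-*)
  open Integers S using (module RingSolver)
  open RingSolver using (solve; _:=_; _:+_; _:*_; :-_; con)
  open SetoidReasoning setoid
  private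
    module P = CommutativeRing polynomialRing
    open Exp P.commutativeSemiring using () renaming (_^_ to _^ₚ_)
    open Exp R.commutativeSemiring using () renaming (_^_ to _^ᴿ_; ^-congˡ to ^ᴿ-congˡ)

    evalθ : Carrier → List R.Carrier → Carrier
    evalθ s f = S[X].eval (map θ f) s

    evalθ-isHom : ∀ s → IsHom polynomialRing S (evalθ s)
    evalθ-isHom s = Composition.isRingHomomorphism trans (MapHom.map-isHom R S θ-isHom) (S[X].eval-isHom s)

    module E s = IsHom polynomialRing S (evalθ-isHom s)
    module V x = IsHom polynomialRing R (eval-isHom x)

    -- Written so that `X+ (- x)` is literally `linear x`, on which `root-of-product` relies.
    X+_ : R.Carrier → List R.Carrier
    X+ y = R.0# R.+ y ∷ R.1# ∷ []

    artinSchreier : R.Carrier → List R.Carrier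
    artinSchreier y = (X+ y) ^ₚ q +ₚ -ₚ (X+ y)

    evalθ-X+ : ∀ y s → evalθ s (X+ y) ≈ s + θ y
    evalθ-X+ y s = trans (+-cong (trans (θ.+-homo R.0# y) (+-congʳ θ.0#-homo)) (*-congˡ (+-congʳ θ.1#-homo)))
      (solve 2 (λ y s → con (+ 0) :+ y :+ s :* (con (+ 1) :+ s :* con (+ 0)) := s :+ y) refl (θ y) s)

    X+-monic : ∀ y → IsMonicOfDegree (X+ y) 1
    X+-monic y = R.refl , λ { (suc zero) (s≤s ()) ; (suc (suc k)) _ → R.refl }

    ^-monic : ∀ f → IsMonicOfDegree f 1 → ∀ k → IsMonicOfDegree (f ^ₚ k) k
    ^-monic f f-monic zero    = isMonic-1
    ^-monic f f-monic (suc k) = isMonic-* f (f ^ₚ k) f-monic (^-monic f f-monic k)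

    artinSchreier≈ : ∀ y → artinSchreier y ≈ₚ fromRoots elements
    artinSchreier≈ y = fromRoots-complete (artinSchreier y) monic elements length-elements elements-unique
      (All.universal root elements)
      where
      monic : IsMonicOfDegree (artinSchreier y) q
      monic = isMonic-resp (-ₚ (X+ y) +ₚ (X+ y) ^ₚ q) (artinSchreier y) (P.+-comm (-ₚ (X+ y)) ((X+ y) ^ₚ q))
        (isMonic-+ (-ₚ (X+ y)) ((X+ y) ^ₚ q) card>1
          (DegreeAtMost-neg (X+ y) (proj₂ (X+-monic y))) (^-monic (X+ y) (X+-monic y) q))
      root : ∀ x → IsRoot (artinSchreier y) x
      root x = R.trans (V.+-homo x ((X+ y) ^ₚ q) (-ₚ (X+ y))) (R.trans
        (R.+-cong (R.trans (V.^-homo x (X+ y) q) (xᵠ≈x (eval (X+ y) x))) (V.-‿homo x (X+ y)))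
        (R.-‿inverseʳ _))

    evalθ-artinSchreier : ∀ y s → evalθ s (artinSchreier y) ≈ (s + θ y) ^ q + - (s + θ y)
    evalθ-artinSchreier y s = trans (E.+-homo s ((X+ y) ^ₚ q) (-ₚ (X+ y))) (+-cong
      (trans (E.^-homo s (X+ y) q) (^-congˡ q (evalθ-X+ y s)))
      (trans (E.-‿homo s (X+ y)) (-‿cong (evalθ-X+ y s))))

  -- (X + y)^q - (X + y) and X^q - X are both monic of degree q and
  -- vanish on the whole field.
  frobenius-+ : ∀ s y → (s + θ y) ^ q ≈ s ^ q + θ y
  frobenius-+ s y = begin
    (s + θ y) ^ q
      ≈⟨ solve 2 (λ u v → u := (u :+ :- v) :+ v) refl ((s + θ y) ^ q) (s + θ y) ⟩
    ((s + θ y) ^ q + - (s + θ y)) + (s + θ y)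
      ≈⟨ +-congʳ (trans (sym (evalθ-artinSchreier y s)) (trans (E.⟦⟧-cong s
           {artinSchreier y} {artinSchreier R.0#}
           (λ i → R.trans (artinSchreier≈ y i) (R.sym (artinSchreier≈ R.0# i)))) (evalθ-artinSchreier R.0# s))) ⟩
    ((s + θ R.0#) ^ q + - (s + θ R.0#)) + (s + θ y)
      ≈⟨ +-congʳ (+-cong (^-congˡ q s+0) (-‿cong s+0)) ⟩
    (s ^ q + - s) + (s + θ y)
      ≈⟨ solve 3 (λ u s y → (u :+ :- s) :+ (s :+ y) := u :+ y) refl (s ^ q) s (θ y) ⟩
    s ^ q + θ y
      ∎
    where
    s+0 : s + θ R.0# ≈ s
    s+0 = trans (+-congˡ θ.0#-homo) (+-identityʳ s)

  module _ (domain-S : ∀ x y → x * y ≈ 0# → x ≈ 0# ⊎ y ≈ 0#) (1≉0 : 1# ≉ 0#) where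

    open AbelianGroupProperties +-abelianGroup using (x∙y⁻¹≈ε⇒x≈y)

    private
      root-of-product : ∀ xs s → evalθ s (fromRoots xs) ≈ 0# → ∃[ x ] s ≈ θ x
      root-of-product []       s r = contradiction (trans (sym (E.1#-homo s)) r) 1≉0
      root-of-product (x ∷ xs) s r = Sum.[
        (λ r′ → x , x∙y⁻¹≈ε⇒x≈y s (θ x) (trans (+-congˡ (sym (θ.-‿homo x))) (trans (sym (evalθ-X+ (R.- x) s)) r′))) ,
        root-of-product xs s ]′
        (domain-S (evalθ s (linear x)) (evalθ s (fromRoots xs)) (trans (sym (E.*-homo s (linear x) (fromRoots xs))) r))

    -- `s^q - s` is the product of the `s - θ x` over all `x` in the field, and `S` is a domain.
    frobenius-fixed : ∀ s → s ^ q ≈ s → ∃[ x ] s ≈ θ x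
    frobenius-fixed s sᵠ≈s = root-of-product elements s (begin
      evalθ s (fromRoots elements)              ≈⟨ E.⟦⟧-cong s {fromRoots elements} {artinSchreier R.0#}
                                                    (λ i → R.sym (artinSchreier≈ R.0# i)) ⟩
      evalθ s (artinSchreier R.0#)              ≈⟨ evalθ-artinSchreier R.0# s ⟩
      (s + θ R.0#) ^ q + - (s + θ R.0#)         ≈⟨ +-congʳ (frobenius-+ s R.0#) ⟩
      s ^ q + θ R.0# + - (s + θ R.0#)           ≈⟨ +-congʳ (+-congʳ sᵠ≈s) ⟩
      s + θ R.0# + - (s + θ R.0#)               ≈⟨ -‿inverseʳ _ ⟩
      0#                                        ∎)

    module _ (b c : R.Carrier) (γ : Carrier) (γ-root : γ * γ + θ b * γ + θ c ≈ 0#) where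

      conjugate : Carrier
      conjugate = - θ b + - γ

      γ*conjugate : γ * conjugate ≈ θ c
      γ*conjugate = begin
        γ * (- θ b + - γ)                        ≈⟨ solve 3 (λ γ b c → γ :* (:- b :+ :- γ) := c :+ :- (γ :* γ :+ b :* γ :+ c)) refl γ (θ b) (θ c) ⟩
        θ c + - (γ * γ + θ b * γ + θ c)          ≈⟨ +-congˡ (-‿cong γ-root) ⟩
        θ c + - 0#                               ≈⟨ solve 1 (λ c → c :+ :- con (+ 0) := c) refl (θ c) ⟩
        θ c                                      ∎

      private
        -- `frobenius-+` asks only for one summand from the base field, here `- c`; the other one,
        -- `- b γ`, is raised to the power `q` factor by factor.
        γᵠ-root : γ ^ q * γ ^ q ≈ θ (R.- b) * γ ^ q + θ (R.- c)
        γᵠ-root = begin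
          γ ^ q * γ ^ q                            ≈⟨ ^-distrib-* γ γ q ⟨
          (γ * γ) ^ q                              ≈⟨ ^-congˡ q γγ≈ ⟩
          (θ (R.- b) * γ + θ (R.- c)) ^ q          ≈⟨ frobenius-+ (θ (R.- b) * γ) (R.- c) ⟩
          (θ (R.- b) * γ) ^ q + θ (R.- c)          ≈⟨ +-congʳ (trans (^-distrib-* (θ (R.- b)) γ q)
                                                       (*-congʳ (trans (sym (θ.^-homo (R.- b) q)) (θ.⟦⟧-cong (xᵠ≈x (R.- b)))))) ⟩
          θ (R.- b) * γ ^ q + θ (R.- c)            ∎
          where
          γγ≈ : γ * γ ≈ θ (R.- b) * γ + θ (R.- c)
          γγ≈ = begin
            γ * γ                                                ≈⟨ solve 3 (λ γ b c → γ :* γ := :- b :* γ :+ :- c :+ (γ :* γ :+ b :* γ :+ c)) refl γ (θ b) (θ c) ⟩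
            - θ b * γ + - θ c + (γ * γ + θ b * γ + θ c)          ≈⟨ trans (+-congˡ γ-root) (+-identityʳ _) ⟩
            - θ b * γ + - θ c                                    ≈⟨ +-cong (*-congʳ (sym (θ.-‿homo b))) (sym (θ.-‿homo c)) ⟩
            θ (R.- b) * γ + θ (R.- c)                            ∎

      -- By `γᵠ-root`, `γ ^ q` is again a root of the quadratic, which factors as
      -- `(T - γ) (T - conjugate)`.
      γᵠ≈γ⊎conjugate : γ ^ q ≈ γ ⊎ γ ^ q ≈ conjugate
      γᵠ≈γ⊎conjugate = Sum.map (x∙y⁻¹≈ε⇒x≈y (γ ^ q) γ) (x∙y⁻¹≈ε⇒x≈y (γ ^ q) conjugate)
        (domain-S (γ ^ q + - γ) (γ ^ q + - conjugate) (begin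
          (γ ^ q + - γ) * (γ ^ q + - (- θ b + - γ))
            ≈⟨ solve 4 (λ s γ b c → (s :+ :- γ) :* (s :+ :- (:- b :+ :- γ)) :=
                 s :* s :+ b :* s :+ c :+ :- (γ :* γ :+ b :* γ :+ c)) refl (γ ^ q) γ (θ b) (θ c) ⟩
          γ ^ q * γ ^ q + θ b * γ ^ q + θ c + - (γ * γ + θ b * γ + θ c)
            ≈⟨ +-cong (+-congʳ (+-congʳ (trans γᵠ-root (+-cong (*-congʳ (θ.-‿homo b)) (θ.-‿homo c))))) (-‿cong γ-root) ⟩
          - θ b * γ ^ q + - θ c + θ b * γ ^ q + θ c + - 0#
            ≈⟨ solve 3 (λ s b c → :- b :* s :+ :- c :+ b :* s :+ c :+ :- con (+ 0) := con (+ 0)) refl (γ ^ q) (θ b) (θ c) ⟩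
          0#
            ∎))

      module _ (γᵠ≈ : γ ^ q ≈ conjugate) where

        γᵠ⁺¹≈c : γ ^ suc q ≈ θ c
        γᵠ⁺¹≈c = trans (*-congˡ γᵠ≈) γ*conjugate

        -- conjugate^(m+1) = γ^(q(m+1)) = γ^(m+1) (γ^(q+1))^m = γ^(m+1) c^m
        half-power-sum : ∀ m → q ≡ suc (2 ℕ.* m) → c ^ᴿ m R.≈ R.- R.1# → γ ^ suc m + conjugate ^ suc m ≈ 0#
        half-power-sum m q≡ cᵐ≈-1 = begin
          γ ^ suc m + conjugate ^ suc m                  ≈⟨ +-congˡ (^-congˡ (suc m) (sym γᵠ≈)) ⟩
          γ ^ suc m + (γ ^ q) ^ suc m                    ≈⟨ +-congˡ (trans (^-assocʳ γ q (suc m)) (^-congʳ γ exponent)) ⟩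
          γ ^ suc m + γ ^ (suc m ℕ.+ suc q ℕ.* m)        ≈⟨ +-congˡ (^-homo-* γ (suc m) (suc q ℕ.* m)) ⟩
          γ ^ suc m + γ ^ suc m * γ ^ (suc q ℕ.* m)      ≈⟨ +-congˡ (*-congˡ (sym (^-assocʳ γ (suc q) m))) ⟩
          γ ^ suc m + γ ^ suc m * (γ ^ suc q) ^ m        ≈⟨ +-congˡ (*-congˡ (trans (^-congˡ m γᵠ⁺¹≈c)
            (trans (sym (θ.^-homo c m)) (trans (θ.⟦⟧-cong cᵐ≈-1) (trans (θ.-‿homo R.1#) (-‿cong θ.1#-homo)))))) ⟩
          γ ^ suc m + γ ^ suc m * - 1#                   ≈⟨ solve 1 (λ t → t :+ t :* :- con (+ 1) := con (+ 0)) refl (γ ^ suc m) ⟩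
          0#                                             ∎
          where
          open ℕ-Solver.+-*-Solver using () renaming (solve to solveℕ; _:=_ to _≔_; _:+_ to _⊹_; _:*_ to _⊛_; con to conℕ)
          exponent : q ℕ.* suc m ≡ suc m ℕ.+ suc q ℕ.* m
          exponent = ≡.subst (λ k → k ℕ.* suc m ≡ suc m ℕ.+ suc k ℕ.* m) (≡.sym q≡)
            (solveℕ 1 (λ m → (conℕ 1 ⊹ conℕ 2 ⊛ m) ⊛ (conℕ 1 ⊹ m) ≔ ((conℕ 1 ⊹ m) ⊹ (conℕ 2 ⊹ conℕ 2 ⊛ m) ⊛ m)) ≡.refl m)

-- The field with q² elements given by a rootless quadratic

module QuadraticField {a ℓ q} (F : FiniteField a ℓ q) (b c : FiniteField.Carrier F)
  (rootless : ∀ x → ¬ FiniteField.IsRoot F (FiniteField.quadratic F b c) x) where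

  private module F = FiniteField F
  open CommutativeRing F.commutativeRing
  open Enumerated F
  open Field F.commutativeRing isDiscreteField using (≉0-*)
  open QuadraticExtension F.commutativeRing b c
  open Integers F.commutativeRing using (module RingSolver)
  open RingSolver using (solve; _:=_; _:+_; _:*_; :-_; con)
  private module A = CommutativeRing quadraticExtension

  private
    norm : Carrier → Carrier → Carrier
    norm u v = u * u + - (b * (u * v)) + c * (v * v)

    -- norm u v = v² (t² + b t + c) for t = - u / v
    norm≉0 : ∀ u v → (u , v) A.≉ A.0# → norm u v ≉ 0#
    norm≉0 u v uv≉0 n≈0 = cases (v ≟ 0#)
      where
      open SetoidReasoning setoid
      cases : Dec (v ≈ 0#) → _
      cases (yes v≈0) = ≉0-* u≉0 u≉0 (begin
        u * u                                              ≈⟨ solve 3 (λ u b c → u :* u := u :* u :+ :- (b :* (u :* con (+ 0))) :+ c :* (con (+ 0) :* con (+ 0))) refl u b c ⟩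
        u * u + - (b * (u * 0#)) + c * (0# * 0#)           ≈⟨ +-cong (+-congˡ (-‿cong (*-congˡ (*-congˡ v≈0)))) (*-congˡ (*-cong v≈0 v≈0)) ⟨
        norm u v                                           ≈⟨ n≈0 ⟩
        0#                                                 ∎)
        where
        u≉0 : u ≉ 0#
        u≉0 u≈0 = uv≉0 (u≈0 , v≈0)
      cases (no v≉0) = rootless (- (u * w)) (begin
        c + - (u * w) * (b + - (u * w) * (1# + - (u * w) * 0#))
          ≈⟨ solve 4 (λ u w b c → c :+ :- (u :* w) :* (b :+ :- (u :* w) :* (con (+ 1) :+ :- (u :* w) :* con (+ 0))) :=
               w :* w :* (u :* u) :+ :- (b :* (u :* w)) :+ c) refl u w b c ⟩
        w * w * (u * u) + - (b * (u * w)) + c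
          ≈⟨ +-cong (+-congˡ (-‿cong (*-congˡ (sym (trans (*-congˡ wv≈1) (*-identityʳ _)))))) (sym (trans (*-congˡ (trans (*-cong wv≈1 wv≈1) (*-identityˡ 1#))) (*-identityʳ c))) ⟩
        w * w * (u * u) + - (b * (u * w * (w * v))) + c * (w * v * (w * v))
          ≈⟨ solve 5 (λ u v w b c → w :* w :* (u :* u) :+ :- (b :* (u :* w :* (w :* v))) :+ c :* (w :* v :* (w :* v)) :=
               w :* w :* (u :* u :+ :- (b :* (u :* v)) :+ c :* (v :* v))) refl u v w b c ⟩
        w * w * norm u v
          ≈⟨ trans (*-congˡ n≈0) (zeroʳ _) ⟩
        0#
          ∎)
        where
        w : Carrier
        w = proj₁ (F.inverse v v≉0)
        wv≈1 : w * v ≈ 1#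
        wv≈1 = proj₂ (F.inverse v v≉0)

    -- The conjugate `u - b v - v T` divided by the norm.
    inverse : ∀ x → x A.≉ A.0# → ∃[ y ] y A.* x A.≈ A.1#
    inverse (u , v) uv≉0 = (w * (u + - (b * v)) , - (w * v)) ,
      trans (solve 5 (λ w u v b c → w :* (u :+ :- (b :* v)) :* u :+ :- (c :* (:- (w :* v) :* v)) :=
        w :* (u :* u :+ :- (b :* (u :* v)) :+ c :* (v :* v))) refl w u v b c) (proj₂ (F.inverse (norm u v) n≉0)) ,
      solve 4 (λ w u v b → w :* (u :+ :- (b :* v)) :* v :+ :- (w :* v) :* u :+ :- (b :* (:- (w :* v) :* v)) := con (+ 0))
        refl w u v b
      where
      n≉0 : norm u v ≉ 0#
      n≉0 = norm≉0 u v uv≉0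
      w : Carrier
      w = proj₁ (F.inverse (norm u v) n≉0)

  isDiscreteFieldExtension : IsDiscreteField quadraticExtension
  isDiscreteFieldExtension = record
    { 1≉0     = λ p → F.1≉0 (proj₁ p)
    ; inverse = inverse
    ; _≟_     = λ (u , v) (u′ , v′) → (u ≟ u′) ×-dec (v ≟ v′)
    }

  private
    module En = Inverse F.enumeration

    enumeration : Inverse A.setoid (≡.setoid (Fin (q ℕ.* q)))
    enumeration = record
      { to        = λ (u , v) → combine (En.to u) (En.to v)
      ; from      = λ i → En.from (proj₁ (remQuot {q} q i)) , En.from (proj₂ (remQuot {q} q i))
      ; to-cong   = λ (p , r) → ≡.cong₂ combine (En.to-cong p) (En.to-cong r)
      ; from-cong = λ { ≡.refl → refl , refl }
      ; inverse   =
          (λ {i} {x} x≈ → ≡.trans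
            (≡.cong₂ combine
              (≡.trans (En.to-cong (proj₁ x≈)) (En.strictlyInverseˡ (proj₁ (remQuot {q} q i))))
              (≡.trans (En.to-cong (proj₂ x≈)) (En.strictlyInverseˡ (proj₂ (remQuot {q} q i)))))
            (Fin.combine-remQuot {q} q i)) ,
          (λ {(u , v)} {i} i≡ →
            trans (En.from-cong (≡.cong proj₁ (≡.trans (≡.cong (remQuot {q} q) i≡) (Fin.remQuot-combine (En.to u) (En.to v))))) (En.strictlyInverseʳ u) ,
            trans (En.from-cong (≡.cong proj₂ (≡.trans (≡.cong (remQuot {q} q) i≡) (Fin.remQuot-combine (En.to u) (En.to v))))) (En.strictlyInverseʳ v))
      }

  quadraticField : FiniteField a ℓ (q ℕ.^ 2)
  quadraticField = record
    { commutativeRing = quadraticExtension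
    ; 1≉0             = λ p → F.1≉0 (proj₁ p)
    ; inverse         = inverse
    ; enumeration     = ≡.subst (λ n → Inverse A.setoid (≡.setoid (Fin n)))
        (≡.cong (q ℕ.*_) (≡.sym (ℕ.*-identityʳ q))) enumeration
    }

  extensionField : Extension F 2
  extensionField = record
    { L              = quadraticField
    ; embed          = ι
    ; isMonomorphism = record { isRingHomomorphism = ι-isHom ; injective = proj₁ }
    }

-- Transport of cyclotomic forms and power sums along homomorphisms

module _ {a ℓ b m} (R : CommutativeRing a ℓ) (S : CommutativeRing b m) where

  private
    module R = CommutativeRing R
    module S = CommutativeRing S

  module CyclotomicMap {θ : R.Carrier → S.Carrier} (h : IsHom R S θ) where

    open IsHom R S h

    fromℤ-unique : ∀ i → θ (fromℤ R.rawRing i) S.≈ fromℤ S.rawRing i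
    fromℤ-unique (+ n)    = ×1-homo n
    fromℤ-unique -[1+ n ] = S.trans (-‿homo _) (S.-‿cong (×1-homo (suc n)))

    map-Φ : ∀ n i → coeff S.rawRing (map θ (CyclotomicOver.Φ R n)) i S.≈ coeff S.rawRing (CyclotomicOver.Φ S n) i
    map-Φ n i = go (Cyclotomic.Φ n) i
      where
      go : ∀ f i → coeff S.rawRing (map θ (map (fromℤ R.rawRing) f)) i S.≈ coeff S.rawRing (map (fromℤ S.rawRing) f) i
      go []      i       = S.refl
      go (x ∷ f) zero    = fromℤ-unique x
      go (x ∷ f) (suc i) = go f i

    Φʰ-map : ∀ n x y → θ (CyclotomicOver.Φʰ R n x y) S.≈ CyclotomicOver.Φʰ S n (θ x) (θ y)
    Φʰ-map n x y = S.trans (MapHom.homogenize-map R S h (φ n) (CyclotomicOver.Φ R n) x y)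
      (Evaluation.homogenize-cong S (φ n) (map θ (CyclotomicOver.Φ R n)) (CyclotomicOver.Φ S n) (map-Φ n) S.refl S.refl)

  module _ {σ : R.Carrier → S.Carrier} (h : IsHom R S σ) where

    private
      module ExpR = Exp R.commutativeSemiring
      module ExpS = Exp S.commutativeSemiring
    open IsHom R S h

    transport-Φʰ : ∀ n z x y x′ y′ → z R.≈ CyclotomicOver.Φʰ R n x y → σ x S.≈ x′ → σ y S.≈ y′ →
      σ z S.≈ CyclotomicOver.Φʰ S n x′ y′
    transport-Φʰ n z x y x′ y′ z≈ x≈ y≈ = S.trans (⟦⟧-cong z≈)
      (S.trans (CyclotomicMap.Φʰ-map h n x y) (CyclotomicOver.Φʰ-cong S n x≈ y≈))

    transport-power-sum : ∀ n z x y x′ y′ → z R.≈ x ExpR.^ n R.+ y ExpR.^ n → σ x S.≈ x′ → σ y S.≈ y′ →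
      σ z S.≈ x′ ExpS.^ n S.+ y′ ExpS.^ n
    transport-power-sum n z x y x′ y′ z≈ x≈ y≈ = S.trans (⟦⟧-cong z≈) (S.trans (+-homo _ _)
      (S.+-cong (S.trans (^-homo x n) (ExpS.^-congˡ n x≈)) (S.trans (^-homo y n) (ExpS.^-congˡ n y≈))))

-- Power sums of the roots of a quadratic

module PowerSums {a ℓ} (R : CommutativeRing a ℓ) where

  open CommutativeRing R
  open Exp commutativeSemiring using (_^_)
  open Integers R using (module RingSolver)
  open RingSolver using (solve; _:=_; _:+_; _:*_; :-_; con)
  open SetoidReasoning setoid

  ^-recurrence : ∀ b c x n → x * x + b * x + c ≈ 0# → x ^ suc (suc n) ≈ - b * x ^ suc n + - (c * x ^ n)
  ^-recurrence b c x n root = begin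
    x * (x * x ^ n)
      ≈⟨ solve 4 (λ b c x t → x :* (x :* t) := :- b :* (x :* t) :+ :- (c :* t) :+ (x :* x :+ b :* x :+ c) :* t) refl b c x (x ^ n) ⟩
    - b * (x * x ^ n) + - (c * x ^ n) + (x * x + b * x + c) * x ^ n
      ≈⟨ trans (+-congˡ (trans (*-congʳ root) (zeroˡ _))) (+-identityʳ _) ⟩
    - b * (x * x ^ n) + - (c * x ^ n)
      ∎

  power-sum-recurrence : ∀ b c x y v₀ v₁ n → x * x + b * x + c ≈ 0# → y * y + b * y + c ≈ 0# →
    v₀ ≈ x ^ n + y ^ n → v₁ ≈ x ^ suc n + y ^ suc n →
    - b * v₁ + - (c * v₀) ≈ x ^ suc (suc n) + y ^ suc (suc n)
  power-sum-recurrence b c x y v₀ v₁ n x-root y-root v₀≈ v₁≈ = begin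
    - b * v₁ + - (c * v₀)
      ≈⟨ +-cong (*-congˡ v₁≈) (-‿cong (*-congˡ v₀≈)) ⟩
    - b * (x ^ suc n + y ^ suc n) + - (c * (x ^ n + y ^ n))
      ≈⟨ solve 6 (λ b c x₀ y₀ x₁ y₁ → :- b :* (x₁ :+ y₁) :+ :- (c :* (x₀ :+ y₀)) :=
           (:- b :* x₁ :+ :- (c :* x₀)) :+ (:- b :* y₁ :+ :- (c :* y₀))) refl b c (x ^ n) (y ^ n) (x ^ suc n) (y ^ suc n) ⟩
    (- b * x ^ suc n + - (c * x ^ n)) + (- b * y ^ suc n + - (c * y ^ n))
      ≈⟨ +-cong (^-recurrence b c x n x-root) (^-recurrence b c y n y-root) ⟨
    x ^ suc (suc n) + y ^ suc (suc n)
      ∎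

  other-root : ∀ b c x y → x * x + b * x + c ≈ 0# → y ≈ - b + - x → y * y + b * y + c ≈ 0#
  other-root b c x y root y≈ = begin
    y * y + b * y + c                                      ≈⟨ +-congʳ (+-cong (*-cong y≈ y≈) (*-congˡ y≈)) ⟩
    (- b + - x) * (- b + - x) + b * (- b + - x) + c        ≈⟨ solve 3 (λ b c x → (:- b :+ :- x) :* (:- b :+ :- x) :+ b :* (:- b :+ :- x) :+ c :=
                                                                x :* x :+ b :* x :+ c) refl b c x ⟩
    x * x + b * x + c                                      ≈⟨ root ⟩
    0#                                                     ∎

  conjugate-involutive : ∀ b x y z → y ≈ - b + - x → z ≈ - b + - y → z ≈ x
  conjugate-involutive b x y z y≈ z≈ = trans z≈ (trans (+-congˡ (-‿cong y≈))
    (solve 2 (λ b x → :- b :+ :- (:- b :+ :- x) := x) refl b x))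

  conjugate-unique : ∀ b b′ x y z → b ≈ b′ → y ≈ - b + - x → z ≈ - b′ + - x → y ≈ z
  conjugate-unique b b′ x y z b≈b′ y≈ z≈ = trans y≈ (trans (+-congʳ (-‿cong b≈b′)) (sym z≈))

  halve⇒-x≈x⇒x≈0 : (∀ x → x + x ≈ 0# → x ≈ 0#) → ∀ x y → y ≈ x → y ≈ - x → x ≈ 0#
  halve⇒-x≈x⇒x≈0 halve x y y≈x y≈-x = halve x (trans (+-congˡ (trans (sym y≈x) y≈-x)) (-‿inverseʳ x))

  root-resp : ∀ x b b′ c c′ → b ≈ b′ → c ≈ c′ → x * x + b * x + c ≈ 0# → x * x + b′ * x + c′ ≈ 0#
  root-resp x b b′ c c′ b≈ c≈ root = trans (+-cong (+-congˡ (*-congʳ (sym b≈))) (sym c≈)) root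

  sum-of-roots : ∀ b x y → y ≈ - b + - x → - b ≈ x * 1# + y * 1#
  sum-of-roots b x y y≈ = trans (solve 2 (λ b x → :- b := x :* con (+ 1) :+ (:- b :+ :- x) :* con (+ 1)) refl b x)
    (+-congˡ (*-congʳ (sym y≈)))

-- Lucas polynomials and Lucas atoms in terms of the two roots

module RootRing {a ℓ e m} (R : CommutativeRing a ℓ) (Q : CommutativeRing e m) where

  private
    module R = CommutativeRing R
    module R[B] = Evaluation R
    module R[B,C] = Evaluation R[B].polynomialRing
    module Bi = Bivariate R.rawRing
    PBC : CommutativeRing a ℓ
    PBC = R[B,C].polynomialRing
    module PBC = CommutativeRing PBC
    module Q = CommutativeRing Q
    module ExpQ = Exp Q.commutativeSemiring
    module Q[X] = Evaluation Q
  open SetoidReasoning Q.setoid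

  sum-Φʰ : ∀ {θ : R.Carrier → Q.Carrier} → IsHom R Q θ → ∀ n x y →
    RawSemiringDefs.sum (RawRing.rawSemiring Q.rawRing) {suc (φ n)} (λ i →
      θ (coeff R.rawRing (cyclotomicOver R.rawRing n) (toℕ i)) Q.* x ExpQ.^ toℕ i Q.* y ExpQ.^ (φ n ∸ toℕ i))
    Q.≈ CyclotomicOver.Φʰ Q n x y
  sum-Φʰ {θ} h n x y = begin
    SQ.sum {suc (φ n)} (λ i → θ (coeff R.rawRing (cyclotomicOver R.rawRing n) (toℕ i)) Q.* x ExpQ.^ toℕ i Q.* y ExpQ.^ (φ n ∸ toℕ i))
      ≈⟨ SQ.sum-cong-≋ {suc (φ n)} (λ i → Q.*-congʳ {y ExpQ.^ (φ n ∸ toℕ i)}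
           (Q.*-congʳ {x ExpQ.^ toℕ i} (Q.sym (MapHom.map-! R Q h (cyclotomicOver R.rawRing n) (toℕ i))))) ⟩
    SQ.sum {suc (φ n)} (λ i → map θ (cyclotomicOver R.rawRing n) Q[X].! toℕ i Q.* x ExpQ.^ toℕ i Q.* y ExpQ.^ (φ n ∸ toℕ i))
      ≈⟨ Q[X].sum-homogenize (φ n) (map θ (cyclotomicOver R.rawRing n)) x y ⟩
    Q[X].homogenize (φ n) (map θ (cyclotomicOver R.rawRing n)) x y
      ≡⟨ ≡.cong (λ f → Q[X].homogenize (φ n) (map θ f) x y) (CyclotomicOver.Φ≡cyclotomicOver R n) ⟨
    Q[X].homogenize (φ n) (map θ (CyclotomicOver.Φ R n)) x y
      ≈⟨ Q[X].homogenize-cong (φ n) (map θ (CyclotomicOver.Φ R n)) (CyclotomicOver.Φ Q n)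
           (CyclotomicMap.map-Φ R Q h n) Q.refl Q.refl ⟩
    CyclotomicOver.Φʰ Q n x y
      ∎
    where module SQ = Sums Q.+-commutativeMonoid

  module _ {ι : PBC.Carrier → Q.Carrier} (ι-isHom : IsHom PBC Q ι) (α β : Q.Carrier)
    (α-root : α Q.* α Q.+ ι Bi.B Q.* α Q.+ ι Bi.C Q.≈ Q.0#) (β≈ : β Q.≈ Q.- ι Bi.B Q.+ Q.- α) where

    private
      module ι = IsHom PBC Q ι-isHom

    lucasV-power-sum : ∀ n → ι (Bi.lucasV n) Q.≈ α ExpQ.^ n Q.+ β ExpQ.^ n
    lucasV-power-sum zero          = Q.trans (ι.+-homo PBC.1# PBC.1#) (Q.+-cong ι.1#-homo ι.1#-homo)
    lucasV-power-sum (suc zero)    = Q.trans (ι.-‿homo Bi.B) (PowerSums.sum-of-roots Q (ι Bi.B) α β β≈)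
    lucasV-power-sum (suc (suc n)) = begin
      ι (Bi.lucasV (suc (suc n)))
        ≈⟨ ι.+-homo (PBC.- Bi.B PBC.* Bi.lucasV (suc n)) (PBC.- (Bi.C PBC.* Bi.lucasV n)) ⟩
      ι (PBC.- Bi.B PBC.* Bi.lucasV (suc n)) Q.+ ι (PBC.- (Bi.C PBC.* Bi.lucasV n))
        ≈⟨ Q.+-cong (Q.trans (ι.*-homo (PBC.- Bi.B) (Bi.lucasV (suc n))) (Q.*-congʳ (ι.-‿homo Bi.B)))
                    (Q.trans (ι.-‿homo (Bi.C PBC.* Bi.lucasV n)) (Q.-‿cong (ι.*-homo Bi.C (Bi.lucasV n)))) ⟩
      Q.- ι Bi.B Q.* ι (Bi.lucasV (suc n)) Q.+ Q.- (ι Bi.C Q.* ι (Bi.lucasV n))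
        ≈⟨ PowerSums.power-sum-recurrence Q (ι Bi.B) (ι Bi.C) α β (ι (Bi.lucasV n)) (ι (Bi.lucasV (suc n))) n
             α-root (PowerSums.other-root Q (ι Bi.B) (ι Bi.C) α β α-root β≈) (lucasV-power-sum n) (lucasV-power-sum (suc n)) ⟩
      α ExpQ.^ suc (suc n) Q.+ β ExpQ.^ suc (suc n)
        ∎

  Φʰ-conjugation : ∀ {conj : Q.Carrier → Q.Carrier} → IsHom Q Q conj → ∀ n → 2 ≤ n → ∀ z α β →
    z Q.≈ CyclotomicOver.Φʰ Q n α β → conj α Q.≈ β → conj β Q.≈ α → conj z Q.≈ z
  Φʰ-conjugation h n 2≤n z α β z≈ α↦β β↦α = Q.trans (transport-Φʰ Q Q h n z α β β α z≈ α↦β β↦α)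
    (Q.trans (CyclotomicOver.Φʰ-swap Q n 2≤n β α) (Q.sym z≈))

module Lucas {a ℓ} (R : CommutativeRing a ℓ) where

  private
    module R = CommutativeRing R
    module R[B] = Evaluation R
    module R[B,C] = Evaluation R[B].polynomialRing
    module Bi = Bivariate R.rawRing
    PB : CommutativeRing a ℓ
    PB = R[B].polynomialRing
    PBC : CommutativeRing a ℓ
    PBC = R[B,C].polynomialRing
    module PBC = CommutativeRing PBC
    module QE = QuadraticExtension PBC Bi.B Bi.C

  Q : CommutativeRing a ℓ
  Q = QE.quadraticExtension

  private
    module Q = CommutativeRing Q
    module ExpQ = Exp Q.commutativeSemiring

    scalar : R.Carrier → Q.Carrier
    scalar x = QE.ι (R[B,C].const (R[B].const x))

    scalar-isHom : IsHom R Q scalar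
    scalar-isHom = Composition.isRingHomomorphism (λ {x} {y} {z} → Q.trans {x} {y} {z})
      (Composition.isRingHomomorphism (λ {x} {y} {z} → PBC.trans {x} {y} {z}) R[B].const-isHom R[B,C].const-isHom) QE.ι-isHom

    β-root : Bi.β Q.* Bi.β Q.+ QE.ι Bi.B Q.* Bi.β Q.+ QE.ι Bi.C Q.≈ Q.0#
    β-root = PowerSums.other-root Q (QE.ι Bi.B) (QE.ι Bi.C) Bi.α Bi.β QE.root₁-root QE.root₂≈

  Φʰᵒᵐ≈ : ∀ n → Bi.Φʰᵒᵐ n Q.≈ CyclotomicOver.Φʰ Q n Bi.α Bi.β
  Φʰᵒᵐ≈ n = RootRing.sum-Φʰ R Q scalar-isHom n Bi.α Bi.β

  lucasV≈ : ∀ n → QE.ι (Bi.lucasV n) Q.≈ Bi.α ExpQ.^ n Q.+ Bi.β ExpQ.^ n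
  lucasV≈ = RootRing.lucasV-power-sum R Q QE.ι-isHom Bi.α Bi.β QE.root₁-root QE.root₂≈

  private
    -- The endomorphism that fixes `R[B,C]` and exchanges `α` and `β`; it exists because `β` is a
    -- root too.
    conj : Q.Carrier → Q.Carrier
    conj = QE.adjoin Q QE.ι Bi.β

    conj-isHom : IsHom Q Q conj
    conj-isHom = QE.adjoin-isHom Q QE.ι-isHom Bi.β β-root

    Φʰ-conj : ∀ n → 2 ≤ n → conj (Bi.Φʰᵒᵐ n) Q.≈ Bi.Φʰᵒᵐ n
    Φʰ-conj n 2≤n = RootRing.Φʰ-conjugation R Q conj-isHom n 2≤n (Bi.Φʰᵒᵐ n) Bi.α Bi.β (Φʰᵒᵐ≈ n)
      (QE.adjoin-root₁ Q QE.ι-isHom Bi.β)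
      (PowerSums.conjugate-involutive Q (QE.ι Bi.B) Bi.α Bi.β (conj Bi.β) QE.root₂≈
        (QE.adjoin-root₂ Q QE.ι-isHom Bi.β))

  module _ (halve : ∀ x → x R.+ x R.≈ R.0# → x R.≈ R.0#) where

    -- Write `Φʰᵒᵐ n = u + v α`. It is fixed by `conj`, and as `β = - B - α`, its image has second
    -- component `- v`. So `v + v = 0`, and `halve` gives `v = 0`.
    lucasAtom-isLucasAtom : ∀ n → 2 ≤ n → Bi.IsLucasAtom n (Bi.lucasAtom n)
    lucasAtom-isLucasAtom (suc zero)    (s≤s ())
    lucasAtom-isLucasAtom (suc (suc n)) 2≤n = PBC.refl {proj₁ (Bi.Φʰᵒᵐ N)} , λ i j → R.sym (v≈0 i j)
      where
      N : ℕ
      N = suc (suc n)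
      v : PBC.Carrier
      v = proj₂ (Bi.Φʰᵒᵐ N)
      second : proj₂ (conj (Bi.Φʰᵒᵐ N)) PBC.≈ PBC.- v
      second = simplify PBC Bi.B v
        where
        simplify : ∀ {a ℓ} (S : CommutativeRing a ℓ) → let open CommutativeRing S in
          ∀ b v → 0# + (v * - 1# + 0# * - b + - (b * (0# * - 1#))) ≈ - v
        simplify S b v = solve 2 (λ b v → con (+ 0) :+ (v :* :- con (+ 1) :+ con (+ 0) :* :- b :+
          :- (b :* (con (+ 0) :* :- con (+ 1)))) := :- v) (CommutativeRing.refl S) b v
          where
          open Integers S using (module RingSolver)
          open RingSolver using (solve; _:=_; _:+_; _:*_; :-_; con)
      v≈0 : v PBC.≈ PBC.0#
      v≈0 = PowerSums.halve⇒-x≈x⇒x≈0 PBC halve² v (proj₂ (conj (Bi.Φʰᵒᵐ N))) (proj₂ (Φʰ-conj N 2≤n)) second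
        where
        halve² : ∀ f → f PBC.+ f PBC.≈ PBC.0# → f PBC.≈ PBC.0#
        halve² f f+f≈0 i j = halve _ (R.trans (R.sym (R[B].!-+ (f R[B,C].! i) (f R[B,C].! i) j))
          (R.trans (R.sym (R[B,C].!-+ f f i j)) (f+f≈0 i j)))

-- Specialisation at C = c, then at B = b

module Specialised {a ℓ} (R : CommutativeRing a ℓ) (c : CommutativeRing.Carrier R) where

  private
    module R = CommutativeRing R
    module R[B] = Evaluation R
    module R[B,C] = Evaluation R[B].polynomialRing
    module Bi = Bivariate R.rawRing
    PB : CommutativeRing a ℓ
    PB = R[B].polynomialRing
    PBC : CommutativeRing a ℓ
    PBC = R[B,C].polynomialRing
    module PBC = CommutativeRing PBC
    module PB = CommutativeRing PB
    module QE = QuadraticExtension PBC Bi.B Bi.C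
    open Lucas R using (Q)
    module Q = CommutativeRing Q
  open QuadraticExtension PB R[B].X (R[B].const c) public

  -- The ring of the two generic roots after `C = c`. The map `σ` leads into it from `Q`, and `τ`
  -- leads out of it into any ring `S` over `R` with a root `γ` of `X² + b X + c`.
  T : CommutativeRing a ℓ
  T = quadraticExtension

  private
    module T = CommutativeRing T
    module ExpT = Exp T.commutativeSemiring

    at-c : PBC.Carrier → PB.Carrier
    at-c f = Bi.specialise f c

    at-c-isHom : IsHom PBC PB at-c
    at-c-isHom = R[B,C].eval-isHom (R[B].const c)

    θ : PBC.Carrier → T.Carrier
    θ f = ι (at-c f)

    θ-isHom : IsHom PBC T θ
    θ-isHom = Composition.isRingHomomorphism (λ {x} {y} {z} → T.trans {x} {y} {z}) at-c-isHom ι-isHom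

    root₁-θ : root₁ T.* root₁ T.+ θ Bi.B T.* root₁ T.+ θ Bi.C T.≈ T.0#
    root₁-θ = PowerSums.root-resp T root₁ (ι R[B].X) (θ Bi.B) (ι (R[B].const c)) (θ Bi.C)
      (IsHom.⟦⟧-cong PB T ι-isHom {R[B].X} {at-c Bi.B} (λ i → R.sym (R[B,C].eval-const R[B].X (R[B].const c) i)))
      (IsHom.⟦⟧-cong PB T ι-isHom {R[B].const c} {at-c Bi.C} (λ i → R.sym (R[B,C].eval-X (R[B].const c) i)))
      root₁-root

    σ : Q.Carrier → T.Carrier
    σ = QE.adjoin T θ root₁

    σ-isHom : IsHom Q T σ
    σ-isHom = QE.adjoin-isHom T θ-isHom root₁ root₁-θ

    σ-ι : ∀ f → σ (QE.ι f) T.≈ ι (at-c f)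
    σ-ι f = QE.adjoin-ι T θ-isHom root₁ f

    σ-α : σ Bi.α T.≈ root₁
    σ-α = QE.adjoin-root₁ T θ-isHom root₁

    σ-β : σ Bi.β T.≈ root₂
    σ-β = PowerSums.conjugate-unique T (θ Bi.B) (ι R[B].X) root₁ (σ Bi.β) root₂
      (IsHom.⟦⟧-cong PB T ι-isHom {at-c Bi.B} {R[B].X} (R[B,C].eval-const R[B].X (R[B].const c)))
      (QE.adjoin-root₂ T θ-isHom root₁) root₂≈

  specialise-lucasAtom : ∀ n Λ → Bi.IsLucasAtom n Λ → ι (at-c Λ) T.≈ CyclotomicOver.Φʰ T n root₁ root₂
  specialise-lucasAtom n Λ isAtom = begin
    ι (at-c Λ)                                 ≈⟨ σ-ι Λ ⟨
    σ (QE.ι Λ)                                 ≈⟨ transport-Φʰ Q T σ-isHom n (QE.ι Λ) Bi.α Bi.β root₁ root₂ atom≈ σ-α σ-β ⟩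
    CyclotomicOver.Φʰ T n root₁ root₂          ∎
    where
    open SetoidReasoning T.setoid
    atom≈ : QE.ι Λ Q.≈ CyclotomicOver.Φʰ Q n Bi.α Bi.β
    atom≈ = Q.trans {QE.ι Λ} {Bi.Φʰᵒᵐ n} {CyclotomicOver.Φʰ Q n Bi.α Bi.β} isAtom (Lucas.Φʰᵒᵐ≈ R n)

  specialise-lucasV : ∀ n → ι (at-c (Bi.lucasV n)) T.≈ root₁ ExpT.^ n T.+ root₂ ExpT.^ n
  specialise-lucasV n = begin
    ι (at-c (Bi.lucasV n))                     ≈⟨ σ-ι (Bi.lucasV n) ⟨
    σ (QE.ι (Bi.lucasV n))                     ≈⟨ transport-power-sum Q T σ-isHom n (QE.ι (Bi.lucasV n)) Bi.α Bi.β root₁ root₂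
                                                    (Lucas.lucasV≈ R n) σ-α σ-β ⟩
    root₁ ExpT.^ n T.+ root₂ ExpT.^ n          ∎
    where open SetoidReasoning T.setoid

  module _ {e m} (S : CommutativeRing e m) (ψ : R.Carrier → CommutativeRing.Carrier S) (ψ-isHom : IsHom R S ψ)
    (b : R.Carrier) (γ : CommutativeRing.Carrier S) where

    private
      module S = CommutativeRing S
      module S[X] = Evaluation S
      module ExpS = Exp S.commutativeSemiring

      at-b : PB.Carrier → S.Carrier
      at-b f = S[X].eval (map ψ f) (ψ b)

      at-b-isHom : IsHom PB S at-b
      at-b-isHom = Composition.isRingHomomorphism S.trans (MapHom.map-isHom R S ψ-isHom) (S[X].eval-isHom (ψ b))

      at-b≈ : ∀ f → at-b f S.≈ ψ (R[B].eval f b)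
      at-b≈ f = S.sym (MapHom.eval-map R S ψ-isHom f b)

      at-b-X : at-b R[B].X S.≈ ψ b
      at-b-X = S.trans (at-b≈ R[B].X) (IsHom.⟦⟧-cong R S ψ-isHom (R[B].eval-X b))

      at-b-const : at-b (R[B].const c) S.≈ ψ c
      at-b-const = S.trans (at-b≈ (R[B].const c)) (IsHom.⟦⟧-cong R S ψ-isHom (R[B].eval-const c b))

    module _ (γ-root : γ S.* γ S.+ ψ b S.* γ S.+ ψ c S.≈ S.0#) where

      private
        τ : T.Carrier → S.Carrier
        τ = adjoin S at-b γ

        τ-isHom : IsHom T S τ
        τ-isHom = adjoin-isHom S at-b-isHom γ
          (PowerSums.root-resp S γ (ψ b) (at-b R[B].X) (ψ c) (at-b (R[B].const c)) (S.sym at-b-X) (S.sym at-b-const) γ-root)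

        τ-ι : ∀ f → τ (ι f) S.≈ ψ (R[B].eval f b)
        τ-ι f = S.trans (adjoin-ι S at-b-isHom γ f) (at-b≈ f)

        δ : S.Carrier
        δ = S.- ψ b S.+ S.- γ

        τ-root₁ : τ root₁ S.≈ γ
        τ-root₁ = adjoin-root₁ S at-b-isHom γ

        τ-root₂ : τ root₂ S.≈ δ
        τ-root₂ = S.trans (adjoin-root₂ S at-b-isHom γ) (S.+-congʳ (S.-‿cong at-b-X))

      -- The value at `b` lies in `R` while the root `γ` may lie in a larger ring `S`. Quadratics
      -- with a root use `S = R` (for `eval-lucasV`), the others an extension field.
      eval-lucasAtom : ∀ n Λ → Bi.IsLucasAtom n Λ → ψ (R[B].eval (Bi.specialise Λ c) b) S.≈ CyclotomicOver.Φʰ S n γ δ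
      eval-lucasAtom n Λ isAtom = S.trans (S.sym (τ-ι (at-c Λ)))
        (transport-Φʰ T S τ-isHom n (ι (at-c Λ)) root₁ root₂ γ δ (specialise-lucasAtom n Λ isAtom) τ-root₁ τ-root₂)

      eval-lucasV : ∀ n → ψ (R[B].eval (Bi.specialise (Bi.lucasV n) c) b) S.≈ γ ExpS.^ n S.+ δ ExpS.^ n
      eval-lucasV n = S.trans (S.sym (τ-ι (at-c (Bi.lucasV n))))
        (transport-power-sum T S τ-isHom n (ι (at-c (Bi.lucasV n))) root₁ root₂ γ δ (specialise-lucasV n) τ-root₁ τ-root₂)

-- Degrees and leading coefficients in B

module GradedIdentities {a ℓ} (R : CommutativeRing a ℓ) where

  open CommutativeRing R
  open Integers R using (module RingSolver)
  open RingSolver using (solve; _:=_; _:+_; _:*_; :-_)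

  shift-product : ∀ x v v′ → (x * v) * (x * v′) ≈ x * (x * (v * v′))
  shift-product = solve 3 (λ x v v′ → (x :* v) :* (x :* v′) := x :* (x :* (v :* v′))) refl

  shift-second : ∀ x u v u′ v′ → x * (u * v′ + v * u′ + - (x * (v * v′))) ≈
    u * (x * v′) + (x * v) * u′ + - ((x * v) * (x * v′))
  shift-second = solve 5 (λ x u v u′ v′ → x :* (u :* v′ :+ v :* u′ :+ :- (x :* (v :* v′))) :=
    u :* (x :* v′) :+ (x :* v) :* u′ :+ :- ((x :* v) :* (x :* v′))) refl

-- These rules suffice to read off the leading term of a binary form or a power sum from those of
-- its two arguments, both of weight 1.
record LeadingTermSystem {a ℓ e m} (R : CommutativeRing a ℓ) (T : CommutativeRing e m) : Set (a ⊔ ℓ ⊔ e ⊔ m ⊔ Level.suc ℓ) where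

  private
    module R = CommutativeRing R
    module T = CommutativeRing T

  field
    HasLeadingTerm : T.Carrier → ℕ → R.Carrier → Set ℓ
    leading-resp   : ∀ {z z′ n x} → z T.≈ z′ → HasLeadingTerm z n x → HasLeadingTerm z′ n x
    leading-0      : ∀ n → HasLeadingTerm T.0# n R.0#
    leading-+      : ∀ {z z′ n x x′} → HasLeadingTerm z n x → HasLeadingTerm z′ n x′ →
                     HasLeadingTerm (z T.+ z′) n (x R.+ x′)
    leading-*      : ∀ {z z′ k n x x′} → HasLeadingTerm z k x → HasLeadingTerm z′ n x′ →
                     HasLeadingTerm (z T.* z′) (k ℕ.+ n) (x R.* x′)
    scalar         : R.Carrier → T.Carrier
    scalar-isHom   : IsHom R T scalar
    leading-scalar : ∀ x → HasLeadingTerm (scalar x) 0 x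

  private
    module T[X] = Evaluation T
    module R[X] = Evaluation R
    module ExpT = Exp T.commutativeSemiring
    module ExpR = Exp R.commutativeSemiring

  leading-^ : ∀ {z x} n → HasLeadingTerm z 1 x → HasLeadingTerm (z ExpT.^ n) n (x ExpR.^ n)
  leading-^ zero    h = leading-resp (RingMorphisms.IsRingHomomorphism.1#-homo scalar-isHom) (leading-scalar R.1#)
  leading-^ (suc n) h = leading-* h (leading-^ n h)

  leading-homogenize : ∀ n f {z w x y} → HasLeadingTerm z 1 x → HasLeadingTerm w 1 y →
    HasLeadingTerm (T[X].homogenize n (map scalar f) z w) n (R[X].homogenize n f x y)
  leading-homogenize n       []      h h′ = leading-0 n
  leading-homogenize zero    (u ∷ f) h h′ = leading-scalar u
  leading-homogenize (suc n) (u ∷ f) h h′ = leading-+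
    (leading-* (leading-scalar u) (leading-^ (suc n) h′)) (leading-* h (leading-homogenize n f h h′))

  leading-Φʰ : ∀ n t z w {x y} → t T.≈ CyclotomicOver.Φʰ T n z w → HasLeadingTerm z 1 x → HasLeadingTerm w 1 y →
    HasLeadingTerm t (φ n) (CyclotomicOver.Φʰ R n x y)
  leading-Φʰ n t z w t≈ h h′ = leading-resp
    (T.trans (T[X].homogenize-cong (φ n) (map scalar (CyclotomicOver.Φ R n)) (CyclotomicOver.Φ T n)
      (CyclotomicMap.map-Φ R T scalar-isHom n) T.refl T.refl) (T.sym t≈))
    (leading-homogenize (φ n) (CyclotomicOver.Φ R n) h h′)

  leading-power-sum : ∀ n t z w {x y} → t T.≈ z ExpT.^ n T.+ w ExpT.^ n → HasLeadingTerm z 1 x → HasLeadingTerm w 1 y →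
    HasLeadingTerm t n (x ExpR.^ n R.+ y ExpR.^ n)
  leading-power-sum n t z w t≈ h h′ = leading-resp (T.sym t≈) (leading-+ (leading-^ n h) (leading-^ n h′))

module LeadingTerms {a ℓ} (R : CommutativeRing a ℓ) (c : CommutativeRing.Carrier R) where

  open CommutativeRing R
  open Evaluation R
  open Reciprocal R using (X-*)
  open Specialised R c
  open AbelianGroupProperties +-abelianGroup using (ε⁻¹≈ε)
  private
    module P = CommutativeRing polynomialRing
    module T = CommutativeRing T
    module G = GradedIdentities polynomialRing
  open Exp commutativeSemiring using (_^_)

  -- In F[B][T] / (T² + B T + c) give B and T weight 1 and c weight 0;
  -- u + v T then has weight at most m when u and B v have degree at
  -- most m.  Taking the coefficient of B^m in u amounts to reducing the
  -- top weight part T (T + B) = 0 modulo T, so it is multiplicative.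
  record HasLeadingTerm (z : T.Carrier) (m : ℕ) (x : Carrier) : Set ℓ where
    constructor leading
    field
      degree₁ : DegreeAtMost (proj₁ z) m
      degree₂ : DegreeAtMost (X *ₚ proj₂ z) m
      lead    : proj₁ z ! m ≈ x

  private
    X*-cong : ∀ v v′ → v ≈ₚ v′ → X *ₚ v ≈ₚ X *ₚ v′
    X*-cong v v′ v≈ = P.*-cong {X} {X} {v} {v′} (λ _ → refl) v≈

    X*[] : X *ₚ [] ≈ₚ []
    X*[] = P.zeroʳ X

  leading-resp : ∀ z z′ {m x} → z T.≈ z′ → HasLeadingTerm z m x → HasLeadingTerm z′ m x
  leading-resp (u , v) (u′ , v′) (u≈ , v≈) (leading du dv lead) = leading
    (DegreeAtMost-resp u u′ u≈ du) (DegreeAtMost-resp (X *ₚ v) (X *ₚ v′) (X*-cong v v′ v≈) dv)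
    (trans (sym (u≈ _)) lead)

  leading-+ : ∀ z z′ {m x x′} → HasLeadingTerm z m x → HasLeadingTerm z′ m x′ → HasLeadingTerm (z T.+ z′) m (x + x′)
  leading-+ (u , v) (u′ , v′) {m} (leading du dv lead) (leading du′ dv′ lead′) = leading
    (DegreeAtMost-+ u u′ du du′)
    (DegreeAtMost-resp (X *ₚ v +ₚ X *ₚ v′) (X *ₚ (v +ₚ v′)) (λ i → sym (P.distribˡ X v v′ i))
      (DegreeAtMost-+ (X *ₚ v) (X *ₚ v′) dv dv′))
    (trans (!-+ u u′ m) (+-cong lead lead′))

  leading-* : ∀ z z′ {m n x x′} → HasLeadingTerm z m x → HasLeadingTerm z′ n x′ →
    HasLeadingTerm (z T.* z′) (m ℕ.+ n) (x * x′)
  leading-* (u , v) (u′ , v′) {m} {n} (leading du dv lead) (leading du′ dv′ lead′) = leading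
    (DegreeAtMost-+ (u *ₚ u′) (-ₚ (const c *ₚ (v *ₚ v′))) (DegreeAtMost-* u u′ du du′)
      (λ k l → -cvv′-small k (ℕ.<⇒≤ l)))
    (DegreeAtMost-resp second (X *ₚ (u *ₚ v′ +ₚ v *ₚ u′ +ₚ -ₚ (X *ₚ (v *ₚ v′))))
      (λ i → sym (G.shift-second X u v u′ v′ i))
      (DegreeAtMost-+ (u *ₚ (X *ₚ v′) +ₚ (X *ₚ v) *ₚ u′) (-ₚ ((X *ₚ v) *ₚ (X *ₚ v′)))
        (DegreeAtMost-+ (u *ₚ (X *ₚ v′)) ((X *ₚ v) *ₚ u′) (DegreeAtMost-* u (X *ₚ v′) du dv′) (DegreeAtMost-* (X *ₚ v) u′ dv du′))
        (DegreeAtMost-neg ((X *ₚ v) *ₚ (X *ₚ v′)) (DegreeAtMost-* (X *ₚ v) (X *ₚ v′) dv dv′))))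
    (trans (!-+ (u *ₚ u′) (-ₚ (const c *ₚ (v *ₚ v′))) (m ℕ.+ n))
      (trans (+-cong (trans (!-top u u′ du du′) (*-cong lead lead′)) (-cvv′-small (m ℕ.+ n) ℕ.≤-refl)) (+-identityʳ _)))
    where
    second : List Carrier
    second = u *ₚ (X *ₚ v′) +ₚ (X *ₚ v) *ₚ u′ +ₚ -ₚ ((X *ₚ v) *ₚ (X *ₚ v′))
    -- `(X v) (X v′) = X² v v′` has degree at most `m + n`, so `v v′` has degree below `m + n`.
    -- Hence the term `c v v′` of the product does not reach the leading coefficient.
    vv′-small : ∀ i → m ℕ.+ n ≤ i → (v *ₚ v′) ! i ≈ 0#
    vv′-small i l = trans (sym (X-* (v *ₚ v′) (suc i))) (trans (sym (X-* (X *ₚ (v *ₚ v′)) (suc (suc i))))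
      (trans (sym (G.shift-product X v v′ (suc (suc i))))
        (DegreeAtMost-* (X *ₚ v) (X *ₚ v′) dv dv′ (suc (suc i)) (s≤s (ℕ.m≤n⇒m≤1+n l)))))
    -cvv′-small : ∀ i → m ℕ.+ n ≤ i → (-ₚ (const c *ₚ (v *ₚ v′))) ! i ≈ 0#
    -cvv′-small i l = trans (!-neg (const c *ₚ (v *ₚ v′)) i) (trans (-‿cong (trans (!-*-∷ c [] (v *ₚ v′) i)
      (trans (+-cong (trans (*-congˡ (vv′-small i l)) (zeroʳ c)) (shift-0 {[]} (λ _ → refl) i)) (+-identityʳ 0#)))) ε⁻¹≈ε)

  leading-0 : ∀ n → HasLeadingTerm T.0# n 0#
  leading-0 n = leading (λ _ _ → refl) (λ k _ → X*[] k) refl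

  scalar : Carrier → T.Carrier
  scalar x = ι (const x)

  scalar-isHom : IsHom R T scalar
  scalar-isHom = Composition.isRingHomomorphism (λ {x} {y} {z} → T.trans {x} {y} {z}) const-isHom ι-isHom

  leading-scalar : ∀ x → HasLeadingTerm (scalar x) 0 x
  leading-scalar x = leading (λ { (suc k) _ → refl }) (λ k _ → X*[] k) refl

  leadingTermSystem : LeadingTermSystem R T
  leadingTermSystem = record
    { HasLeadingTerm = HasLeadingTerm
    ; leading-resp   = λ {z} {z′} → leading-resp z z′
    ; leading-0      = leading-0
    ; leading-+      = λ {z} {z′} → leading-+ z z′
    ; leading-*      = λ {z} {z′} → leading-* z z′
    ; scalar         = scalar
    ; scalar-isHom   = scalar-isHom
    ; leading-scalar = leading-scalar
    }

  -- Modulo `T` the roots `T` and `- B - T` become 0 and `- B`: hence the coefficient 0 here and -1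
  -- for `root₂`.
  leading-root₁ : HasLeadingTerm root₁ 1 0#
  leading-root₁ = leading (λ _ _ → refl) (λ k l → trans (X-* P.1# k) (above k l)) refl
    where
    above : DegreeAtMost (0# ∷ P.1#) 1
    above (suc (suc k)) _ = refl
    above (suc zero) (s≤s ())

  leading-root₂ : HasLeadingTerm root₂ 1 (- 1#)
  leading-root₂ = leading first (λ k l → trans (X-* (-ₚ P.1#) k) (above k l)) refl
    where
    first : DegreeAtMost (-ₚ X) 1
    first (suc (suc k)) _ = refl
    first (suc zero) (s≤s ())
    above : DegreeAtMost (0# ∷ (-ₚ P.1#)) 1
    above (suc (suc k)) _ = refl
    above (suc zero) (s≤s ())

  private
    module Bi = Bivariate rawRing
    module System = LeadingTermSystem leadingTermSystem

  lucasAtom-leading : ∀ n Λ → Bi.IsLucasAtom n Λ →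
    HasLeadingTerm (ι (Bi.specialise Λ c)) (φ n) (CyclotomicOver.Φʰ R n 0# (- 1#))
  lucasAtom-leading n Λ isAtom = System.leading-Φʰ n (ι (Bi.specialise Λ c)) root₁ root₂
    (specialise-lucasAtom n Λ isAtom) leading-root₁ leading-root₂

  lucasV-leading : ∀ n → HasLeadingTerm (ι (Bi.specialise (Bi.lucasV n) c)) n (0# ^ n + (- 1#) ^ n)
  lucasV-leading n = System.leading-power-sum n (ι (Bi.specialise (Bi.lucasV n) c)) root₁ root₂
    (specialise-lucasV n) leading-root₁ leading-root₂

-- Identities for quadratics and signs

module QuadraticIdentities {a ℓ} (R : CommutativeRing a ℓ) where

  open CommutativeRing R
  open Integers R using (module RingSolver)
  open RingSolver using (solve; _:=_; _:+_; _:*_; :-_; con)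

  -- The leading coefficient is a variable because mapping `quadratic b c` along an embedding puts
  -- the image of 1 there, which is only `≈` to 1.
  quadratic-eval : ∀ b c o x → o ≈ 1# → c + x * (b + x * (o + x * 0#)) ≈ x * x + b * x + c
  quadratic-eval b c o x o≈1 = trans (+-congˡ (*-congˡ (+-congˡ (*-congˡ (+-congʳ o≈1)))))
    (solve 3 (λ b c x → c :+ x :* (b :+ x :* (con (+ 1) :+ x :* con (+ 0))) := x :* x :+ b :* x :+ c) refl b c x)

  drop-0 : ∀ x y → x + - (y * 0#) ≈ x
  drop-0 = solve 2 (λ x y → x :+ :- (y :* con (+ 0)) := x) refl

  -- `x = x (1 + 2 k) - (x + x) k`. The hypothesis is `q · 1 = 0` for `q = 1 + 2 m`, in the shape to
  -- which it unfolds.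
  halve-by : ∀ x k → 1# + (1# + (1# + 0#)) * k ≈ 0# → x + x ≈ 0# → x ≈ 0#
  halve-by x k 1+2k≈0 x+x≈0 = trans
    (solve 2 (λ x k → x := x :* (con (+ 1) :+ (con (+ 1) :+ (con (+ 1) :+ con (+ 0))) :* k) :+ :- ((x :+ x) :* k)) refl x k)
    (trans (+-cong (trans (*-congˡ 1+2k≈0) (zeroʳ x)) (-‿cong (trans (*-congʳ x+x≈0) (zeroˡ k))))
      (-‿inverseʳ 0#))

  neg-*-neg : ∀ x → (- 1#) * x ≈ - x
  neg-*-neg = solve 1 (λ x → :- con (+ 1) :* x := :- x) refl

  cofactor-resp : ∀ l f w s v → l ≈ f → f * w ≈ s → v ≈ s → l * w ≈ v
  cofactor-resp l f w s v l≈ fw≈ v≈ = trans (*-congʳ l≈) (trans fw≈ (sym v≈))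

  -- The value of `u + v X` at `root₁`, unfolded in the extension. Together with `second-component`
  -- it shows that no monic polynomial of degree below 2 vanishes at `root₁`.
  first-component : ∀ b c u v → v ≈ 0# →
    u + (0# * (v + (0# * 0# + - (c * (1# * 0#)))) + - (c * (1# * (0# + (0# * 0# + 1# * 0# + - (b * (1# * 0#))))))) ≈ u
  first-component b c u v v≈0 = solve 4 (λ b c u v →
    u :+ (con (+ 0) :* (v :+ (con (+ 0) :* con (+ 0) :+ :- (c :* (con (+ 1) :* con (+ 0))))) :+
      :- (c :* (con (+ 1) :* (con (+ 0) :+ (con (+ 0) :* con (+ 0) :+ con (+ 1) :* con (+ 0) :+ :- (b :* (con (+ 1) :* con (+ 0)))))))) := u)
    refl b c u v

  second-component : ∀ b c v →
    0# + (0# * (0# + (0# * 0# + 1# * 0# + - (b * (1# * 0#)))) + 1# * (v + (0# * 0# + - (c * (1# * 0#)))) +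
      - (b * (1# * (0# + (0# * 0# + 1# * 0# + - (b * (1# * 0#))))))) ≈ v
  second-component b c v = solve 3 (λ b c v →
    con (+ 0) :+ (con (+ 0) :* (con (+ 0) :+ (con (+ 0) :* con (+ 0) :+ con (+ 1) :* con (+ 0) :+ :- (b :* (con (+ 1) :* con (+ 0))))) :+
      con (+ 1) :* (v :+ (con (+ 0) :* con (+ 0) :+ :- (c :* (con (+ 1) :* con (+ 0))))) :+
      :- (b :* (con (+ 1) :* (con (+ 0) :+ (con (+ 0) :* con (+ 0) :+ con (+ 1) :* con (+ 0) :+ :- (b :* (con (+ 1) :* con (+ 0)))))))) := v)
    refl b c v

-- Fields of odd order

2*suc : ∀ m → suc (suc (2 ℕ.* m)) ≡ 2 ℕ.* suc m
2*suc m = ≡.cong suc (≡.sym (ℕ.+-suc m (m ℕ.+ 0)))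

module OddCardinality {a ℓ q} (F : FiniteField a ℓ q) (m : ℕ) (q≡ : q ≡ suc (2 ℕ.* m)) where

  private
    R : CommutativeRing a ℓ
    R = FiniteField.commutativeRing F
    module F = FiniteField F
    N : ℕ
    N = suc q
  open CommutativeRing R
  open Enumerated F
  open Field R isDiscreteField
  open Evaluation R
  open Exp commutativeSemiring using (_^_; ^-congˡ; ^-congʳ; ^-homo-*; ^-distrib-*)
  open Mult semiring using () renaming (_×_ to _·_)
  open UniqueSetoid setoid using (Unique)
  open Membership setoid using (_∈_)

  N≡ : N ≡ 2 ℕ.* suc m
  N≡ = ≡.trans (≡.cong suc q≡) (2*suc m)

  1≤m : 1 ≤ m
  1≤m = positive m (≡.subst (1 <_) q≡ card>1)
    where
    positive : ∀ k → 1 < suc (2 ℕ.* k) → 1 ≤ k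
    positive zero    (s≤s ())
    positive (suc k) _ = s≤s z≤n

  q-1≡ : q ∸ 1 ≡ 2 ℕ.* m
  q-1≡ = ≡.cong ℕ.pred q≡

  2≤N : 2 ≤ N
  2≤N = s≤s (ℕ.<⇒≤ card>1)

  halve : ∀ x → x + x ≈ 0# → x ≈ 0#
  halve x = QuadraticIdentities.halve-by R x (m · 1#) (trans (+-congˡ (sym (Mult.×1-homo-* semiring 2 m)))
    (trans (Mult.×-congˡ semiring {1#} (≡.sym q≡)) card·1≈0))

  N·1≈1 : N · 1# ≈ 1#
  N·1≈1 = trans (+-congˡ card·1≈0) (+-identityʳ 1#)

  P-isLucasAtom : F.IsLucasAtom N (F.P q)
  P-isLucasAtom = subst-suc q card>1
    where
    subst-suc : ∀ k → 1 < k → F.IsLucasAtom (suc k) (F.P k)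
    subst-suc (suc k) _ = Lucas.lucasAtom-isLucasAtom R halve (suc (suc k)) (s≤s (s≤s z≤n))

  -- Since `q · 1 = 0`, the number `N = q + 1` acts as 1, so its divisors are units. This is the
  -- separability of `X^N - 1`, and it is what makes a root of `Φ_N` have exact order `N`.
  divisor·1≉0 : ∀ {e ε} (S : CommutativeRing e ε) → let module S = CommutativeRing S in
    ∀ {θ} → IsHom R S θ → S.1# S.≉ S.0# → ∀ k g → N ≡ k ℕ.* g → Mult._×_ S.semiring k S.1# S.≉ S.0#
  divisor·1≉0 S {θ} h 1≉0 k g N≡kg k≈0 = 1≉0 (begin
    S.1#                              ≈⟨ S.trans (sym-1) (⟦⟧-cong (sym N·1≈1)) ⟩
    θ (N · 1#)                        ≈⟨ ×1-homo N ⟩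
    N ·ˢ S.1#                         ≈⟨ Mult.×-congˡ S.semiring {S.1#} N≡kg ⟩
    (k ℕ.* g) ·ˢ S.1#                 ≈⟨ Mult.×1-homo-* S.semiring k g ⟩
    (k ·ˢ S.1#) S.* (g ·ˢ S.1#)       ≈⟨ S.trans (S.*-congʳ k≈0) (S.zeroˡ _) ⟩
    S.0#                              ∎)
    where
    module S = CommutativeRing S
    open Mult S.semiring using () renaming (_×_ to _·ˢ_)
    open IsHom R S h
    open SetoidReasoning S.setoid
    sym-1 : S.1# S.≈ θ 1#
    sym-1 = S.sym 1#-homo

  id-isHom : IsHom R R (λ x → x)
  id-isHom = isHom R R (λ p → p) (λ _ _ → refl) (λ _ _ → refl) refl

  -- Φ_N is palindromic, so Φ_N(-1) = (-1)^φ(N) Φ_N(-1); and -1 is not a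
  -- root of Φ_N.
  [-1]^φN≈1 : (- 1#) ^ φ N ≈ 1#
  [-1]^φN≈1 = sym (*-cancelˡ z z≉0 (begin
    z * 1#                                       ≈⟨ *-identityʳ z ⟩
    C.Φʰ N (- 1#) 1#                             ≈⟨ C.Φʰ-swap N 2≤N (- 1#) 1# ⟩
    C.Φʰ N 1# (- 1#)                             ≈⟨ C.Φʰ-cong N -1*-1 (sym (*-identityʳ _)) ⟩
    C.Φʰ N (- 1# * - 1#) (- 1# * 1#)             ≈⟨ C.Φʰ-dilate N (s≤s z≤n) (- 1#) (- 1#) 1# ⟩
    (- 1#) ^ φ N * z                             ≈⟨ *-comm _ _ ⟩
    z * (- 1#) ^ φ N                             ∎))
    where
    module C = CyclotomicOver R
    open SetoidReasoning setoid
    open AbelianGroupProperties +-abelianGroup using (⁻¹-involutive)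
    z : Carrier
    z = C.Φʰ N (- 1#) 1#
    -1*-1 : 1# ≈ - 1# * - 1#
    -1*-1 = sym (trans (QuadraticIdentities.neg-*-neg R (- 1#)) (⁻¹-involutive 1#))
    2<N : 2 < N
    2<N = s≤s (≡.subst (2 ≤_) (≡.sym q≡) (s≤s (ℕ.≤-trans 1≤m (ℕ.m≤m+n m (m ℕ.+ 0)))))
    N≡m*2 : N ≡ suc m ℕ.* 2
    N≡m*2 = ≡.trans N≡ (ℕ.*-comm 2 (suc m))
    geo : ∃[ s ] eval (C.Φ N) (- 1#) * s ≈ Powers.geometric R ((- 1#) ^ 2) (suc m)
    geo = C.Φ-geometric N 2 (suc m) (s≤s z≤n) 2<N N≡m*2 (- 1#)
    z≉0 : z ≉ 0#
    z≉0 z≈0 = divisor·1≉0 R id-isHom F.1≉0 (suc m) 2 N≡m*2 (trans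
      (sym (Powers.geometric-1 R (suc m) (trans (*-congˡ (*-identityʳ _)) (sym -1*-1))))
      (trans (sym (proj₂ geo)) (trans (*-congʳ (trans (sym (C.Φʰ-1 N (s≤s z≤n) (- 1#))) z≈0)) (zeroˡ _))))

  hasRoots : ∀ f xs {n} → Unique xs → (∀ x → IsRoot f x → x ∈ xs) → length (filter (root? f) xs) ≡ n → F.HasRoots f n
  hasRoots f xs unique complete len = filter (root? f) xs , UniqueProperties.filter⁺ setoid (root? f) unique , len ,
    λ x → mk⇔ (λ x∈ → proj₂ (MembershipProperties.∈-filter⁻ setoid (root? f) resp {xs = xs} x∈))
               (λ r → MembershipProperties.∈-filter⁺ setoid (root? f) resp (complete x r) r)
    where
    resp : ∀ {x y} → x ≈ y → IsRoot f x → IsRoot f y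
    resp x≈y r = trans (sym (eval-cong f f (λ _ → refl) x≈y)) r

  -- Values of Lucas polynomials and atoms when the norm c is primitive

  module PrimitiveNorm (c : Carrier) (c-primitive : F.IsPrimitiveElement c) where

    open Primitive c-primitive
    Λ : List Carrier
    Λ = F.specialise (F.P q) c
    V : ℕ → List Carrier
    V n = F.specialise (F.lucasV n) c

    c≉0 : c ≉ 0#
    c≉0 = proj₁ c-primitive

    -- `c ^ m` squares to `c ^ (q - 1) = 1`, and it is not 1 because `order-≥` bounds the order of
    -- `c` below by `2 m`.
    c^m≈-1 : c ^ m ≈ - 1#
    c^m≈-1 = Sum.[ (λ c^m≈1 → contradiction (order-≥ m 1≤m c^m≈1) (ℕ.<⇒≱ suc-m<q)) , (λ p → p) ]′
      (x²≈1 (c ^ m) (trans (sym (^-homo-* c m m)) (trans (^-congʳ c (≡.trans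
        (≡.cong (m ℕ.+_) (≡.sym (ℕ.+-identityʳ m))) (≡.sym q-1≡))) gᵠ⁻¹≈1)))
      where
      suc-m<q : suc m < q
      suc-m<q = ≡.subst (suc m <_) (≡.sym q≡) (s≤s (ℕ.m<m+n m (ℕ.≤-trans 1≤m (ℕ.m≤m+n m 0))))

    r≉0 : ∀ r s → r * s ≈ c → r ≉ 0#
    r≉0 r s rs≈c r≈0 = c≉0 (trans (sym rs≈c) (trans (*-congʳ r≈0) (zeroˡ s)))

    r^m²≈1 : ∀ r s → r * s ≈ c → r ^ m * r ^ m ≈ 1#
    r^m²≈1 r s rs≈c = trans (sym (^-homo-* r m m)) (trans (^-congʳ r (≡.trans
      (≡.cong (m ℕ.+_) (≡.sym (ℕ.+-identityʳ m))) (≡.sym q-1≡))) (xᵠ⁻¹≈1 (r≉0 r s rs≈c)))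

    split-V-m : ∀ r s → r * s ≈ c → r ^ m + s ^ m ≈ 0#
    split-V-m r s rs≈c = *-cancelˡ (r ^ m) (≉0-^ m (r≉0 r s rs≈c)) (begin
      r ^ m * (r ^ m + s ^ m)             ≈⟨ distribˡ _ _ _ ⟩
      r ^ m * r ^ m + r ^ m * s ^ m       ≈⟨ +-cong (r^m²≈1 r s rs≈c) (trans (sym (^-distrib-* r s m)) (trans (^-congˡ m rs≈c) c^m≈-1)) ⟩
      1# + - 1#                           ≈⟨ -‿inverseʳ 1# ⟩
      0#                                  ≈⟨ zeroʳ _ ⟨
      r ^ m * 0#                          ∎)
      where open SetoidReasoning setoid

    -- Combined with `s ^ m = - r ^ m`, vanishing of the sum gives `r ^ m (r - s) = 0`, so `r = s`.
    -- Then `r ^ m + r ^ m = 0`, which `halve` excludes.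
    split-V-suc-m : ∀ r s → r * s ≈ c → r ^ suc m + s ^ suc m ≉ 0#
    split-V-suc-m r s rs≈c sum≈0 = ≉0-^ m (r≉0 r s rs≈c) (halve (r ^ m) (trans
      (+-congˡ (^-congˡ m r≈s)) (split-V-m r s rs≈c)))
      where
      open SetoidReasoning setoid
      open Integers R using (module RingSolver)
      open RingSolver using (solve; _:=_; _:+_; _:*_; :-_)
      open AbelianGroupProperties +-abelianGroup using (x∙y⁻¹≈ε⇒x≈y)
      r≈s : r ≈ s
      r≈s = Sum.[ (λ x≈0 → contradiction x≈0 (≉0-^ m (r≉0 r s rs≈c))) , x∙y⁻¹≈ε⇒x≈y r s ]′
        (domain (r ^ m) (r + - s) (begin
          r ^ m * (r + - s)
            ≈⟨ solve 4 (λ r s x y → x :* (r :+ :- s) := (r :* x :+ s :* y) :+ :- (s :* (x :+ y))) refl r s (r ^ m) (s ^ m) ⟩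
          (r * r ^ m + s * s ^ m) + - (s * (r ^ m + s ^ m))
            ≈⟨ +-cong sum≈0 (-‿cong (trans (*-congˡ (split-V-m r s rs≈c)) (zeroʳ s))) ⟩
          0# + - 0#
            ≈⟨ -‿inverseʳ 0# ⟩
          0#
            ∎))

    -- `S` is left open: it is the constructed quadratic extension when a root of `Λ` is shown to
    -- give a primitive polynomial, and an arbitrary extension of degree 2 in the converse.
    module InExtension {e ε} (S : CommutativeRing e ε) (S-isField : IsDiscreteField S)
      {θ : Carrier → CommutativeRing.Carrier S} (θ-isHom : IsHom R S θ)
      (θ-injective : ∀ {x y} → CommutativeRing._≈_ S (θ x) (θ y) → x ≈ y)
      (b : Carrier) (γ : CommutativeRing.Carrier S) where

      private
        module S = CommutativeRing S
        module SF = IsDiscreteField S-isField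
        module SField = Field S S-isField
        module ExpS = Exp S.commutativeSemiring
        module θ = IsHom R S θ-isHom
        module C = CyclotomicOver S
        module Fr = Frobenius F c-primitive S θ θ-isHom
        module PowS = Powers S

      θ-kernel : ∀ {x} → θ x S.≈ S.0# → x ≈ 0#
      θ-kernel θx≈0 = θ-injective (S.trans θx≈0 (S.sym θ.0#-homo))

      module _ (γ-root : γ S.* γ S.+ θ b S.* γ S.+ θ c S.≈ S.0#) where

        conj : S.Carrier
        conj = Fr.conjugate SF.domain SF.1≉0 b c γ γ-root

        new⇒γᵠ≈conj : (∀ x → ¬ γ S.≈ θ x) → γ ExpS.^ q S.≈ conj
        new⇒γᵠ≈conj new = Sum.[ (λ γᵠ≈γ → let x , γ≈ = Fr.frobenius-fixed SF.domain SF.1≉0 γ γᵠ≈γ in contradiction γ≈ (new x))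
          , (λ p → p) ]′ (Fr.γᵠ≈γ⊎conjugate SF.domain SF.1≉0 b c γ γ-root)

        V-vanishes : γ ExpS.^ q S.≈ conj → IsRoot (V (suc m)) b
        V-vanishes γᵠ≈ = θ-kernel (S.trans (Specialised.eval-lucasV R c S θ θ-isHom b γ γ-root (suc m))
          (Fr.half-power-sum SF.domain SF.1≉0 b c γ γ-root γᵠ≈ m q≡ c^m≈-1))

        private
          -- `γ ^ (q - 1)`, the quotient of the two roots when `γ ^ q` is the conjugate of `γ`.
          η : S.Carrier
          η = γ ExpS.^ (2 ℕ.* m)

          η^ : ∀ d → η ExpS.^ d S.≈ γ ExpS.^ (2 ℕ.* m ℕ.* d)
          η^ d = ExpS.^-assocʳ γ (2 ℕ.* m) d

        -- The roots are `γ` and `γ η`, so homogeneity extracts `γ ^ φ N`, and symmetry of the form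
        -- leaves `Φ_N` at `η`.
        evalΛ≈ : γ ExpS.^ q S.≈ conj → θ (eval Λ b) S.≈ γ ExpS.^ φ N S.* Evaluation.eval S (C.Φ N) η
        evalΛ≈ γᵠ≈ = begin
          θ (eval Λ b)                               ≈⟨ Specialised.eval-lucasAtom R c S θ θ-isHom b γ γ-root N (F.P q) P-isLucasAtom ⟩
          C.Φʰ N γ conj                              ≈⟨ C.Φʰ-cong N (S.sym (S.*-identityʳ γ)) (S.trans (S.sym γᵠ≈) (ExpS.^-congʳ γ q≡)) ⟩
          C.Φʰ N (γ S.* S.1#) (γ S.* η)              ≈⟨ C.Φʰ-dilate N (s≤s z≤n) γ S.1# η ⟩
          γ ExpS.^ φ N S.* C.Φʰ N S.1# η             ≈⟨ S.*-congˡ (S.trans (C.Φʰ-swap N 2≤N S.1# η) (C.Φʰ-1 N (s≤s z≤n) η)) ⟩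
          γ ExpS.^ φ N S.* Evaluation.eval S (C.Φ N) η ∎
          where open SetoidReasoning S.setoid

        Λ-vanishes : γ ExpS.^ q S.≈ conj → γ ExpS.^ (2 ℕ.* m ℕ.* N) S.≈ S.1# →
          (∀ d → 1 ≤ d → d < N → ¬ γ ExpS.^ (2 ℕ.* m ℕ.* d) S.≈ S.1#) → IsRoot Λ b
        Λ-vanishes γᵠ≈ one order = θ-kernel (S.trans (evalΛ≈ γᵠ≈) (S.trans (S.*-congˡ
          (C.Φ-root SF.domain SF.1≉0 N (s≤s z≤n) η (S.trans (η^ N) one)
            (λ d 1≤d d<N ηᵈ≈1 → order d 1≤d d<N (S.trans (S.sym (η^ d)) ηᵈ≈1)))) (S.zeroʳ _)))

        module _ (γ≉0 : γ S.≉ S.0#) (γᵠ≈ : γ ExpS.^ q S.≈ conj) (Λ-root : IsRoot Λ b) where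

          private
            Φη≈0 : Evaluation.eval S (C.Φ N) η S.≈ S.0#
            Φη≈0 = Sum.[ (λ z → contradiction z (SField.≉0-^ (φ N) γ≉0)) , (λ z → z) ]′
              (SF.domain (γ ExpS.^ φ N) (Evaluation.eval S (C.Φ N) η)
                (S.trans (S.sym (evalΛ≈ γᵠ≈)) (S.trans (θ.⟦⟧-cong Λ-root) θ.0#-homo)))

            vanish : ∀ {x} → x S.≈ S.1# → x S.+ S.- S.1# S.≈ S.0#
            vanish p = S.trans (S.+-congʳ p) (S.-‿inverseʳ S.1#)

            η^N-1≈0 : η ExpS.^ N S.+ S.- S.1# S.≈ S.0#
            η^N-1≈0 = S.trans (S.sym (proj₂ (C.Φ-∣ N (s≤s z≤n) η))) (S.trans (S.*-congʳ Φη≈0) (S.zeroˡ _))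

            -- For `g = gcd k N` one has `η ^ g = 1`. If `g < N` and `N = k′ g`, then `Φ_N (η) = 0`
            -- divides the geometric sum of `k′` powers of `η ^ g`, so `k′ · 1 = 0`, against
            -- `divisor·1≉0`.
            order-of-η : ∀ k → η ExpS.^ k S.≈ S.1# → N ∣ k
            order-of-η k ηᵏ≈1 = conclude (gcd[m,n]∣n k N)
              where
              g : ℕ
              g = gcd k N
              béz : ∃[ s ] ∃[ t ] s S.* (η ExpS.^ k S.+ S.- S.1#) S.+ t S.* (η ExpS.^ N S.+ S.- S.1#) S.≈ η ExpS.^ g S.+ S.- S.1#
              béz = PowS.^-1-bézout η (Bézout.identity (gcd-GCD k N))
              ηᵍ≈1 : η ExpS.^ g S.≈ S.1#
              ηᵍ≈1 = AbelianGroupProperties.x∙y⁻¹≈ε⇒x≈y S.+-abelianGroup (η ExpS.^ g) S.1#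
                (S.trans (S.sym (proj₂ (proj₂ béz))) (S.trans
                  (S.+-cong (S.trans (S.*-congˡ (vanish ηᵏ≈1)) (S.zeroʳ _)) (S.trans (S.*-congˡ η^N-1≈0) (S.zeroʳ _)))
                  (S.+-identityˡ S.0#)))
              conclude : g ∣ N → N ∣ k
              conclude (divides k′ N≡k′g) with ℕ.m≤n⇒m<n∨m≡n (Div.∣⇒≤ (gcd[m,n]∣n k N))
              ... | inj₂ g≡N = ≡.subst (_∣ k) g≡N (gcd[m,n]∣m k N)
              ... | inj₁ g<N = contradiction (S.trans (S.sym (PowS.geometric-1 k′ ηᵍ≈1))
                (S.trans (S.sym (proj₂ geo)) (S.trans (S.*-congʳ Φη≈0) (S.zeroˡ _))))
                (divisor·1≉0 S θ-isHom SF.1≉0 k′ g N≡k′g)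
                where
                1≤g : 1 ≤ g
                1≤g = ℕ.n≢0⇒n>0 (λ g≡0 → ℕ.0≢1+n (≡.sym (≡.trans N≡k′g (≡.trans (≡.cong (k′ ℕ.*_) g≡0) (ℕ.*-zeroʳ k′)))))
                geo : ∃[ s ] Evaluation.eval S (C.Φ N) η S.* s S.≈ PowS.geometric (η ExpS.^ g) k′
                geo = C.Φ-geometric N g k′ 1≤g g<N N≡k′g η

          -- `η ^ k = 1` gives `k = t N`. Then `c ^ t = γ ^ (N t) = 1`, so `q - 1 ≤ t`, and
          -- `(q - 1) (q + 1) + 1 = q²`.
          order-of-γ : ∀ k → 1 ≤ k → γ ExpS.^ k S.≈ S.1# → q ℕ.* q ≤ suc k
          order-of-γ k 1≤k γᵏ≈1 = conclude (order-of-η k (S.trans (η^ k) (S.trans (ExpS.^-congʳ γ (ℕ.*-comm (2 ℕ.* m) k))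
            (S.trans (S.sym (ExpS.^-assocʳ γ k (2 ℕ.* m))) (PowS.^≈1 (2 ℕ.* m) γᵏ≈1)))))
            where
            conclude : N ∣ k → q ℕ.* q ≤ suc k
            conclude (divides t k≡tN) = ℕ.≤-trans (ℕ.≤-reflexive square)
              (s≤s (ℕ.≤-trans (ℕ.*-monoˡ-≤ N 2m≤t) (ℕ.≤-reflexive (≡.sym k≡tN))))
              where
              1≤t : 1 ≤ t
              1≤t = ℕ.n≢0⇒n>0 (λ { ≡.refl → ℕ.m<n⇒n≢0 1≤k k≡tN })
              cᵗ≈1 : c ^ t ≈ 1#
              cᵗ≈1 = θ-injective (begin
                θ (c ^ t)                  ≈⟨ θ.^-homo c t ⟩
                θ c ExpS.^ t               ≈⟨ ExpS.^-congˡ t (Fr.γᵠ⁺¹≈c SF.domain SF.1≉0 b c γ γ-root γᵠ≈) ⟨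
                (γ ExpS.^ N) ExpS.^ t      ≈⟨ ExpS.^-assocʳ γ N t ⟩
                γ ExpS.^ (N ℕ.* t)         ≈⟨ ExpS.^-congʳ γ (≡.trans (ℕ.*-comm N t) (≡.sym k≡tN)) ⟩
                γ ExpS.^ k                 ≈⟨ γᵏ≈1 ⟩
                S.1#                       ≈⟨ θ.1#-homo ⟨
                θ 1#                       ∎)
                where open SetoidReasoning S.setoid
              2m≤t : 2 ℕ.* m ≤ t
              2m≤t = ℕ.s≤s⁻¹ (≡.subst (_≤ suc t) q≡ (order-≥ t 1≤t cᵗ≈1))
              square : q ℕ.* q ≡ suc (2 ℕ.* m ℕ.* N)
              square = ≡.subst (λ j → j ℕ.* j ≡ suc (2 ℕ.* m ℕ.* suc j)) (≡.sym q≡)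
                (solveℕ 1 (λ m → (conℕ 1 ⊹ conℕ 2 ⊛ m) ⊛ (conℕ 1 ⊹ conℕ 2 ⊛ m) ≔
                  conℕ 1 ⊹ conℕ 2 ⊛ m ⊛ (conℕ 2 ⊹ conℕ 2 ⊛ m)) ≡.refl m)
                where
                open ℕ-Solver.+-*-Solver using () renaming (solve to solveℕ; _:=_ to _≔_; _:+_ to _⊹_; _:*_ to _⊛_; con to conℕ)

        new-root⇒V : (∀ x → ¬ γ S.≈ θ x) → IsRoot (V (suc m)) b
        new-root⇒V new = V-vanishes (new⇒γᵠ≈conj new)

        new-root-order : (∀ x → ¬ γ S.≈ θ x) → γ S.≉ S.0# → IsRoot Λ b →
          ∀ k → 1 ≤ k → γ ExpS.^ k S.≈ S.1# → q ℕ.^ 2 ≤ suc k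
        new-root-order new γ≉0 Λ-root k 1≤k γᵏ≈1 = ≡.subst (_≤ suc k) (≡.cong (q ℕ.*_) (≡.sym (ℕ.*-identityʳ q)))
          (order-of-γ γ≉0 (new⇒γᵠ≈conj new) Λ-root k 1≤k γᵏ≈1)

-- The roots of I and P at a primitive c

module Conclusion {a ℓ q} (F : FiniteField a ℓ q) (m : ℕ) (q≡ : q ≡ suc (2 ℕ.* m))
  (c : FiniteField.Carrier F) (c-primitive : FiniteField.IsPrimitiveElement F c) where

  private
    R : CommutativeRing a ℓ
    R = FiniteField.commutativeRing F
    module F = FiniteField F
    module R[B] = Evaluation R
    module R[B,C] = Evaluation R[B].polynomialRing
    PB : CommutativeRing a ℓ
    PB = R[B].polynomialRing
    PBC : CommutativeRing a ℓ
    PBC = R[B,C].polynomialRing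
    module PB = CommutativeRing PB
    module PBC = CommutativeRing PBC
    module ExpB = Exp PB.commutativeSemiring
    module ExpBC = Exp PBC.commutativeSemiring
    N : ℕ
    N = suc q
  open CommutativeRing R
  open Enumerated F
  open Field R isDiscreteField
  open Evaluation R
  open Exp commutativeSemiring using (_^_; ^-distrib-*)
  open OddCardinality F m q≡
  open PrimitiveNorm c c-primitive

  quadratic-root : ∀ b r → IsRoot (quadratic b c) r → r * r + b * r + c ≈ 0#
  quadratic-root b r root = trans (sym (QuadraticIdentities.quadratic-eval R b c 1# r refl)) root

  module _ (b r : Carrier) (root : IsRoot (quadratic b c) r) where

    private
      s : Carrier
      s = - b + - r
      root′ : r * r + b * r + c ≈ 0#
      root′ = quadratic-root b r root
      rs≈c : r * s ≈ c
      rs≈c = Frobenius.γ*conjugate F c-primitive R (λ x → x) id-isHom domain F.1≉0 b c r root′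
      eval-V : ∀ n → eval (V n) b ≈ r ^ n + s ^ n
      eval-V = Specialised.eval-lucasV R c R (λ x → x) id-isHom b r root′

    rooted⇒V-m : IsRoot (V m) b
    rooted⇒V-m = trans (eval-V m) (split-V-m r s rs≈c)

    rooted⇒¬V-suc-m : ¬ IsRoot (V (suc m)) b
    rooted⇒¬V-suc-m z = split-V-suc-m r s rs≈c (trans (sym (eval-V (suc m))) z)

  module Rootless (b : Carrier) (rootless : ∀ x → ¬ IsRoot (quadratic b c) x) where

    open QuadraticField F b c rootless using (quadraticField; extensionField; isDiscreteFieldExtension) public
    open QuadraticExtension R b c public
    module L = CommutativeRing quadraticExtension

    root₁-new : ∀ x → ¬ root₁ L.≈ ι x
    root₁-new x p = F.1≉0 (proj₂ p)

    rootless⇒V-suc-m : IsRoot (V (suc m)) b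
    rootless⇒V-suc-m = InExtension.new-root⇒V quadraticExtension isDiscreteFieldExtension
      ι-isHom proj₁ b root₁ root₁-root root₁-new

  -- For `k ≥ 1` the leading coefficient of `V k` is `(-1) ^ k`, and the sign makes it 1. The index
  -- `N / 2` gives `I q`; the index `m` gives the companion factor in the count of roots.
  signedV : ℕ → List Carrier
  signedV k = F.specialise ((PBC.- PBC.1#) ExpBC.^ k PBC.* F.lucasV k) c

  private
    sign : ℕ → Carrier
    sign k = (- 1#) ^ k

    sign² : ∀ k → sign k * sign k ≈ 1#
    sign² k = trans (sym (^-distrib-* (- 1#) (- 1#) k)) (Powers.^≈1 R k
      (trans (QuadraticIdentities.neg-*-neg R (- 1#)) (AbelianGroupProperties.⁻¹-involutive +-abelianGroup 1#)))

    sign≉0 : ∀ k → sign k ≉ 0#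
    sign≉0 k z = F.1≉0 (trans (sym (sign² k)) (trans (*-congʳ z) (zeroˡ _)))

    const-* : ∀ x f i → (const x *ₚ f) ! i ≈ x * f ! i
    const-* x f i = trans (!-*-∷ x [] f i) (trans (+-congˡ (shift-0 {[]} (λ _ → refl) i)) (+-identityʳ _))

  signedV≈ : ∀ k → signedV k ≈ₚ const (sign k) *ₚ V k
  signedV≈ k i = trans (at-c.*-homo ((PBC.- PBC.1#) ExpBC.^ k) (F.lucasV k) i)
    (PB.*-cong {F.specialise ((PBC.- PBC.1#) ExpBC.^ k) c} {const (sign k)} {V k} {V k} signs (λ _ → refl) i)
    where
    module at-c = IsHom PBC PB (R[B,C].eval-isHom (const c))
    module const = IsHom R PB const-isHom
    base : F.specialise (PBC.- PBC.1#) c ≈ₚ const (- 1#)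
    base i = trans (at-c.-‿homo PBC.1# i) (PB.-‿cong {F.specialise PBC.1# c} {PB.1#} at-c.1#-homo i)
    signs : F.specialise ((PBC.- PBC.1#) ExpBC.^ k) c ≈ₚ const (sign k)
    signs i = trans (at-c.^-homo (PBC.- PBC.1#) k i)
      (trans (ExpB.^-congˡ k {F.specialise (PBC.- PBC.1#) c} {const (- 1#)} base i) (sym (const.^-homo (- 1#) k i)))

  eval-signedV : ∀ k b → eval (signedV k) b ≈ sign k * eval (V k) b
  eval-signedV k b = trans (eval-cong (signedV k) (const (sign k) *ₚ V k) (signedV≈ k) refl)
    (trans (eval-* (const (sign k)) (V k) b) (*-congʳ (eval-const (sign k) b)))

  V⇒signedV : ∀ k b → IsRoot (V k) b → IsRoot (signedV k) b
  V⇒signedV k b z = trans (eval-signedV k b) (trans (*-congˡ z) (zeroʳ _))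

  signedV⇒V : ∀ k b → IsRoot (signedV k) b → IsRoot (V k) b
  signedV⇒V k b z = Sum.[ (λ s≈0 → contradiction s≈0 (sign≉0 k)) , (λ v≈0 → v≈0) ]′
    (domain (sign k) (eval (V k) b) (trans (sym (eval-signedV k b)) z))

  private
    module Leading = LeadingTerms R c
    open Leading.HasLeadingTerm

  -- For `k ≥ 1` the summand `0# ^ k` drops out of the leading coefficient `0# ^ k + (- 1#) ^ k` of
  -- `V k`. For `k = 0` the polynomial is the constant 2.
  signedV-monic : ∀ k → 1 ≤ k → IsMonicOfDegree (signedV k) k
  signedV-monic (suc k) _ =
    trans (signedV≈ (suc k) (suc k)) (trans (const-* (sign (suc k)) (V (suc k)) (suc k))
      (trans (*-congˡ (trans (lead h) (trans (+-congʳ (zeroˡ _)) (+-identityˡ _)))) (sign² (suc k)))) ,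
    λ j l → trans (signedV≈ (suc k) j) (trans (const-* (sign (suc k)) (V (suc k)) j)
      (trans (*-congˡ (degree₁ h j l)) (zeroʳ _)))
    where
    h : Leading.HasLeadingTerm _ (suc k) _
    h = Leading.lucasV-leading (suc k)

  -- The leading coefficient is the form at `(0 , -1)`, that is, `(-1) ^ φ N` times the form at
  -- `(0 , 1)`, and both factors are 1.
  Λ-monic : IsMonicOfDegree Λ (φ N)
  Λ-monic = trans (lead h) (trans (C.Φʰ-cong N (sym (zeroʳ (- 1#))) (sym (*-identityʳ (- 1#))))
      (trans (C.Φʰ-dilate N (s≤s z≤n) (- 1#) 0# 1#)
      (trans (*-cong [-1]^φN≈1 (C.Φʰ-0 N 2≤N)) (*-identityˡ 1#)))) , degree₁ h
    where
    module C = CyclotomicOver R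
    h : Leading.HasLeadingTerm _ (φ N) _
    h = Leading.lucasAtom-leading N (F.P q) P-isLucasAtom

  private
    -- The factorisation of `x^(N/2) + y^(N/2)` takes place in the extension `Sp.T`, with a cofactor
    -- `w` there. As `ι Λ` has zero second component, comparing first components gives a
    -- factorisation already over `R[B]`.
    cofactor : ∃[ u ] Λ *ₚ u ≈ₚ V (suc m)
    cofactor = proj₁ w , λ i → trans (sym (QuadraticIdentities.drop-0 PB (Λ *ₚ proj₁ w) (const c) i)) (proj₁ product i)
      where
      module Sp = Specialised R c
      module T = CommutativeRing Sp.T
      module ExpT = Exp T.commutativeSemiring
      half : ∃[ w ] CyclotomicOver.Φʰ Sp.T (2 ℕ.* suc m) Sp.root₁ Sp.root₂ T.* w T.≈ Sp.root₁ ExpT.^ suc m T.+ Sp.root₂ ExpT.^ suc m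
      half = CyclotomicOver.Φʰ-half Sp.T (suc m) (s≤s z≤n) Sp.root₁ Sp.root₂
      w : T.Carrier
      w = proj₁ half
      product : Sp.ι Λ T.* w T.≈ Sp.ι (V (suc m))
      product = QuadraticIdentities.cofactor-resp Sp.T (Sp.ι Λ) (CyclotomicOver.Φʰ Sp.T (2 ℕ.* suc m) Sp.root₁ Sp.root₂) w
        (Sp.root₁ ExpT.^ suc m T.+ Sp.root₂ ExpT.^ suc m) (Sp.ι (V (suc m)))
        (≡.subst (λ n → Sp.ι Λ T.≈ CyclotomicOver.Φʰ Sp.T n Sp.root₁ Sp.root₂) N≡
          (Sp.specialise-lucasAtom N (F.P q) P-isLucasAtom))
        (proj₂ half) (Sp.specialise-lucasV (suc m))

    u : List Carrier
    u = proj₁ cofactor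

    signed-u : List Carrier
    signed-u = const (sign (suc m)) *ₚ u

    Λ*signed-u≈ : Λ *ₚ signed-u ≈ₚ signedV (suc m)
    Λ*signed-u≈ i = trans (sym (Rearrangement.*-factorʳ PB (const (sign (suc m))) (V (suc m)) Λ u (λ j → sym (proj₂ cofactor j)) i))
      (sym (signedV≈ (suc m) i))

  Λ⇒V-suc-m : ∀ b → IsRoot Λ b → IsRoot (V (suc m)) b
  Λ⇒V-suc-m b z = trans (sym (eval-cong (Λ *ₚ u) (V (suc m)) (proj₂ cofactor) refl))
    (trans (eval-* Λ u b) (trans (*-congʳ z) (zeroˡ _)))

  V-suc-m⇒rootless : ∀ b → IsRoot (V (suc m)) b → ∀ x → ¬ IsRoot (quadratic b c) x
  V-suc-m⇒rootless b z x root = rooted⇒¬V-suc-m b x root z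

  I⇔irreducible : ∀ b → IsRoot (signedV (suc m)) b ⇔ IsIrreducible (quadratic b c)
  I⇔irreducible b = mk⇔
    (λ z → rootless⇒irreducible b c (V-suc-m⇒rootless b (signedV⇒V (suc m) b z)))
    (λ irr → V⇒signedV (suc m) b (Rootless.rootless⇒V-suc-m b (irreducible⇒rootless b c irr)))

  private
    iroots : List Carrier
    iroots = filter (root? (signedV (suc m))) elements

    length-iroots : length iroots ≡ suc m
    length-iroots = length-roots-of-factor (signedV (suc m)) (signedV m)
      (signedV-monic (suc m) (s≤s z≤n)) (signedV-monic m 1≤m) elements elements-unique
      (≡.trans length-elements (≡.trans q≡ (≡.cong (λ k → suc (m ℕ.+ k)) (ℕ.+-identityʳ m))))
      (All.universal (λ b → trans (eval-* (signedV (suc m)) (signedV m) b) (vanish b (root-exists? (quadratic b c)))) elements)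
      where
      vanish : ∀ b → Dec (∃[ x ] IsRoot (quadratic b c) x) → eval (signedV (suc m)) b * eval (signedV m) b ≈ 0#
      vanish b (yes (r , root)) = trans (*-congˡ (V⇒signedV m b (rooted⇒V-m b r root))) (zeroʳ _)
      vanish b (no none)        = trans (*-congʳ (V⇒signedV (suc m) b
        (Rootless.rootless⇒V-suc-m b (λ x root → none (x , root))))) (zeroˡ _)

    ∈-iroots : ∀ b → IsRoot Λ b → F._∈_ b iroots
    ∈-iroots b z = MembershipProperties.∈-filter⁺ setoid (root? (signedV (suc m)))
      (λ x≈y r → trans (sym (eval-cong (signedV (suc m)) (signedV (suc m)) (λ _ → refl) x≈y)) r)
      (∈-elements b) (V⇒signedV (suc m) b (Λ⇒V-suc-m b z))

    iroots-unique : F.Unique iroots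
    iroots-unique = UniqueProperties.filter⁺ setoid (root? (signedV (suc m))) elements-unique

    signed-u-monic : φ N ≤ suc m × IsMonicOfDegree signed-u (suc m ∸ φ N)
    signed-u-monic = isMonic-cofactor F.1≉0 Λ signed-u Λ-monic
      (isMonic-resp (signedV (suc m)) (Λ *ₚ signed-u) (λ i → sym (Λ*signed-u≈ i)) (signedV-monic (suc m) (s≤s z≤n)))

    -- The count of roots of a factor again, now among the roots of `signedV (suc m)` instead of all
    -- elements; their number is the degree of `Λ *ₚ signed-u`.
    length-Λ-roots : length (filter (root? Λ) iroots) ≡ φ N
    length-Λ-roots = length-roots-of-factor Λ signed-u Λ-monic (proj₂ signed-u-monic) iroots iroots-unique
      (≡.trans length-iroots (≡.sym (ℕ.m+[n∸m]≡n (proj₁ signed-u-monic))))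
      (All.map (λ {b} z → trans (eval-cong (Λ *ₚ signed-u) (signedV (suc m)) Λ*signed-u≈ refl) z)
        (AllProperties.all-filter (root? (signedV (suc m))) elements))

  I-hasRoots : F.HasRoots (signedV (suc m)) (suc m)
  I-hasRoots = hasRoots (signedV (suc m)) elements elements-unique (λ b _ → ∈-elements b) length-iroots

  Λ-hasRoots : F.HasRoots Λ (φ N)
  Λ-hasRoots = hasRoots Λ iroots iroots-unique ∈-iroots length-Λ-roots

  Λ≈fromRoots : Λ ≈ₚ fromRoots (proj₁ Λ-hasRoots)
  Λ≈fromRoots = fromRoots-complete Λ Λ-monic (filter (root? Λ) iroots) length-Λ-roots
    (UniqueProperties.filter⁺ setoid (root? Λ) iroots-unique) (AllProperties.all-filter (root? Λ) iroots)

  private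
    quadratic-degree : ∀ b k → F.IsMonicOfDegree (quadratic b c) k → k ≡ 2
    quadratic-degree b k k-monic = isMonic-unique F.1≉0 (quadratic b c) k-monic (quadratic-monic b c)

  -- A monic quadratic has no other degree than 2, so the extension has `q²` elements and `γ` has
  -- order `q² - 1 = 2 m N`. Hence `γ ^ (2 m)` has order exactly `N`; in particular it is not 1,
  -- which rules out `γ ^ q = γ`.
  primitive⇒Λ : ∀ b → IsPrimitivePolynomial F (quadratic b c) → IsRoot Λ b
  primitive⇒Λ b (k , _ , k-monic , E , γ , γ-primitive , _ , _ , γ-root , _) =
    at-2 k (quadratic-degree b k k-monic) E γ γ-primitive γ-root
    where
    at-2 : ∀ k → k ≡ 2 → (E : Extension F k) → let open Extension E in
      ∀ γ → L.IsPrimitiveElement γ → L.IsRoot (map embed (quadratic b c)) γ → IsRoot Λ b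
    at-2 k ≡.refl E γ γ-primitive γ-root = Λ-vanishes γ-root′ γᵠ≈conj full proper
      where
      open Extension E
      module S = CommutativeRing L.commutativeRing
      module ExpS = Exp S.commutativeSemiring
      module En = Enumerated L
      module SF = IsDiscreteField En.isDiscreteField
      module Pr = En.Primitive γ-primitive
      module θ = RingMorphisms.IsRingMonomorphism isMonomorphism
      open InExtension L.commutativeRing En.isDiscreteField θ.isRingHomomorphism θ.injective b γ
      γ-root′ : γ S.* γ S.+ embed b S.* γ S.+ embed c S.≈ S.0#
      γ-root′ = S.trans (S.sym (QuadraticIdentities.quadratic-eval L.commutativeRing (embed b) (embed c) (embed 1#) γ θ.1#-homo)) γ-root
      γ≉0 : γ S.≉ S.0#
      γ≉0 = proj₁ γ-primitive
      q²≡ : q ℕ.^ 2 ≡ suc (2 ℕ.* m ℕ.* N)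
      q²≡ = ≡.subst (λ j → j ℕ.* (j ℕ.* 1) ≡ suc (2 ℕ.* m ℕ.* suc j)) (≡.sym q≡)
        (solveℕ 1 (λ m → (conℕ 1 ⊹ conℕ 2 ⊛ m) ⊛ ((conℕ 1 ⊹ conℕ 2 ⊛ m) ⊛ conℕ 1) ≔
          conℕ 1 ⊹ conℕ 2 ⊛ m ⊛ (conℕ 2 ⊹ conℕ 2 ⊛ m)) ≡.refl m)
        where
        open ℕ-Solver.+-*-Solver using () renaming (solve to solveℕ; _:=_ to _≔_; _:+_ to _⊹_; _:*_ to _⊛_; con to conℕ)
      2m>0 : ℕ.NonZero (2 ℕ.* m)
      2m>0 = ℕ.>-nonZero (ℕ.≤-trans 1≤m (ℕ.m≤m+n m (m ℕ.+ 0)))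
      full : γ ExpS.^ (2 ℕ.* m ℕ.* N) S.≈ S.1#
      full = S.trans (ExpS.^-congʳ γ (≡.cong ℕ.pred (≡.sym q²≡))) Pr.gᵠ⁻¹≈1
      order : ∀ d → 1 ≤ d → γ ExpS.^ (2 ℕ.* m ℕ.* d) S.≈ S.1# → N ≤ d
      order d 1≤d one = ℕ.*-cancelˡ-≤ (2 ℕ.* m) {{2m>0}} (ℕ.s≤s⁻¹ (≡.subst (_≤ suc (2 ℕ.* m ℕ.* d)) q²≡
        (Pr.order-≥ (2 ℕ.* m ℕ.* d) (ℕ.*-mono-≤ (ℕ.≤-trans 1≤m (ℕ.m≤m+n m (m ℕ.+ 0))) 1≤d) one)))
      proper : ∀ d → 1 ≤ d → d < N → ¬ γ ExpS.^ (2 ℕ.* m ℕ.* d) S.≈ S.1#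
      proper d 1≤d d<N one = ℕ.<⇒≱ d<N (order d 1≤d one)
      γᵠ≈conj : γ ExpS.^ q S.≈ conj γ-root′
      γᵠ≈conj = Sum.[ (λ γᵠ≈γ → contradiction (order 1 ℕ.≤-refl (S.trans (ExpS.^-congʳ γ (ℕ.*-identityʳ (2 ℕ.* m)))
            (Field.*-cancelˡ L.commutativeRing En.isDiscreteField γ γ≉0
              (S.trans (ExpS.^-congʳ γ (≡.sym q≡)) (S.trans γᵠ≈γ (S.sym (S.*-identityʳ γ))))))) (ℕ.<⇒≱ 2≤N))
        , (λ p → p) ]′
        (Frobenius.γᵠ≈γ⊎conjugate F c-primitive L.commutativeRing embed θ.isRingHomomorphism SF.domain SF.1≉0 b c γ γ-root′)

  -- A root of `Λ` is a root of `V (suc m)`, so the quadratic is rootless and adjoining `root₁`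
  -- yields a field. The order of `root₁` is large enough to make it a generator, and its minimal
  -- polynomial has degree 2 because 1 and `root₁` are independent.
  Λ⇒primitive : ∀ b → IsRoot Λ b → IsPrimitivePolynomial F (quadratic b c)
  Λ⇒primitive b z = 2 , s≤s z≤n , quadratic-monic b c , extensionField , root₁ ,
    Enumerated.primitive-of-order quadraticField root₁ root₁≉0
      (InExtension.new-root-order quadraticExtension isDiscreteFieldExtension
        ι-isHom proj₁ b root₁ root₁-root root₁-new root₁≉0 z) ,
    2 , quadratic-monic b c ,
    L.trans {F′.eval (map ι (quadratic b c)) root₁} {root₁ L.* root₁ L.+ ι b L.* root₁ L.+ ι c} {L.0#}
      (QuadraticIdentities.quadratic-eval quadraticExtension (ι b) (ι c) (ι 1#) root₁ (refl , refl)) root₁-root ,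
    minimal
    where
    open Rootless b (V-suc-m⇒rootless b (Λ⇒V-suc-m b z))
    module F′ = FiniteField quadraticField
    root₁≉0 : root₁ L.≉ L.0#
    root₁≉0 p = F.1≉0 (proj₂ p)
    minimal : ∀ g n → F.IsMonicOfDegree g n → F′.IsRoot (map ι g) root₁ → 2 ≤ n
    minimal g n g-monic g-root = bound n g-monic
      where
      -- `g` is replaced by a list of exactly two entries, on which evaluation at `root₁` computes
      -- componentwise.
      shape : ∀ u v → g ≈ₚ u ∷ v ∷ [] → F′.eval (map ι (u ∷ v ∷ [])) root₁ L.≈ L.0#
      shape u v g≈ = L.trans {F′.eval (map ι (u ∷ v ∷ [])) root₁} {F′.eval (map ι g) root₁} {L.0#}
        (Evaluation.eval-cong quadraticExtension (map ι (u ∷ v ∷ [])) (map ι g) {root₁} {root₁}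
          (IsHom.⟦⟧-cong PB (PolynomialRing.polynomialRing quadraticExtension)
            (MapHom.map-isHom R quadraticExtension ι-isHom) {u ∷ v ∷ []} {g} (λ i → sym (g≈ i)))
          (L.refl {root₁}))
        g-root
      bound : ∀ n → F.IsMonicOfDegree g n → 2 ≤ n
      bound zero (lead , above) = contradiction (trans (sym (eval-1 1#)) (proj₁ (shape 1# 0# g≈))) F.1≉0
        where
        g≈ : g ≈ₚ 1# ∷ 0# ∷ []
        g≈ zero          = lead
        g≈ (suc zero)    = above 1 (s≤s z≤n)
        g≈ (suc (suc i)) = above (suc (suc i)) (s≤s z≤n)
        eval-1 : ∀ x → proj₁ (F′.eval (map ι (x ∷ 0# ∷ [])) root₁) ≈ x
        eval-1 x = QuadraticIdentities.first-component R b c x 0# refl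
      bound (suc zero) (lead , above) = contradiction (trans (sym (eval-2 (g ! 0) 1#)) (proj₂ (shape (g ! 0) 1# g≈))) F.1≉0
        where
        g≈ : g ≈ₚ g ! 0 ∷ 1# ∷ []
        g≈ zero          = refl
        g≈ (suc zero)    = lead
        g≈ (suc (suc i)) = above (suc (suc i)) (s≤s (s≤s z≤n))
        eval-2 : ∀ u v → proj₂ (F′.eval (map ι (u ∷ v ∷ [])) root₁) ≈ v
        eval-2 u v = QuadraticIdentities.second-component R b c v
      bound (suc (suc n)) _ = s≤s (s≤s z≤n)

  P⇔primitive : ∀ b → IsRoot Λ b ⇔ IsPrimitivePolynomial F (quadratic b c)
  P⇔primitive b = mk⇔ (Λ⇒primitive b) (primitive⇒Λ b)

  N/2≡ : suc q / 2 ≡ suc m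
  N/2≡ = ≡.trans (≡.cong (_/ 2) (≡.trans N≡ (ℕ.*-comm 2 (suc m)))) (m*n/n≡m (suc m) 2)

  -- The specialised `F.I q` is `signedV (suc q / 2)` by definition, so only the index has to be
  -- rewritten.
  I-theorem : F.HasRoots (F.specialise (F.I q) c) (suc q / 2) ×
    (∀ b → F.IsRoot (F.specialise (F.I q) c) b ⇔ F.IsIrreducible (F.quadratic b c))
  I-theorem = ≡.subst (λ k → F.HasRoots (signedV k) k × (∀ b → F.IsRoot (signedV k) b ⇔ F.IsIrreducible (F.quadratic b c)))
    (≡.sym N/2≡) (I-hasRoots , I⇔irreducible)

-- Parity of q, and the theorem

odd-power : ∀ p k → Prime p → p ≢ 2 → ¬ 2 ∣ p ℕ.^ k
odd-power p zero    p-prime p≢2 2∣1 with Div.∣1⇒≡1 2∣1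
... | ()
odd-power p (suc k) p-prime p≢2 2∣pᵏ = Sum.[ (λ 2∣p → Sum.[ (λ ()) , (λ 2≡p → p≢2 (≡.sym 2≡p)) ]′ (prime⇒irreducible p-prime 2∣p))
  , odd-power p k p-prime p≢2 ]′ (euclidsLemma p (p ℕ.^ k) prime[2] 2∣pᵏ)

odd⇒2m+1 : ∀ n → ¬ 2 ∣ n → ∃[ m ] n ≡ suc (2 ℕ.* m)
odd⇒2m+1 zero          odd = contradiction (divides 0 ≡.refl) odd
odd⇒2m+1 (suc zero)    odd = 0 , ≡.refl
odd⇒2m+1 (suc (suc n)) odd with odd⇒2m+1 n (λ { (divides k n≡) → odd (divides (suc k) (≡.cong (λ j → suc (suc j)) n≡)) })
... | m , n≡ = suc m , ≡.cong suc (≡.trans (≡.cong suc n≡) (2*suc m))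

open import Data.Nat using (_^_)

theorem5p4 : ∀ {a ℓ} (q p k : ℕ) → Prime p → p ≢ 2 → 1 ≤ k → q ≡ p ^ k →
    (F : FiniteField a ℓ q) →
    let open FiniteField F in
    IsLucasAtom (suc q) (P q) ×
    (∀ c → IsPrimitiveElement c →
    (HasRoots (specialise (I q) c) (suc q / 2) ×
    (∀ b → IsRoot (specialise (I q) c) b ⇔ IsIrreducible (quadratic b c))) ×
    (HasRoots (specialise (P q) c) (φ (suc q)) ×
    (∀ b → IsRoot (specialise (P q) c) b ⇔ IsPrimitivePolynomial F (quadratic b c)))) ×
    IsOptimalDetermining F (P q)
theorem5p4 q p k p-prime p≢2 _ q≡pᵏ F =
  OddCardinality.P-isLucasAtom F m q≡ ,
  (λ c c-primitive → let open Conclusion F m q≡ c c-primitive in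
    I-theorem , Λ-hasRoots , P⇔primitive) ,
  record
    { monic      = λ c c-primitive → φ (suc q) , Conclusion.Λ-monic F m q≡ c c-primitive
    ; squareFree = λ c c-primitive → let open Conclusion F m q≡ c c-primitive in
        Field.fromRoots-squareFree (FiniteField.commutativeRing F) (Enumerated.isDiscreteField F)
          (FiniteField.specialise F (FiniteField.P F q) c) (proj₁ Λ-hasRoots) Λ≈fromRoots (proj₁ (proj₂ Λ-hasRoots))
    ; roots      = λ c c-primitive → Conclusion.P⇔primitive F m q≡ c c-primitive
    ; product    = λ c c-primitive → let open Conclusion F m q≡ c c-primitive in
        proj₁ Λ-hasRoots , proj₁ (proj₂ Λ-hasRoots) ,
        (λ b → mk⇔
          (λ b∈ → Λ⇒primitive b (Equivalence.to (proj₂ (proj₂ (proj₂ Λ-hasRoots)) b) b∈))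
          (λ prim → Equivalence.from (proj₂ (proj₂ (proj₂ Λ-hasRoots)) b) (primitive⇒Λ b prim))) ,
        Λ≈fromRoots
    }
  where
  odd : ∃[ m ] q ≡ suc (2 ℕ.* m)
  odd = odd⇒2m+1 q (λ 2∣q → odd-power p k p-prime p≢2 (≡.subst (2 ∣_) q≡pᵏ 2∣q))
  m : ℕ
  m = proj₁ odd
  q≡ : q ≡ suc (2 ℕ.* m)
  q≡ = proj₂ odd
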